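{- There exist functions $r(n)=\Theta(\log n)$, $s(n)=\Theta(\sqrt{n}\log n)$ and $t(n)=\Theta(\log n)$ such that the following holds. Let $G=G_{n,r,s,t}$ with $r=r(n)$, $s=s(n)$, $t=t(n)$, let $M$ be the number of edges of $G$, and let $B_0$ be any tree of $G$ consisting entirely of zero-edges. Then the expected number of improving switches performed by $\textsc{Random-Facet}(E,B_0)$ is at least $e^{\Omega(\sqrt{n})}=e^{\Omega(M^{1/3}/\log M)}$.
   Context: The graph $G_{n,r,s,t}=(V,E,c)$, for positive integers $n,r,s,t$ and $\epsilon=1/(rs)$: the vertex set consists of a target $\mathsf{t}$, vertices $u_i,w_i$ ($i\in[n]$), $a_{i,j,k}$ ($i\in[n],j\in[r],k\in[s]$) and $b_{i,j}$ ($i\in[n],j\in[rs]$); write $u_{n+1}=w_{n+1}=\mathsf{t}$. The edges (all distinct elements of $E$, even when parallel) are, for $i\in[n]$ and $\ell\in[t]$: $a^1_{i,j,k}:a_{i,j,k}\to a_{i,j,k+1}$ of cost $0$ ($j\in[r],k\in[s-1]$); $a^1_{i,j,s}:a_{i,j,s}\to b_{i,1}$ of cost $0$; $a^{0,\ell}_{i,j,k}:a_{i,j,k}\to u_{i+1}$ of cost $2^{2i+1}+(k-1)\epsilon$ ($j\in[r],k\in[s]$); $b^1_{i,j}:b_{i,j}\to b_{i,j+1}$ of cost $0$ ($j\in[rs-1]$); $b^1_{i,rs}:b_{i,rs}\to w_{i+1}$ of cost $0$; $b^{0,\ell}_{i,j}:b_{i,j}\to u_{i+1}$ of cost $2^{2i+1}+1+(j-1)\epsilon$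 ($j\in[rs]$); $u^{1,\ell}_i:u_i\to b_{i,1}$ of cost $0$; $u^{0,\ell}_i:u_i\to u_{i+1}$ of cost $2^{2i}$; $w^{j,\ell}_i:w_i\to a_{i,j,1}$ of cost $0$ ($j\in[r]$); $w^{0,\ell}_i:w_i\to w_{i+1}$ of cost $2^{2i}$. The graph is acyclic. The edges named $a^{0,\ell}_{i,j,k},b^{0,\ell}_{i,j},u^{0,\ell}_i,w^{0,\ell}_i$ are called zero-edges. A tree is a set $B\subseteq E$ containing exactly one edge leaving each vertex other than $\mathsf{t}$. For a tree $B$ and vertex $u$, $y_B(u)$ is the total cost of the path from $u$ to $\mathsf{t}$ using edges of $B$. An edge $e=(u,v)$ is an improving switch with respect to $B$ if $c(e)+y_B(v)<y_B(u)$; then $B[e]$ denotes the tree obtained from $B$ by replacing the edge leaving $u$ by $e$ (performing the switch). $\textsc{Random-Facet}(F,B)$, for $B\subseteq F\subseteq E$ with $B$ a tree: if $F=B$ return $B$. Otherwise choose $e\in F\setminus B$ uniformly at random, let $B'=\textsc{Random-Facet}(F\setminus\{e\},B)$; if $e$ is an improving switch with respect to $B'$, perform it and return $\textsc{Random-Facet}(F,B'[e])$, otherwise return $B'$. The number of improving switches performed counts all switches $B'\mapsto B'[e]$ over all recursive calls. -}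

module Defs where

open import Data.Nat as ℕ using (ℕ; zero; suc)
open import Data.Fin as Fin using (Fin; toℕ)
open import Data.Bool using (T?; Bool; true; false; _∧_; not; if_then_else_)
open import Data.Maybe using (Maybe; just; nothing)
import Data.Maybe as Maybe
open import Data.List as List using (List; []; _∷_; _++_; concatMap; map; filter; length; allFin)
import Data.List.Properties as ListP
open import Data.Product using (Σ; _×_; _,_; proj₁; proj₂)
open import Data.Integer using (+_)
open import Data.Rational using (ℚ; _+_; _*_; _<_; _≤_; 0ℚ; 1ℚ; _/_)
open import Data.Rational.Properties using (_<?_)
open import Relation.Binary.PropositionalEquality using (_≡_; _≢_)
open import Relation.Nullary using (¬_; Dec; yes; no; does)

sucFin : ∀ {m} → Fin m → Maybe (Fin m)
sucFin {suc zero} Fin.zero = nothing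
sucFin {suc (suc m)} Fin.zero = just (Fin.suc Fin.zero)
sucFin {suc m} (Fin.suc i) = Maybe.map Fin.suc (sucFin i)

firstFin : (m : ℕ) → Maybe (Fin m)
firstFin zero = nothing
firstFin (suc m) = just Fin.zero

ℕtoℚ : ℕ → ℚ
ℕtoℚ k = (+ k) / 1

_^ℚ_ : ℚ → ℕ → ℚ
q ^ℚ zero = 1ℚ
q ^ℚ suc k = q * (q ^ℚ k)

-- The graph G_{n,r,s,t}.  Indices are 0-based: Fin n index i stands for
-- the paper's index i+1 (similarly for j, k, ℓ).

module Graph (n r s t : ℕ) where

  data Vtx : Set where
    tgt : Vtx
    u w : Fin n → Vtx
    a   : Fin n → Fin r → Fin s → Vtx
    b   : Fin n → Fin (r ℕ.* s) → Vtx

  code : Vtx → List ℕ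
  code tgt = 0 ∷ []
  code (u i) = 1 ∷ toℕ i ∷ []
  code (w i) = 2 ∷ toℕ i ∷ []
  code (a i j k) = 3 ∷ toℕ i ∷ toℕ j ∷ toℕ k ∷ []
  code (b i j) = 4 ∷ toℕ i ∷ toℕ j ∷ []

  _==_ : Vtx → Vtx → Bool
  v == v' = does (ListP.≡-dec ℕ._≟_ (code v) (code v'))

  nextU nextW : Fin n → Vtx
  nextU i with sucFin i
  ... | just i' = u i'
  ... | nothing = tgt
  nextW i with sucFin i
  ... | just i' = w i'
  ... | nothing = tgt

  -- b_{i,1}  (r*s ≥ 1 in the theorem, so the fallback is never used)
  bFirst : Fin n → Vtx
  bFirst i with firstFin (r ℕ.* s)
  ... | just j = b i j
  ... | nothing = tgt

  ε : ℚ
  ε with r ℕ.* s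
  ... | zero = 0ℚ
  ... | suc m = (+ 1) / suc m

  -- the paper's i (1-based) for a 0-based index
  ix : Fin n → ℕ
  ix i = suc (toℕ i)

  data EdgeLabel : Set where
    a1 : Fin n → Fin r → Fin s → EdgeLabel
    a0 : Fin n → Fin r → Fin s → Fin t → EdgeLabel
    b1 : Fin n → Fin (r ℕ.* s) → EdgeLabel
    b0 : Fin n → Fin (r ℕ.* s) → Fin t → EdgeLabel
    u1 : Fin n → Fin t → EdgeLabel
    u0 : Fin n → Fin t → EdgeLabel
    wj : Fin n → Fin r → Fin t → EdgeLabel
    w0 : Fin n → Fin t → EdgeLabel

  src : EdgeLabel → Vtx
  src (a1 i j k) = a i j k
  src (a0 i j k ℓ) = a i j k
  src (b1 i j) = b i j
  src (b0 i j ℓ) = b i j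
  src (u1 i ℓ) = u i
  src (u0 i ℓ) = u i
  src (wj i j ℓ) = w i
  src (w0 i ℓ) = w i

  dst : EdgeLabel → Vtx
  dst (a1 i j k) with sucFin k
  ... | just k' = a i j k'
  ... | nothing = bFirst i
  dst (a0 i j k ℓ) = nextU i
  dst (b1 i j) with sucFin j
  ... | just j' = b i j'
  ... | nothing = nextW i
  dst (b0 i j ℓ) = nextU i
  dst (u1 i ℓ) = bFirst i
  dst (u0 i ℓ) = nextU i
  dst (wj i j ℓ) with firstFin s
  ... | just k = a i j k
  ... | nothing = tgt
  dst (w0 i ℓ) = nextW i

  cost : EdgeLabel → ℚ
  cost (a1 i j k) = 0ℚ
  cost (a0 i j k ℓ) = ℕtoℚ (2 ℕ.^ (2 ℕ.* ix i ℕ.+ 1)) + ℕtoℚ (toℕ k) * ε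
  cost (b1 i j) = 0ℚ
  cost (b0 i j ℓ) = ℕtoℚ (2 ℕ.^ (2 ℕ.* ix i ℕ.+ 1) ℕ.+ 1) + ℕtoℚ (toℕ j) * ε
  cost (u1 i ℓ) = 0ℚ
  cost (u0 i ℓ) = ℕtoℚ (2 ℕ.^ (2 ℕ.* ix i))
  cost (wj i j ℓ) = 0ℚ
  cost (w0 i ℓ) = ℕtoℚ (2 ℕ.^ (2 ℕ.* ix i))

  isZeroEdge : EdgeLabel → Bool
  isZeroEdge (a0 _ _ _ _) = true
  isZeroEdge (b0 _ _ _) = true
  isZeroEdge (u0 _ _) = true
  isZeroEdge (w0 _ _) = true
  isZeroEdge _ = false

  allLabels : List EdgeLabel
  allLabels =
    concatMap (λ i →
         concatMap (λ j → concatMap (λ k → a1 i j k ∷ map (a0 i j k) (allFin t)) (allFin s)) (allFin r)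
      ++ concatMap (λ j → b1 i j ∷ map (b0 i j) (allFin t)) (allFin (r ℕ.* s))
      ++ map (u1 i) (allFin t) ++ map (u0 i) (allFin t)
      ++ concatMap (λ j → map (wj i j) (allFin t)) (allFin r)
      ++ map (w0 i) (allFin t)) (allFin n)

  M : ℕ
  M = length allLabels

  Edge : Set
  Edge = Fin M

  label : Edge → EdgeLabel
  label = List.lookup allLabels

  allEdges : List Edge
  allEdges = allFin M

  EdgeSet : Set
  EdgeSet = Edge → Bool

  fullSet : EdgeSet
  fullSet _ = true

  _≟E_ : Edge → Edge → Bool
  e ≟E e' = does (e Fin.≟ e')

  removeEdge : EdgeSet → Edge → EdgeSet
  removeEdge F e x = F x ∧ not (x ≟E e)

  -- A tree: exactly one edge leaving each vertex other than 𝗍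
  -- (and, since no edge leaves 𝗍, every chosen edge leaves a vertex ≠ 𝗍).
  IsTree : EdgeSet → Set
  IsTree B = ∀ (v : Vtx) → v ≢ tgt →
    Σ Edge λ e → (B e ≡ true × src (label e) ≡ v) ×
      (∀ e' → B e' ≡ true → src (label e') ≡ v → e' ≡ e)

  AllZeroEdges : EdgeSet → Set
  AllZeroEdges B = ∀ e → B e ≡ true → isZeroEdge (label e) ≡ true

  outEdge : EdgeSet → Vtx → Maybe Edge
  outEdge B v = List.head (filter (λ e → T? (B e ∧ (src (label e) == v))) allEdges)

  -- number of vertices (bound on the length of any path in the acyclic graph)
  numVtx : ℕ
  numVtx = 1 ℕ.+ n ℕ.+ n ℕ.+ n ℕ.* r ℕ.* s ℕ.+ n ℕ.* (r ℕ.* s)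

  yFuel : ℕ → EdgeSet → Vtx → ℚ
  yFuel zero B v = 0ℚ
  yFuel (suc f) B v with outEdge B v
  ... | nothing = 0ℚ
  ... | just e = cost (label e) + yFuel f B (dst (label e))

  -- y_B(v)   (for a tree B of the acyclic graph, the path has < numVtx edges)
  y : EdgeSet → Vtx → ℚ
  y = yFuel numVtx

  Improving : EdgeSet → Edge → Set
  Improving B e = cost (label e) + y B (dst (label e)) < y B (src (label e))

  switch : EdgeSet → Edge → EdgeSet
  switch B e x = if x ≟E e then true
                 else (if src (label x) == src (label e) then false else B x)

  diffList : EdgeSet → EdgeSet → List Edge
  diffList F B = filter (λ e → T? (F e ∧ not (B e))) allEdges

  -- Finite distributions over outcomes (final tree, number of improving switches)
  Dist : Set
  Dist = List (ℚ × EdgeSet × ℕ)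

  shift : ℚ → ℕ → Dist → Dist
  shift p k = map (λ { (q , B , m) → (p * q , B , k ℕ.+ m) })

  -- Big-step semantics of Random-Facet:  RF F B D  means that
  -- Random-Facet(F,B) returns final tree B' after m improving switches
  -- with the probability distribution D.
  data RF : EdgeSet → EdgeSet → Dist → Set
  -- continuation after the recursive call Random-Facet(F∖{e},B) returned distribution D
  data Cont (F : EdgeSet) (e : Edge) : Dist → Dist → Set
  data Branches (F B : EdgeSet) : List Edge → Dist → Set

  data RF where
    rf-done : ∀ {F B} → diffList F B ≡ [] → RF F B ((1ℚ , B , 0) ∷ [])
    rf-step : ∀ {F B D} {e : Edge} {es : List Edge} →
              diffList F B ≡ e ∷ es →
              Branches F B (e ∷ es) D →
              RF F B (shift ((+ 1) / suc (length es)) 0 D)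

  data Cont F e where
    c-nil : Cont F e [] []
    c-imp : ∀ {p B' k D D' R} → Improving B' e →
            RF F (switch B' e) D' → Cont F e D R →
            Cont F e ((p , B' , k) ∷ D) (shift p (suc k) D' ++ R)
    c-not : ∀ {p B' k D R} → ¬ Improving B' e → Cont F e D R →
            Cont F e ((p , B' , k) ∷ D) ((p , B' , k) ∷ R)

  data Branches F B where
    br-nil  : Branches F B [] []
    br-cons : ∀ {e es D D₁ R} → RF (removeEdge F e) B D → Cont F e D D₁ →
              Branches F B es R → Branches F B (e ∷ es) (D₁ ++ R)

  expectedSwitches : Dist → ℚ
  expectedSwitches = List.foldr (λ { (p , B , k) acc → p * ℕtoℚ k + acc }) 0ℚ

ThetaLog : (ℕ → ℕ) → Set
ThetaLog f = Σ ℕ λ c → Σ ℕ λ n₀ → ∀ n → n₀ ℕ.≤ n →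
  (⌊log₂ n ⌋ ℕ.≤ c ℕ.* f n) × (f n ℕ.≤ c ℕ.* ⌊log₂ n ⌋)
  where open import Data.Nat.Logarithm using (⌊log₂_⌋)

-- f(n) = Θ(√n log n), stated via squares:  n (log n)² ≍ f(n)²
ThetaSqrtLog : (ℕ → ℕ) → Set
ThetaSqrtLog f = Σ ℕ λ c → Σ ℕ λ n₀ → ∀ n → n₀ ℕ.≤ n →
  (n ℕ.* (⌊log₂ n ⌋ ℕ.* ⌊log₂ n ⌋) ℕ.≤ c ℕ.* (f n ℕ.* f n)) ×
  (f n ℕ.* f n ℕ.≤ c ℕ.* (n ℕ.* (⌊log₂ n ⌋ ℕ.* ⌊log₂ n ⌋)))
  where open import Data.Nat.Logarithm using (⌊log₂_⌋)

{-# OPTIONS --safe #-}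
-- The bits i whose b-edges are all present form a randomized counter.  If the first removed edge among them cuts chain b
-- of bit i, Random-Facet first counts with the remaining bits; when the edge returns, bit i gets set, and since u_i then
-- becomes cheap long before w_i, all lower bits reset to zero and are counted again.  With N bits this gives
-- f(N) = f(N-1) + (1/N) Σ_{ρ<N} f(ρ), and paths with exactly k resets contribute C(N,k)/k!, which is 2^Ω(√n) for k ≈ √n/2.
--
-- The counter fails only if all copies of some edge, or all chains a of some bit, disappear too early.  A penalty, the sum
-- over these groups of 2^(number of removed members), controls this.  The expected number of switches is bounded below by
-- C(N,k)/k! (1 - (1+1/m)^k N penalty/2^r), by induction on the run: dropping N to N-1 pays for the increase of the penalty
-- during counting, and the factor 1+1/m pays for the increase during one reset.  A removed edge of the chain currently
-- being completed costs nothing, as the same state is reached again after it returns.  Distances in optimal trees only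
-- depend on the edge set, so whether the removed edge becomes improving is decided without looking at the run.
module Submission where

open import Defs
open import Data.Nat using (ℕ; zero; suc; _!; _+_; _*_; _∸_; _^_; _≤_; _<_; z≤n; s≤s; _≤?_; _<?_; pred; ⌊_/2⌋; ⌈_/2⌉)
open import Data.Nat.Properties hiding (_≟_)
open import Data.Nat.Tactic.RingSolver using (solve-∀)
open import Data.Nat.Combinatorics using (_C_; nCk+nC[k+1]≡[n+1]C[k+1]; k>n⇒nCk≡0)
open import Data.Nat.Logarithm using (⌊log₂_⌋; ⌊log₂⌋-mono-≤; ⌊log₂⌊n/2⌋⌋≡⌊log₂n⌋∸1; ⌊log₂[2^n]⌋≡n)
open import Data.Nat.DivMod using (m≡m%n+[m/n]*n; m%n<n; m/n*n≤m)
import Data.Nat.DivMod as DivMod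
open import Algebra.Properties.CommutativeMonoid.Sum +-0-commutativeMonoid using (∑-distrib-+) renaming (sum to ∑; sum-cong-≗ to ∑-cong)
open import Data.Fin using (Fin; toℕ)
import Data.Fin as Fin
open import Data.Fin.Properties using (toℕ<n; toℕ-injective)
import Data.Fin.Properties as FinP
open import Data.Bool using (Bool; true; false; _∧_; not; if_then_else_; T; T?)
import Data.Bool.Properties as BoolP
open import Data.Maybe using (Maybe; just; nothing)
import Data.Maybe as Maybe
open import Data.List using (List; []; _∷_; _++_; concatMap; map; filter; length; allFin; lookup; tabulate; head)
import Data.Nat.ListAction as ListAction
import Data.List.Properties as ListP
open import Data.List.Membership.Propositional using (_∈_; _∉_)
open import Data.List.Membership.Propositional.Properties
open import Data.List.Relation.Unary.Any using (here; there; index)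
import Data.List.Relation.Unary.Any as Any
open import Data.List.Relation.Unary.Any.Properties using (lookup-index)
open import Data.List.Relation.Unary.All using (All; []; _∷_)
import Data.List.Relation.Unary.All as All
import Data.List.Relation.Unary.All.Properties as AllP
open import Data.List.Relation.Unary.AllPairs using ([]; _∷_)
open import Data.List.Relation.Unary.Unique.Propositional using (Unique)
import Data.List.Relation.Unary.Unique.Propositional.Properties as UniqueP
open import Data.Product using (Σ; _×_; _,_; proj₁; proj₂; ∃)
open import Data.Sum using (_⊎_; inj₁; inj₂)
open import Data.Empty using (⊥; ⊥-elim)
open import Data.Unit using (tt)
import Data.Integer as ℤ
import Data.Integer.Properties as ℤP
open import Data.Rational using (ℚ; 0ℚ; 1ℚ; _/_)
import Data.Rational as ℚ
import Data.Rational.Properties as ℚP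
import Data.Rational.Unnormalised as ℚᵘ
import Data.Rational.Unnormalised.Properties as ℚᵘP
open import Function using (_∘_; id; case_of_)
open import Relation.Nullary using (¬_; Dec; yes; no; does)
open import Relation.Nullary.Decidable using (dec-true; dec-false)
open import Relation.Binary.PropositionalEquality using (_≡_; _≢_; refl; sym; trans; cong; cong₂; subst; subst₂)
open import Data.Rational.Solver using (module +-*-Solver)

-- Finite sums and chains of indices

-- `RF` unfolds one random removal at a time, so no statement about the whole random order is at
-- hand: failure must be controlled by a quantity that can be averaged over a single removal.
-- Weights `2 ^ gaps` are of this kind, as losing one member at most doubles the weight of its
-- group. While `N` bits are counted with penalty `P`, all removals together raise the penalty by at
-- most `R * P`, and each of the `N * R` edges that cut an active bit lowers `N` by one; for the
-- error term `N * P` this is an exact balance. While a bit is being set no active bit is cut, and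
-- something else has to pay: an intact chain a offers `s` edges whose removal brings the reset
-- closer, against a total increase of at most `r * P`. Spreading one factor `1 + 1/m` over the `r`
-- chains balances this when `2 * r * r * m ≤ s`. With `m` of order √n / log n and `k` about √n / 2,
-- the factor `(1 + 1/m)ᵏ` stays polynomial in `n`, so that `2 ^ r` absorbs it, and `s` becomes √n
-- log n up to constants. Fixing `k` turns every averaging step into a polynomial inequality between
-- natural numbers.

∑-const : ∀ n c → ∑ {n} (λ _ → c) ≡ n * c
∑-const zero    c = refl
∑-const (suc n) c = cong (c +_) (∑-const n c)

∑-mono : ∀ {n} {f g : Fin n → ℕ} → (∀ i → f i ≤ g i) → ∑ f ≤ ∑ g
∑-mono {zero}  f≤g = z≤n
∑-mono {suc n} f≤g = +-mono-≤ (f≤g Fin.zero) (∑-mono (f≤g ∘ Fin.suc))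

∑-scale : ∀ {n} c (f : Fin n → ℕ) → ∑ (λ i → c * f i) ≡ c * ∑ f
∑-scale {zero}  c f = sym (*-zeroʳ c)
∑-scale {suc n} c f = trans (cong (c * f Fin.zero +_) (∑-scale c (f ∘ Fin.suc))) (sym (*-distribˡ-+ c (f Fin.zero) _))

term≤∑ : ∀ {n} (f : Fin n → ℕ) i → f i ≤ ∑ f
term≤∑ f Fin.zero    = m≤m+n _ _
term≤∑ f (Fin.suc i) = ≤-trans (term≤∑ (f ∘ Fin.suc) i) (m≤n+m _ _)

∑-bump : ∀ {n} (f g : Fin n → ℕ) i d → (∀ j → j ≢ i → f j ≤ g j) → f i ≤ g i + d → ∑ f ≤ ∑ g + d
∑-bump {suc n} f g Fin.zero d others at = begin
  f Fin.zero + ∑ (f ∘ Fin.suc)       ≤⟨ +-mono-≤ at (∑-mono (λ j → others (Fin.suc j) (λ ()))) ⟩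
  (g Fin.zero + d) + ∑ (g ∘ Fin.suc) ≡⟨ swap (g Fin.zero) d _ ⟩
  ∑ g + d                            ∎
  where
  open ≤-Reasoning
  swap : ∀ x y z → (x + y) + z ≡ (x + z) + y
  swap = solve-∀
∑-bump {suc n} f g (Fin.suc i) d others at = begin
  f Fin.zero + ∑ (f ∘ Fin.suc)       ≤⟨ +-mono-≤ (others Fin.zero (λ ()))
                                          (∑-bump (f ∘ Fin.suc) (g ∘ Fin.suc) i d
                                            (λ j j≢i → others (Fin.suc j) (j≢i ∘ FinP.suc-injective)) at) ⟩
  g Fin.zero + (∑ (g ∘ Fin.suc) + d) ≡⟨ +-assoc (g Fin.zero) _ d ⟨
  ∑ g + d                            ∎
  where open ≤-Reasoning

Σl : ∀ {A : Set} → List A → (A → ℕ) → ℕ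
Σl xs f = ListAction.sum (map f xs)

Σl-++ : ∀ {A : Set} (xs ys : List A) f → Σl (xs ++ ys) f ≡ Σl xs f + Σl ys f
Σl-++ []       ys f = refl
Σl-++ (x ∷ xs) ys f = trans (cong (f x +_) (Σl-++ xs ys f)) (sym (+-assoc (f x) _ _))

Σl-concatMap : ∀ {A B : Set} (g : A → List B) xs f → Σl (concatMap g xs) f ≡ Σl xs (λ x → Σl (g x) f)
Σl-concatMap g []       f = refl
Σl-concatMap g (x ∷ xs) f = trans (Σl-++ (g x) _ f) (cong (Σl (g x) f +_) (Σl-concatMap g xs f))

Σl-map : ∀ {A B : Set} (g : A → B) xs f → Σl (map g xs) f ≡ Σl xs (f ∘ g)
Σl-map g []       f = refl
Σl-map g (x ∷ xs) f = cong (f (g x) +_) (Σl-map g xs f)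

Σl-tabulate : ∀ {A : Set} {n} (g : Fin n → A) f → Σl (tabulate g) f ≡ ∑ (f ∘ g)
Σl-tabulate {n = zero}  g f = refl
Σl-tabulate {n = suc n} g f = cong (f (g Fin.zero) +_) (Σl-tabulate (g ∘ Fin.suc) f)

Σl-allFin : ∀ n f → Σl (allFin n) f ≡ ∑ f
Σl-allFin n f = Σl-tabulate id f

Σl-mono : ∀ {A : Set} (xs : List A) {f g : A → ℕ} → (∀ x → f x ≤ g x) → Σl xs f ≤ Σl xs g
Σl-mono []       f≤g = z≤n
Σl-mono (x ∷ xs) f≤g = +-mono-≤ (f≤g x) (Σl-mono xs f≤g)

Σl-mono-strict : ∀ {A : Set} (xs : List A) {f g : A → ℕ} {x} → x ∈ xs → (∀ x → f x ≤ g x) → f x < g x →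
  Σl xs f < Σl xs g
Σl-mono-strict (x ∷ xs) (here refl) f≤g fx<gx = +-mono-<-≤ fx<gx (Σl-mono xs f≤g)
Σl-mono-strict (y ∷ xs) (there x∈)  f≤g fx<gx = +-mono-≤-< (f≤g y) (Σl-mono-strict xs x∈ f≤g fx<gx)

Σl-+ : ∀ {A : Set} (xs : List A) (f g : A → ℕ) → Σl xs (λ x → f x + g x) ≡ Σl xs f + Σl xs g
Σl-+ []       f g = refl
Σl-+ (x ∷ xs) f g = trans (cong (f x + g x +_) (Σl-+ xs f g)) (interchange (f x) (g x) _ _)
  where
  interchange : ∀ a b c d → (a + b) + (c + d) ≡ (a + c) + (b + d)
  interchange = solve-∀

Σl-const : ∀ {A : Set} (xs : List A) c → Σl xs (λ _ → c) ≡ length xs * c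
Σl-const []       c = refl
Σl-const (x ∷ xs) c = cong (c +_) (Σl-const xs c)

Σl-scale : ∀ {A : Set} (xs : List A) c (f : A → ℕ) → Σl xs (λ x → c * f x) ≡ c * Σl xs f
Σl-scale []       c f = sym (*-zeroʳ c)
Σl-scale (x ∷ xs) c f = trans (cong (c * f x +_) (Σl-scale xs c f)) (sym (*-distribˡ-+ c (f x) _))

Σl-filter : ∀ {A : Set} (p : A → Bool) xs f →
  Σl (filter (λ x → T? (p x)) xs) f ≡ Σl xs (λ x → if p x then f x else 0)
Σl-filter p []       f = refl
Σl-filter p (x ∷ xs) f with p x
... | true  = cong (f x +_) (Σl-filter p xs f)
... | false = Σl-filter p xs f

allF : ∀ {m} → (Fin m → Bool) → Bool
allF {zero}  h = true
allF {suc m} h = h Fin.zero ∧ allF (h ∘ Fin.suc)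

∧-true : ∀ {x y} → x ∧ y ≡ true → x ≡ true × y ≡ true
∧-true {true} {true} refl = refl , refl

allF-elim : ∀ {m} (h : Fin m → Bool) → allF h ≡ true → ∀ i → h i ≡ true
allF-elim h all Fin.zero    = proj₁ (∧-true all)
allF-elim h all (Fin.suc i) = allF-elim (h ∘ Fin.suc) (proj₂ (∧-true {h Fin.zero} all)) i

allF-intro : ∀ {m} (h : Fin m → Bool) → (∀ i → h i ≡ true) → allF h ≡ true
allF-intro {zero}  h all = refl
allF-intro {suc m} h all = cong₂ _∧_ (all Fin.zero) (allF-intro (h ∘ Fin.suc) (all ∘ Fin.suc))

allF-counterexample : ∀ {m} (h : Fin m → Bool) → allF h ≡ false → ∃ λ i → h i ≡ false
allF-counterexample {suc m} h ¬all with h Fin.zero in eq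
... | false = Fin.zero , eq
... | true  with allF-counterexample (h ∘ Fin.suc) ¬all
...   | i , hi = Fin.suc i , hi

allF-cong : ∀ {m} {h h' : Fin m → Bool} → (∀ i → h i ≡ h' i) → allF h ≡ allF h'
allF-cong {zero}  e = refl
allF-cong {suc m} e = cong₂ _∧_ (e Fin.zero) (allF-cong (e ∘ Fin.suc))

gap : Bool → ℕ
gap true  = 0
gap false = 1

gaps : ∀ {m} → (Fin m → Bool) → ℕ
gaps h = ∑ (gap ∘ h)

gap-≤1 : ∀ x → gap x ≤ 1
gap-≤1 true  = z≤n
gap-≤1 false = s≤s z≤n

gaps-cong : ∀ {m} {h h' : Fin m → Bool} → (∀ i → h i ≡ h' i) → gaps h ≡ gaps h'
gaps-cong e = ∑-cong (cong gap ∘ e)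

gaps≤ : ∀ {m} (h : Fin m → Bool) → gaps h ≤ m
gaps≤ {m} h = ≤-trans (∑-mono (gap-≤1 ∘ h)) (≤-reflexive (trans (∑-const m 1) (*-identityʳ m)))

gaps<⇒∃ : ∀ {m} (h : Fin m → Bool) → gaps h < m → ∃ λ i → h i ≡ true
gaps<⇒∃ {suc m} h lt with h Fin.zero in eq
... | true  = Fin.zero , eq
... | false with gaps<⇒∃ (h ∘ Fin.suc) (≤-pred lt)
...   | i , hi = Fin.suc i , hi

∃⇒gaps< : ∀ {m} (h : Fin m → Bool) i → h i ≡ true → gaps h < m
∃⇒gaps< h Fin.zero    hi rewrite hi = s≤s (gaps≤ (h ∘ Fin.suc))
∃⇒gaps< {suc m} h (Fin.suc i) hi = begin-strict
  gap (h Fin.zero) + gaps (h ∘ Fin.suc) ≤⟨ +-monoˡ-≤ _ (gap-≤1 (h Fin.zero)) ⟩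
  suc (gaps (h ∘ Fin.suc))              <⟨ s≤s (∃⇒gaps< (h ∘ Fin.suc) i hi) ⟩
  suc m                                 ∎
  where open ≤-Reasoning

gaps-drop : ∀ {m} (h h' : Fin m → Bool) i → (∀ j → j ≢ i → h' j ≡ h j) → gaps h' ≤ suc (gaps h)
gaps-drop h h' i others = subst (gaps h' ≤_) (+-comm (gaps h) 1)
  (∑-bump (gap ∘ h') (gap ∘ h) i 1 (λ j j≢i → ≤-reflexive (cong gap (others j j≢i)))
    (≤-trans (gap-≤1 (h' i)) (m≤n+m 1 _)))

2^gaps-drop : ∀ {m} (h h' : Fin m → Bool) i → (∀ j → j ≢ i → h' j ≡ h j) →
  2 ^ gaps h' ≤ 2 ^ gaps h + 2 ^ gaps h
2^gaps-drop h h' i others = ≤-trans (^-monoʳ-≤ 2 (gaps-drop h h' i others))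
  (≤-reflexive (cong (2 ^ gaps h +_) (+-identityʳ _)))

sucFin-suc : ∀ {m} (j : Fin m) → sucFin (Fin.suc j) ≡ Maybe.map Fin.suc (sucFin j)
sucFin-suc {suc m} j = refl

≢-via : ∀ {A : Set} {x y z : A} → y ≡ x → z ≢ x → z ≢ y
≢-via y≡x z≢x z≡y = z≢x (trans z≡y y≡x)

-- Induction from the last index down to the first. Distances along a chain, and from bit to bit,
-- are determined from the target backwards, so the hypothesis must concern the successor.
chainInd : ∀ {m} (P : Fin m → Set) → (∀ j → (∀ j' → sucFin j ≡ just j' → P j') → P j) → ∀ j → P j
chainInd {suc m} P step = λ { Fin.zero → step Fin.zero (first m P later) ; (Fin.suc j) → later j }
  where
  shifted : ∀ j → (∀ j' → sucFin j ≡ just j' → P (Fin.suc j')) → ∀ j' → (mj : Maybe (Fin m)) → sucFin j ≡ mj →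
    Maybe.map Fin.suc mj ≡ just j' → P j'
  shifted j ih .(Fin.suc j'') (just j'') e refl = ih j'' e
  later : ∀ j → P (Fin.suc j)
  later = chainInd (P ∘ Fin.suc) λ j ih → step (Fin.suc j) (λ j' eq →
    shifted j ih j' (sucFin j) refl (trans (sym (sucFin-suc j)) eq))
  first : ∀ m (P : Fin (suc m) → Set) → (∀ j → P (Fin.suc j)) → ∀ j' → sucFin {suc m} Fin.zero ≡ just j' → P j'
  first (suc m) P later .(Fin.suc Fin.zero) refl = later Fin.zero

sucFin-just : ∀ {m} (j : Fin m) {j'} → sucFin j ≡ just j' → toℕ j' ≡ suc (toℕ j)
sucFin-just {suc (suc m)} Fin.zero refl = refl
sucFin-just {suc (suc m)} (Fin.suc j) eq with sucFin j in e
sucFin-just {suc (suc m)} (Fin.suc j) refl | just j'' = cong suc (sucFin-just j e)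

sucFin-nothing : ∀ {m} (j : Fin m) → sucFin j ≡ nothing → suc (toℕ j) ≡ m
sucFin-nothing {suc zero} Fin.zero eq = refl
sucFin-nothing {suc (suc m)} (Fin.suc j) eq with sucFin j in e
... | nothing = cong suc (sucFin-nothing j e)

-- Edge labels

∈-concatMap-intro : ∀ {A B : Set} (f : A → List B) {xs x y} → x ∈ xs → y ∈ f x → y ∈ concatMap f xs
∈-concatMap-intro f x∈ y∈ = ∈-concatMap⁺ f (Any.map (λ { refl → y∈ }) x∈)

All-concatMap : ∀ {A B : Set} {P : B → Set} (f : A → List B) xs → (∀ x → All P (f x)) → All P (concatMap f xs)
All-concatMap f xs all = AllP.concat⁺ (AllP.map⁺ (All.universal all xs))

All-map : ∀ {A B : Set} {P : B → Set} (f : A → B) xs → (∀ x → P (f x)) → All P (map f xs)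
All-map f xs all = AllP.map⁺ (All.universal all xs)

unique-++ : ∀ {A : Set} (key : A → ℕ) c {xs ys} → Unique xs → Unique ys →
  All (λ x → key x ≡ c) xs → All (λ y → key y ≢ c) ys → Unique (xs ++ ys)
unique-++ key c ux uy kx ky = UniqueP.++⁺ ux uy (λ { (x∈xs , x∈ys) → All.lookup ky x∈ys (All.lookup kx x∈xs) })

-- All members of the block of `x` carry the key of `x`, and `keyA` is injective, so blocks of
-- different elements are disjoint.
unique-concatMap : ∀ {A B : Set} (key : B → ℕ) (keyA : A → ℕ) → (∀ {x y} → keyA x ≡ keyA y → x ≡ y) →
  (f : A → List B) → (∀ x → Unique (f x)) → (∀ x → All (λ z → key z ≡ keyA x) (f x)) →
  ∀ {xs} → Unique xs → Unique (concatMap f xs)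
unique-concatMap key keyA inj f uf kf {[]}     [] = []
unique-concatMap key keyA inj f uf kf {x ∷ xs} (x∉ ∷ uxs) = unique-++ key (keyA x) (uf x)
  (unique-concatMap key keyA inj f uf kf uxs) (kf x)
  (AllP.concat⁺ (AllP.map⁺ (All.map (λ {y} x≢y → All.map (λ kz≡ kz≡' → x≢y (inj (trans (sym kz≡') kz≡))) (kf y)) x∉)))

lookup-injective : ∀ {A : Set} {xs : List A} → Unique xs → ∀ i j → lookup xs i ≡ lookup xs j → i ≡ j
lookup-injective (x∉ ∷ u) Fin.zero    Fin.zero    eq = refl
lookup-injective (x∉ ∷ u) Fin.zero    (Fin.suc j) eq = ⊥-elim (All.lookup x∉ (∈-lookup j) eq)
lookup-injective (x∉ ∷ u) (Fin.suc i) Fin.zero    eq = ⊥-elim (All.lookup x∉ (∈-lookup i) (sym eq))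
lookup-injective (x∉ ∷ u) (Fin.suc i) (Fin.suc j) eq = cong Fin.suc (lookup-injective u i j eq)

∑-lookup : ∀ {A : Set} (xs : List A) (h : A → ℕ) → ∑ (h ∘ lookup xs) ≡ Σl xs h
∑-lookup []       h = refl
∑-lookup (x ∷ xs) h = cong (h x +_) (∑-lookup xs h)

module Labels (n r' s' t : ℕ) where

  r s R : ℕ
  r = suc r'
  s = suc s'
  R = r * s

  open Graph n r s t

  cellA : Fin n → Fin r → Fin s → List EdgeLabel
  cellA i j k = a1 i j k ∷ map (a0 i j k) (allFin t)

  rowA rowWj : Fin n → Fin r → List EdgeLabel
  rowA i j = concatMap (cellA i j) (allFin s)
  rowWj i j = map (wj i j) (allFin t)

  rowB : Fin n → Fin R → List EdgeLabel
  rowB i j = b1 i j ∷ map (b0 i j) (allFin t)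

  blockA blockB blockU1 blockU0 blockWj blockW0 : Fin n → List EdgeLabel
  blockA i = concatMap (rowA i) (allFin r)
  blockB i = concatMap (rowB i) (allFin R)
  blockU1 i = map (u1 i) (allFin t)
  blockU0 i = map (u0 i) (allFin t)
  blockWj i = concatMap (rowWj i) (allFin r)
  blockW0 i = map (w0 i) (allFin t)

  bit : EdgeLabel → Fin n
  bit (a1 i _ _) = i
  bit (a0 i _ _ _) = i
  bit (b1 i _) = i
  bit (b0 i _ _) = i
  bit (u1 i _) = i
  bit (u0 i _) = i
  bit (wj i _ _) = i
  bit (w0 i _) = i

  -- One key for each level of nesting in `allLabels`. Labels listed in the same block share a
  -- family, which is why `a1` and `a0` agree, and likewise `b1` and `b0`.
  family key₁ key₂ : EdgeLabel → ℕ
  family (a1 _ _ _) = 0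
  family (a0 _ _ _ _) = 0
  family (b1 _ _) = 1
  family (b0 _ _ _) = 1
  family (u1 _ _) = 2
  family (u0 _ _) = 3
  family (wj _ _ _) = 4
  family (w0 _ _) = 5
  key₁ (a1 _ j _) = toℕ j
  key₁ (a0 _ j _ _) = toℕ j
  key₁ (b1 _ j) = toℕ j
  key₁ (b0 _ j _) = toℕ j
  key₁ (wj _ j _) = toℕ j
  key₁ _ = 0
  key₂ (a1 _ _ k) = toℕ k
  key₂ (a0 _ _ k _) = toℕ k
  key₂ _ = 0

  private
    allFin-unique : ∀ m → Unique (allFin m)
    allFin-unique = UniqueP.allFin⁺

    All-block : ∀ {P : EdgeLabel → Set} i → (∀ x → bit x ≡ i → P x) →
      All P (blockA i) × All P (blockB i) × All P (blockU1 i) × All P (blockU0 i) × All P (blockWj i) × All P (blockW0 i)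
    All-block i p =
      All-concatMap _ (allFin r) (λ j → All-concatMap _ (allFin s) (λ k →
        p (a1 i j k) refl ∷ All-map _ (allFin t) (λ ℓ → p (a0 i j k ℓ) refl))) ,
      All-concatMap _ (allFin R) (λ j → p (b1 i j) refl ∷ All-map _ (allFin t) (λ ℓ → p (b0 i j ℓ) refl)) ,
      All-map _ (allFin t) (λ ℓ → p (u1 i ℓ) refl) ,
      All-map _ (allFin t) (λ ℓ → p (u0 i ℓ) refl) ,
      All-concatMap _ (allFin r) (λ j → All-map _ (allFin t) (λ ℓ → p (wj i j ℓ) refl)) ,
      All-map _ (allFin t) (λ ℓ → p (w0 i ℓ) refl)

    familyA : ∀ i → All (λ x → family x ≡ 0) (blockA i)
    familyA i = All-concatMap _ (allFin r) (λ j → All-concatMap _ (allFin s) (λ k →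
      refl ∷ All-map _ (allFin t) (λ ℓ → refl)))

    familyB : ∀ (P : ℕ → Set) i → P 1 → All (λ x → P (family x)) (blockB i)
    familyB P i p = All-concatMap _ (allFin R) (λ j → p ∷ All-map _ (allFin t) (λ ℓ → p))

    familyWj : ∀ (P : ℕ → Set) i → P 4 → All (λ x → P (family x)) (blockWj i)
    familyWj P i p = All-concatMap _ (allFin r) (λ j → All-map _ (allFin t) (λ ℓ → p))

    familyMap : ∀ (P : ℕ → Set) (f : Fin t → EdgeLabel) → (∀ ℓ → P (family (f ℓ))) →
      All (λ x → P (family x)) (map f (allFin t))
    familyMap P f p = All-map f (allFin t) p

    unique-block : ∀ i → Unique (blockA i ++ blockB i ++ blockU1 i ++ blockU0 i ++ blockWj i ++ blockW0 i)
    unique-block i =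
      unique-++ family 0
        (unique-concatMap key₁ toℕ toℕ-injective _
          (λ j → unique-concatMap key₂ toℕ toℕ-injective _
            (λ k → All-map _ (allFin t) (λ _ ()) ∷ UniqueP.map⁺ (λ { refl → refl }) (allFin-unique t))
            (λ k → refl ∷ All-map _ (allFin t) (λ _ → refl))
            (allFin-unique s))
          (λ j → All-concatMap _ (allFin s) (λ k → refl ∷ All-map _ (allFin t) (λ _ → refl)))
          (allFin-unique r))
        (unique-++ family 1
          (unique-concatMap key₁ toℕ toℕ-injective _
            (λ j → All-map _ (allFin t) (λ _ ()) ∷ UniqueP.map⁺ (λ { refl → refl }) (allFin-unique t))
            (λ j → refl ∷ All-map _ (allFin t) (λ _ → refl))
            (allFin-unique R))
          (unique-++ family 2
            (UniqueP.map⁺ (λ { refl → refl }) (allFin-unique t))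
            (unique-++ family 3
              (UniqueP.map⁺ (λ { refl → refl }) (allFin-unique t))
              (unique-++ family 4
                (unique-concatMap key₁ toℕ toℕ-injective _
                  (λ j → UniqueP.map⁺ (λ { refl → refl }) (allFin-unique t))
                  (λ j → All-map _ (allFin t) (λ _ → refl))
                  (allFin-unique r))
                (UniqueP.map⁺ (λ { refl → refl }) (allFin-unique t))
                (familyWj (_≡ 4) i refl)
                (familyMap (_≢ 4) (w0 i) (λ _ ())))
              (familyMap (_≡ 3) (u0 i) (λ _ → refl))
              (AllP.++⁺ (familyWj (_≢ 3) i (λ ())) (familyMap (_≢ 3) (w0 i) (λ _ ()))))
            (familyMap (_≡ 2) (u1 i) (λ _ → refl))
            (AllP.++⁺ (familyMap (_≢ 2) (u0 i) (λ _ ())) (AllP.++⁺ (familyWj (_≢ 2) i (λ ())) (familyMap (_≢ 2) (w0 i) (λ _ ())))))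
          (familyB (_≡ 1) i refl)
          (AllP.++⁺ (familyMap (_≢ 1) (u1 i) (λ _ ())) (AllP.++⁺ (familyMap (_≢ 1) (u0 i) (λ _ ()))
            (AllP.++⁺ (familyWj (_≢ 1) i (λ ())) (familyMap (_≢ 1) (w0 i) (λ _ ()))))))
        (familyA i)
        (AllP.++⁺ (familyB (_≢ 0) i (λ ())) (AllP.++⁺ (familyMap (_≢ 0) (u1 i) (λ _ ())) (AllP.++⁺ (familyMap (_≢ 0) (u0 i) (λ _ ()))
          (AllP.++⁺ (familyWj (_≢ 0) i (λ ())) (familyMap (_≢ 0) (w0 i) (λ _ ()))))))

  unique-allLabels : Unique allLabels
  unique-allLabels = unique-concatMap (toℕ ∘ bit) toℕ toℕ-injective _ unique-block
    (λ i → let (pa , pb , pu1 , pu0 , pwj , pw0) = All-block i (λ x → cong toℕ) in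
      AllP.++⁺ pa (AllP.++⁺ pb (AllP.++⁺ pu1 (AllP.++⁺ pu0 (AllP.++⁺ pwj pw0)))))
    (allFin-unique n)

  complete : ∀ x → x ∈ allLabels
  complete x = ∈-concatMap-intro _ (∈-allFin (bit x)) (inBlock x)
    where
    inBlock : ∀ x → let i = bit x in
      x ∈ blockA i ++ blockB i ++ blockU1 i ++ blockU0 i ++ blockWj i ++ blockW0 i
    inBlock (a1 i j k) = ∈-++⁺ˡ (∈-concatMap-intro (rowA i) (∈-allFin j) (∈-concatMap-intro (cellA i j) (∈-allFin k) (here refl)))
    inBlock (a0 i j k ℓ) = ∈-++⁺ˡ (∈-concatMap-intro (rowA i) (∈-allFin j) (∈-concatMap-intro (cellA i j) (∈-allFin k)
      (there (∈-map⁺ (a0 i j k) (∈-allFin ℓ)))))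
    inBlock (b1 i j) = ∈-++⁺ʳ (blockA i) (∈-++⁺ˡ (∈-concatMap-intro (rowB i) (∈-allFin j) (here refl)))
    inBlock (b0 i j ℓ) = ∈-++⁺ʳ (blockA i) (∈-++⁺ˡ (∈-concatMap-intro (rowB i) (∈-allFin j)
      (there (∈-map⁺ (b0 i j) (∈-allFin ℓ)))))
    inBlock (u1 i ℓ) = ∈-++⁺ʳ (blockA i) (∈-++⁺ʳ (blockB i) (∈-++⁺ˡ (∈-map⁺ (u1 i) (∈-allFin ℓ))))
    inBlock (u0 i ℓ) = ∈-++⁺ʳ (blockA i) (∈-++⁺ʳ (blockB i) (∈-++⁺ʳ (blockU1 i) (∈-++⁺ˡ
      (∈-map⁺ (u0 i) (∈-allFin ℓ)))))
    inBlock (wj i j ℓ) = ∈-++⁺ʳ (blockA i) (∈-++⁺ʳ (blockB i) (∈-++⁺ʳ (blockU1 i) (∈-++⁺ʳ (blockU0 i)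
      (∈-++⁺ˡ (∈-concatMap-intro (rowWj i) (∈-allFin j) (∈-map⁺ (wj i j) (∈-allFin ℓ)))))))
    inBlock (w0 i ℓ) = ∈-++⁺ʳ (blockA i) (∈-++⁺ʳ (blockB i) (∈-++⁺ʳ (blockU1 i) (∈-++⁺ʳ (blockU0 i)
      (∈-++⁺ʳ (blockWj i) (∈-map⁺ (w0 i) (∈-allFin ℓ))))))

  -- Opaque: only the two inverse laws matter, and the position of a label in `allLabels` is never
  -- computed.
  abstract

    edge : EdgeLabel → Edge
    edge x = index (complete x)

    label-edge : ∀ x → label (edge x) ≡ x
    label-edge x = sym (lookup-index (complete x))

    edge-label : ∀ e → edge (label e) ≡ e
    edge-label e = lookup-injective unique-allLabels _ e (label-edge (label e))

  ∑-labels : ∀ h → Σl allLabels h ≡ ∑ λ i →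
    ∑ (λ j → ∑ λ k → h (a1 i j k) + ∑ (h ∘ a0 i j k)) + (∑ (λ j → h (b1 i j) + ∑ (h ∘ b0 i j)) +
    (∑ (h ∘ u1 i) + (∑ (h ∘ u0 i) + (∑ (λ j → ∑ (h ∘ wj i j)) + ∑ (h ∘ w0 i)))))
  ∑-labels h = trans (Σl-concatMap _ (allFin n) h) (trans (Σl-allFin n _) (∑-cong λ i →
    trans (Σl-++ (blockA i) _ h) (cong₂ _+_ (sumA i)
    (trans (Σl-++ (blockB i) _ h) (cong₂ _+_ (sumB i)
    (trans (Σl-++ (blockU1 i) _ h) (cong₂ _+_ (sumMap (u1 i))
    (trans (Σl-++ (blockU0 i) _ h) (cong₂ _+_ (sumMap (u0 i))
    (trans (Σl-++ (blockWj i) _ h) (cong₂ _+_ (sumWj i) (sumMap (w0 i)))))))))))))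
    where
    sumMap : (f : Fin t → EdgeLabel) → Σl (map f (allFin t)) h ≡ ∑ (h ∘ f)
    sumMap f = trans (Σl-map f (allFin t) h) (Σl-allFin t _)
    sumA : ∀ i → Σl (blockA i) h ≡ ∑ (λ j → ∑ λ k → h (a1 i j k) + ∑ (h ∘ a0 i j k))
    sumA i = trans (Σl-concatMap (rowA i) (allFin r) h) (trans (Σl-allFin r _) (∑-cong λ j →
      trans (Σl-concatMap (cellA i j) (allFin s) h) (trans (Σl-allFin s _) (∑-cong λ k →
        cong (h (a1 i j k) +_) (sumMap (a0 i j k))))))
    sumB : ∀ i → Σl (blockB i) h ≡ ∑ (λ j → h (b1 i j) + ∑ (h ∘ b0 i j))
    sumB i = trans (Σl-concatMap (rowB i) (allFin R) h) (trans (Σl-allFin R _) (∑-cong λ j →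
      cong (h (b1 i j) +_) (sumMap (b0 i j))))
    sumWj : ∀ i → Σl (blockWj i) h ≡ ∑ (λ j → ∑ (h ∘ wj i j))
    sumWj i = trans (Σl-concatMap (rowWj i) (allFin r) h) (trans (Σl-allFin r _) (∑-cong λ j → sumMap (wj i j)))

  free : EdgeSet → EdgeSet → EdgeLabel → Bool
  free F B x = F (edge x) ∧ not (B (edge x))

  ∑-diffList : ∀ F B (h : EdgeLabel → ℕ) →
    Σl (diffList F B) (h ∘ label) ≡ Σl allLabels (λ x → if free F B x then h x else 0)
  ∑-diffList F B h = trans (Σl-filter (λ e → F e ∧ not (B e)) allEdges (h ∘ label))
    (trans (Σl-allFin M _)
    (trans (∑-cong (λ e → cong (λ e' → if F e' ∧ not (B e') then h (label e) else 0) (sym (edge-label e))))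
    (∑-lookup allLabels (λ x → if free F B x then h x else 0))))

  nextU-just : ∀ i {i'} → sucFin i ≡ just i' → nextU i ≡ u i'
  nextU-just i eq with sucFin i
  nextU-just i refl | just i' = refl

  nextU-nothing : ∀ i → sucFin i ≡ nothing → nextU i ≡ tgt
  nextU-nothing i eq with sucFin i
  ... | nothing = refl

  nextW-just : ∀ i {i'} → sucFin i ≡ just i' → nextW i ≡ w i'
  nextW-just i eq with sucFin i
  nextW-just i refl | just i' = refl

  nextW-nothing : ∀ i → sucFin i ≡ nothing → nextW i ≡ tgt
  nextW-nothing i eq with sucFin i
  ... | nothing = refl

-- Trees and distances

ℕtoℚᵘ : ∀ k → ℚ.toℚᵘ (ℕtoℚ k) ℚᵘ.≃ ℚᵘ.mkℚᵘ (ℤ.+ k) 0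
ℕtoℚᵘ k = ℚP.toℚᵘ-fromℚᵘ (ℚᵘ.mkℚᵘ (ℤ.+ k) 0)

ℕtoℚ-+ : ∀ a b → ℕtoℚ (a + b) ≡ ℕtoℚ a ℚ.+ ℕtoℚ b
ℕtoℚ-+ a b = ℚP.toℚᵘ-injective (begin-equality
  ℚ.toℚᵘ (ℕtoℚ (a + b))                        ≃⟨ ℕtoℚᵘ (a + b) ⟩
  ℚᵘ.mkℚᵘ (ℤ.+ (a + b)) 0                      ≃⟨ ℚᵘ.*≡* (cong (ℤ._* ℤ.1ℤ) (sym (cong₂ ℤ._+_
                                                    (ℤP.*-identityʳ (ℤ.+ a)) (ℤP.*-identityʳ (ℤ.+ b))))) ⟩
  ℚᵘ.mkℚᵘ (ℤ.+ a) 0 ℚᵘ.+ ℚᵘ.mkℚᵘ (ℤ.+ b) 0     ≃⟨ ℚᵘP.+-cong (ℕtoℚᵘ a) (ℕtoℚᵘ b) ⟨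
  ℚ.toℚᵘ (ℕtoℚ a) ℚᵘ.+ ℚ.toℚᵘ (ℕtoℚ b)         ≃⟨ ℚP.toℚᵘ-homo-+ (ℕtoℚ a) (ℕtoℚ b) ⟨
  ℚ.toℚᵘ (ℕtoℚ a ℚ.+ ℕtoℚ b)                   ∎)
  where open ℚᵘP.≤-Reasoning

ℕtoℚ-* : ∀ a b → ℕtoℚ (a * b) ≡ ℕtoℚ a ℚ.* ℕtoℚ b
ℕtoℚ-* a b = ℚP.toℚᵘ-injective (begin-equality
  ℚ.toℚᵘ (ℕtoℚ (a * b))                        ≃⟨ ℕtoℚᵘ (a * b) ⟩
  ℚᵘ.mkℚᵘ (ℤ.+ (a * b)) 0                      ≃⟨ ℚᵘ.*≡* (cong (ℤ._* ℤ.1ℤ) (ℤP.pos-* a b)) ⟩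
  ℚᵘ.mkℚᵘ (ℤ.+ a) 0 ℚᵘ.* ℚᵘ.mkℚᵘ (ℤ.+ b) 0     ≃⟨ ℚᵘP.*-cong (ℕtoℚᵘ a) (ℕtoℚᵘ b) ⟨
  ℚ.toℚᵘ (ℕtoℚ a) ℚᵘ.* ℚ.toℚᵘ (ℕtoℚ b)         ≃⟨ ℚP.toℚᵘ-homo-* (ℕtoℚ a) (ℕtoℚ b) ⟨
  ℚ.toℚᵘ (ℕtoℚ a ℚ.* ℕtoℚ b)                   ∎)
  where open ℚᵘP.≤-Reasoning

ℕtoℚ-mono-≤ : ∀ {a b} → a ≤ b → ℕtoℚ a ℚ.≤ ℕtoℚ b
ℕtoℚ-mono-≤ {a} {b} a≤b = ℚP.toℚᵘ-cancel-≤ (begin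
  ℚ.toℚᵘ (ℕtoℚ a)   ≃⟨ ℕtoℚᵘ a ⟩
  ℚᵘ.mkℚᵘ (ℤ.+ a) 0 ≤⟨ ℚᵘ.*≤* (ℤP.*-monoʳ-≤-nonNeg ℤ.1ℤ (ℤ.+≤+ a≤b)) ⟩
  ℚᵘ.mkℚᵘ (ℤ.+ b) 0 ≃⟨ ℕtoℚᵘ b ⟨
  ℚ.toℚᵘ (ℕtoℚ b)   ∎)
  where open ℚᵘP.≤-Reasoning

ℕtoℚ-mono-< : ∀ {a b} → a < b → ℕtoℚ a ℚ.< ℕtoℚ b
ℕtoℚ-mono-< {a} {b} a<b = ℚP.toℚᵘ-cancel-< (begin-strict
  ℚ.toℚᵘ (ℕtoℚ a)   ≃⟨ ℕtoℚᵘ a ⟩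
  ℚᵘ.mkℚᵘ (ℤ.+ a) 0 <⟨ ℚᵘ.*<* (ℤP.*-monoʳ-<-pos ℤ.1ℤ (ℤ.+<+ a<b)) ⟩
  ℚᵘ.mkℚᵘ (ℤ.+ b) 0 ≃⟨ ℕtoℚᵘ b ⟨
  ℚ.toℚᵘ (ℕtoℚ b)   ∎)
  where open ℚᵘP.≤-Reasoning

ℕtoℚ-cancel-< : ∀ {a b} → ℕtoℚ a ℚ.< ℕtoℚ b → a < b
ℕtoℚ-cancel-< {a} {b} a<b with a <? b
... | yes p = p
... | no ¬p = ⊥-elim (ℚP.<-irrefl refl (ℚP.<-≤-trans a<b (ℕtoℚ-mono-≤ (≮⇒≥ ¬p))))

ℕtoℚ-nonNeg : ∀ k → ℚ.NonNegative (ℕtoℚ k)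
ℕtoℚ-nonNeg k = ℚ.nonNegative (ℕtoℚ-mono-≤ {0} {k} z≤n)

ℕtoℚ-pos : ∀ k → ℚ.Positive (ℕtoℚ (suc k))
ℕtoℚ-pos k = ℚ.positive (ℕtoℚ-mono-< {0} {suc k} (s≤s z≤n))

reciprocal : ∀ m → ℕtoℚ (suc m) ℚ.* ((ℤ.+ 1) / suc m) ≡ 1ℚ
reciprocal m = ℚP.toℚᵘ-injective (begin-equality
  ℚ.toℚᵘ (ℕtoℚ (suc m) ℚ.* ((ℤ.+ 1) / suc m))           ≃⟨ ℚP.toℚᵘ-homo-* (ℕtoℚ (suc m)) ((ℤ.+ 1) / suc m) ⟩
  ℚ.toℚᵘ (ℕtoℚ (suc m)) ℚᵘ.* ℚ.toℚᵘ ((ℤ.+ 1) / suc m)   ≃⟨ ℚᵘP.*-cong (ℕtoℚᵘ (suc m)) (ℚP.toℚᵘ-fromℚᵘ (ℚᵘ.mkℚᵘ (ℤ.+ 1) m)) ⟩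
  ℚᵘ.mkℚᵘ (ℤ.+ suc m) 0 ℚᵘ.* ℚᵘ.mkℚᵘ (ℤ.+ 1) m          ≃⟨ ℚᵘ.*≡* (trans (ℤP.*-identityʳ _)
                                                             (trans (ℤP.*-identityʳ _) (sym (trans (ℤP.*-identityˡ _)
                                                               (cong (λ z → ℤ.+ suc z) (+-identityʳ m)))))) ⟩
  ℚ.toℚᵘ 1ℚ                                             ∎)
  where open ℚᵘP.≤-Reasoning

reciprocal-pos : ∀ m → ℚ.Positive ((ℤ.+ 1) / suc m)
reciprocal-pos m = ℚ.positive (ℚP.*-cancelˡ-<-nonNeg (ℕtoℚ (suc m)) {{ℕtoℚ-nonNeg (suc m)}}
  (subst₂ ℚ._<_ (sym (ℚP.*-zeroʳ (ℕtoℚ (suc m)))) (sym (reciprocal m)) (ℕtoℚ-mono-< {0} {1} (s≤s z≤n))))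

T⇒true : ∀ {x} → T x → x ≡ true
T⇒true {true} _ = refl

true⇒T : ∀ {x} → x ≡ true → T x
true⇒T refl = tt

filter-head : ∀ {A : Set} (p : A → Bool) xs {x} → x ∈ xs → p x ≡ true → (∀ {y} → p y ≡ true → y ≡ x) →
  head (filter (λ y → T? (p y)) xs) ≡ just x
filter-head p (y ∷ xs) x∈ px unique with p y in eq
filter-head p (y ∷ xs) x∈         px unique | true = cong just (unique eq)
filter-head p (y ∷ xs) (here refl) px unique | false with trans (sym px) eq
... | ()
filter-head p (y ∷ xs) (there x∈) px unique | false = filter-head p xs x∈ px unique

filter-none : ∀ {A : Set} (p : A → Bool) xs → (∀ y → p y ≡ false) → filter (λ y → T? (p y)) xs ≡ []
filter-none p []       none = refl
filter-none p (y ∷ xs) none rewrite none y = filter-none p xs none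

module Trees (n r' s' t : ℕ) where

  open Labels n r' s' t
  open Graph n r s t

  -- All costs are multiples of ε = 1/R; C, q and Y measure cost in units of ε.
  q : Fin n → ℕ
  q i = R * 2 ^ (2 * ix i)

  C : EdgeLabel → ℕ
  C (a0 i j k ℓ) = 2 * q i + toℕ k
  C (b0 i j ℓ) = 2 * q i + R + toℕ j
  C (u0 i ℓ) = q i
  C (w0 i ℓ) = q i
  C _ = 0

  R-unit : ℕtoℚ R ℚ.* ε ≡ 1ℚ
  R-unit = reciprocal (s' + r' * s)

  ε-pos : ℚ.Positive ε
  ε-pos = reciprocal-pos (s' + r' * s)

  scale-R : ∀ k → ℕtoℚ (R * k) ℚ.* ε ≡ ℕtoℚ k
  scale-R k = trans (cong (ℚ._* ε) (trans (cong ℕtoℚ (*-comm R k)) (ℕtoℚ-* k R)))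
    (trans (ℚP.*-assoc (ℕtoℚ k) (ℕtoℚ R) ε) (trans (cong (ℕtoℚ k ℚ.*_) R-unit) (ℚP.*-identityʳ (ℕtoℚ k))))

  +-scaled : ∀ x y {p q'} → p ≡ ℕtoℚ x ℚ.* ε → q' ≡ ℕtoℚ y ℚ.* ε → p ℚ.+ q' ≡ ℕtoℚ (x + y) ℚ.* ε
  +-scaled x y refl refl = trans (sym (ℚP.*-distribʳ-+ ε (ℕtoℚ x) (ℕtoℚ y))) (cong (ℚ._* ε) (sym (ℕtoℚ-+ x y)))

  double-q : ∀ i → 2 * q i ≡ R * 2 ^ (2 * ix i + 1)
  double-q i = trans (swap R (2 ^ (2 * ix i))) (cong (R *_) (sym (trans (^-distribˡ-+-* 2 (2 * ix i) 1) refl)))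
    where
    swap : ∀ R x → 2 * (R * x) ≡ R * (x * (2 * 1))
    swap = solve-∀

  cost-scaled : ∀ x → cost x ≡ ℕtoℚ (C x) ℚ.* ε
  cost-scaled (a1 i j k) = sym (ℚP.*-zeroˡ ε)
  cost-scaled (a0 i j k ℓ) = +-scaled (2 * q i) (toℕ k)
    (sym (trans (cong (λ z → ℕtoℚ z ℚ.* ε) (double-q i)) (scale-R (2 ^ (2 * ix i + 1))))) refl
  cost-scaled (b1 i j) = sym (ℚP.*-zeroˡ ε)
  cost-scaled (b0 i j ℓ) = +-scaled (2 * q i + R) (toℕ j)
    (sym (trans (cong (λ z → ℕtoℚ z ℚ.* ε) (trans (cong (_+ R) (double-q i)) (factor R (2 ^ (2 * ix i + 1))))) (scale-R (2 ^ (2 * ix i + 1) + 1)))) refl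
    where
    factor : ∀ R x → R * x + R ≡ R * (x + 1)
    factor = solve-∀
  cost-scaled (u1 i ℓ) = sym (ℚP.*-zeroˡ ε)
  cost-scaled (u0 i ℓ) = sym (scale-R (2 ^ (2 * ix i)))
  cost-scaled (wj i j ℓ) = sym (ℚP.*-zeroˡ ε)
  cost-scaled (w0 i ℓ) = sym (scale-R (2 ^ (2 * ix i)))

  YFuel : ℕ → EdgeSet → Vtx → ℕ
  YFuel zero    B v = 0
  YFuel (suc f) B v with outEdge B v
  ... | nothing = 0
  ... | just e  = C (label e) + YFuel f B (dst (label e))

  Y : EdgeSet → Vtx → ℕ
  Y = YFuel numVtx

  yFuel-scaled : ∀ f B v → yFuel f B v ≡ ℕtoℚ (YFuel f B v) ℚ.* ε
  yFuel-scaled zero    B v = sym (ℚP.*-zeroˡ ε)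
  yFuel-scaled (suc f) B v with outEdge B v
  ... | nothing = sym (ℚP.*-zeroˡ ε)
  ... | just e  = +-scaled (C (label e)) (YFuel f B (dst (label e))) (cost-scaled (label e)) (yFuel-scaled f B (dst (label e)))

  Better : EdgeSet → EdgeLabel → Set
  Better B x = C x + Y B (dst x) < Y B (src x)

  improving⇒better : ∀ B e → Improving B e → Better B (label e)
  improving⇒better B e imp = ℕtoℚ-cancel-< (ℚP.*-cancelʳ-<-nonNeg ε {{ℚP.pos⇒nonNeg ε {{ε-pos}}}}
    (subst₂ ℚ._<_ (+-scaled (C (label e)) (Y B (dst (label e))) (cost-scaled (label e)) (yFuel-scaled numVtx B (dst (label e))))
      (yFuel-scaled numVtx B (src (label e))) imp))

  better⇒improving : ∀ B e → Better B (label e) → Improving B e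
  better⇒improving B e lt = subst₂ ℚ._<_
    (sym (+-scaled (C (label e)) (Y B (dst (label e))) (cost-scaled (label e)) (yFuel-scaled numVtx B (dst (label e)))))
    (sym (yFuel-scaled numVtx B (src (label e))))
    (ℚP.*-monoˡ-<-pos ε {{ε-pos}} (ℕtoℚ-mono-< lt))

  improving? : ∀ B e → Dec (Improving B e)
  improving? B e with (C (label e) + Y B (dst (label e))) <? Y B (src (label e))
  ... | yes lt = yes (better⇒improving B e lt)
  ... | no ¬lt = no (¬lt ∘ improving⇒better B e)

  -- The number of ranks that one bit occupies: `R` for chain b, `s` more for the chains a, and one
  -- on top shared by `u` and `w`. The resulting `rank` decreases along every edge and is at most
  -- `numVtx`, so the fuel in `Y` never runs out on a tree.
  K : ℕ
  K = suc (R + s)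

  rank : Vtx → ℕ
  rank tgt = 0
  rank (u i) = (n ∸ toℕ i) * K
  rank (w i) = (n ∸ toℕ i) * K
  rank (a i j k) = (n ∸ suc (toℕ i)) * K + (R + (s ∸ toℕ k))
  rank (b i j) = (n ∸ suc (toℕ i)) * K + (R ∸ toℕ j)

  private
    rank-top : ∀ (i : Fin n) → (n ∸ toℕ i) * K ≡ (n ∸ suc (toℕ i)) * K + K
    rank-top i = trans (cong (_* K) (+-∸-assoc 1 (toℕ<n i))) (+-comm K _)

  rank-nextU : ∀ i → rank (nextU i) ≡ (n ∸ suc (toℕ i)) * K
  rank-nextU i with sucFin i in eq
  ... | just i' = cong (λ z → (n ∸ z) * K) (sucFin-just i eq)
  ... | nothing = sym (cong (_* K) (trans (cong (n ∸_) (sucFin-nothing i eq)) (n∸n≡0 n)))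

  rank-nextW : ∀ i → rank (nextW i) ≡ (n ∸ suc (toℕ i)) * K
  rank-nextW i with sucFin i in eq
  ... | just i' = cong (λ z → (n ∸ z) * K) (sucFin-just i eq)
  ... | nothing = sym (cong (_* K) (trans (cong (n ∸_) (sucFin-nothing i eq)) (n∸n≡0 n)))

  private
    above : ∀ {x y d e} → x ≡ y → 0 < d → y + d ≡ e → x < e
    above {x} {d = suc d} refl _ refl = m<m+n x (s≤s z≤n)

  rank-dst : ∀ x → rank (dst x) < rank (src x)
  rank-dst (a1 i j k) with sucFin k in eq
  ... | just k' = +-monoʳ-< _ (+-monoʳ-< R (∸-monoʳ-< (subst (toℕ k <_) (sym (sucFin-just k eq)) (n<1+n _))
                    (≤-trans (n≤1+n _) (toℕ<n k'))))
  ... | nothing = +-monoʳ-< _ (m<m+n R (m<n⇒0<n∸m (toℕ<n k)))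
  rank-dst (a0 i j k ℓ) = above (rank-nextU i) (s≤s z≤n) refl
  rank-dst (b1 i j) with sucFin j in eq
  ... | just j' = +-monoʳ-< _ (∸-monoʳ-< (subst (toℕ j <_) (sym (sucFin-just j eq)) (n<1+n _))
                    (≤-trans (n≤1+n _) (toℕ<n j')))
  ... | nothing = above (rank-nextW i) (m<n⇒0<n∸m (toℕ<n j)) refl
  rank-dst (b0 i j ℓ) = above (rank-nextU i) (m<n⇒0<n∸m (toℕ<n j)) refl
  rank-dst (u1 i ℓ) = subst (rank (b i Fin.zero) <_) (sym (rank-top i)) (+-monoʳ-< _ (s≤s (m≤m+n R s)))
  rank-dst (u0 i ℓ) = above (rank-nextU i) (s≤s z≤n) (sym (rank-top i))
  rank-dst (wj i j ℓ) = subst (rank (a i j Fin.zero) <_) (sym (rank-top i)) (+-monoʳ-< _ ≤-refl)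
  rank-dst (w0 i ℓ) = above (rank-nextW i) (s≤s z≤n) (sym (rank-top i))

  rank≤top : ∀ v → rank v ≤ n * K
  rank≤top tgt = z≤n
  rank≤top (u i) = *-monoˡ-≤ K (m∸n≤m n (toℕ i))
  rank≤top (w i) = *-monoˡ-≤ K (m∸n≤m n (toℕ i))
  rank≤top (a i j k) = ≤-trans (+-monoʳ-≤ _ (≤-trans (+-monoʳ-≤ R (m∸n≤m s (toℕ k))) (n≤1+n _)))
    (≤-trans (≤-reflexive (sym (rank-top i))) (rank≤top (u i)))
  rank≤top (b i j) = ≤-trans (+-monoʳ-≤ _ (≤-trans (m∸n≤m R (toℕ j)) (≤-trans (m≤m+n R s) (n≤1+n _))))
    (≤-trans (≤-reflexive (sym (rank-top i))) (rank≤top (u i)))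

  rank≤numVtx : ∀ v → rank v ≤ numVtx
  rank≤numVtx v = ≤-trans (rank≤top v) (begin
    n * K                                       ≡⟨ expand n R s ⟩
    n * s + (n + n * R)                         ≤⟨ +-monoˡ-≤ _ (≤-trans (*-monoʳ-≤ n (m≤m+n s (r' * s))) (≤-reflexive (sym (*-assoc n r s)))) ⟩
    n * r * s + (n + n * R)                     ≤⟨ m≤n+m _ (1 + n) ⟩
    (1 + n) + (n * r * s + (n + n * R))         ≡⟨ rearrange n (n * r * s) (n * R) ⟩
    numVtx                                      ∎)
    where
    open ≤-Reasoning
    expand : ∀ n R s → n * suc (R + s) ≡ n * s + (n + n * R)
    expand = solve-∀
    rearrange : ∀ n x y → (1 + n) + (x + (n + y)) ≡ 1 + n + n + x + y
    rearrange = solve-∀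

  code-injective : ∀ v v' → code v ≡ code v' → v ≡ v'
  code-injective tgt tgt eq = refl
  code-injective (u i) (u i') eq = cong u (toℕ-injective (ListP.∷-injectiveˡ (ListP.∷-injectiveʳ eq)))
  code-injective (w i) (w i') eq = cong w (toℕ-injective (ListP.∷-injectiveˡ (ListP.∷-injectiveʳ eq)))
  code-injective (a i j k) (a i' j' k') eq
    with toℕ-injective (ListP.∷-injectiveˡ (ListP.∷-injectiveʳ eq))
       | toℕ-injective (ListP.∷-injectiveˡ (ListP.∷-injectiveʳ (ListP.∷-injectiveʳ eq)))
       | toℕ-injective (ListP.∷-injectiveˡ (ListP.∷-injectiveʳ (ListP.∷-injectiveʳ (ListP.∷-injectiveʳ eq))))
  ... | refl | refl | refl = refl
  code-injective (b i j) (b i' j') eq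
    with toℕ-injective (ListP.∷-injectiveˡ (ListP.∷-injectiveʳ eq))
       | toℕ-injective (ListP.∷-injectiveˡ (ListP.∷-injectiveʳ (ListP.∷-injectiveʳ eq)))
  ... | refl | refl = refl

  ==⇒≡ : ∀ v v' → (v == v') ≡ true → v ≡ v'
  ==⇒≡ v v' eq with ListP.≡-dec Data.Nat._≟_ (code v) (code v')
  ... | yes p = code-injective v v' p

  ==-refl : ∀ v → (v == v) ≡ true
  ==-refl v = dec-true (ListP.≡-dec Data.Nat._≟_ (code v) (code v)) refl

  ≢⇒==false : ∀ {v v'} → v ≢ v' → (v == v') ≡ false
  ≢⇒==false {v} {v'} v≢v' = dec-false (ListP.≡-dec Data.Nat._≟_ (code v) (code v')) (v≢v' ∘ code-injective v v')

  src≢tgt : ∀ x → src x ≢ tgt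
  src≢tgt (a1 _ _ _) ()
  src≢tgt (a0 _ _ _ _) ()
  src≢tgt (b1 _ _) ()
  src≢tgt (b0 _ _ _) ()
  src≢tgt (u1 _ _) ()
  src≢tgt (u0 _ _) ()
  src≢tgt (wj _ _ _) ()
  src≢tgt (w0 _ _) ()

  infix 4 _∋_
  _∋_ : EdgeSet → EdgeLabel → Set
  F ∋ x = F (edge x) ≡ true

  ∋-label : ∀ {F e} → F e ≡ true → F ∋ label e
  ∋-label {F} {e} Fe = trans (cong F (edge-label e)) Fe

  label-∋ : ∀ {F e} → F ∋ label e → F e ≡ true
  label-∋ {F} {e} Fe = trans (sym (cong F (edge-label e))) Fe

  tree-out : ∀ {B} → IsTree B → ∀ v → v ≢ tgt → ∃ λ x → B ∋ x × src x ≡ v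
  tree-out {B} tree v v≢ with tree v v≢
  ... | e , (Be , srce) , _ = label e , ∋-label {B} {e} Be , srce

  tree-unique : ∀ {B} → IsTree B → ∀ {x x'} → B ∋ x → B ∋ x' → src x ≡ src x' → x ≡ x'
  tree-unique {B} tree {x} {x'} Bx Bx' eq with tree (src x') (src≢tgt x')
  ... | e , _ , unique = trans (sym (label-edge x)) (trans (cong label
    (trans (unique (edge x) Bx (trans (cong src (label-edge x)) eq))
      (sym (unique (edge x') Bx' (cong src (label-edge x')))))) (label-edge x'))

  outEdge-tree : ∀ {B} → IsTree B → ∀ {x} → B ∋ x → outEdge B (src x) ≡ just (edge x)
  outEdge-tree {B} tree {x} Bx = filter-head (λ e → B e ∧ (src (label e) == src x)) allEdges (∈-allFin (edge x))
    (cong₂ _∧_ Bx (trans (cong (λ z → src z == src x) (label-edge x)) (==-refl (src x))))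
    (λ {e} eq → let (Be , same) = ∧-true {B e} eq in
      trans (sym (edge-label e)) (cong edge (tree-unique tree (∋-label {B} {e} Be) Bx (==⇒≡ _ _ same))))

  outEdge-tgt : ∀ B → outEdge B tgt ≡ nothing
  outEdge-tgt B = cong head (filter-none (λ e → B e ∧ (src (label e) == tgt)) allEdges
    (λ e → trans (cong (B e ∧_) (≢⇒==false (src≢tgt (label e)))) (BoolP.∧-zeroʳ (B e))))

  YFuel-tgt : ∀ f B → YFuel f B tgt ≡ 0
  YFuel-tgt zero    B = refl
  YFuel-tgt (suc f) B rewrite outEdge-tgt B = refl

  Y-tgt : ∀ B → Y B tgt ≡ 0
  Y-tgt B = YFuel-tgt numVtx B

  YFuel-edge : ∀ {B} → IsTree B → ∀ {x} → B ∋ x → ∀ f → YFuel (suc f) B (src x) ≡ C x + YFuel f B (dst x)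
  YFuel-edge {B} tree {x} Bx f rewrite outEdge-tree tree Bx | label-edge x = refl

  isTgt? : ∀ v → Dec (v ≡ tgt)
  isTgt? tgt = yes refl
  isTgt? (u _) = no λ ()
  isTgt? (w _) = no λ ()
  isTgt? (a _ _ _) = no λ ()
  isTgt? (b _ _) = no λ ()

  YFuel-enough : ∀ {B} → IsTree B → ∀ f f' v → rank v ≤ f → rank v ≤ f' → YFuel f B v ≡ YFuel f' B v
  YFuel-enough {B} tree f f' v r≤f r≤f' with isTgt? v
  ... | yes refl = trans (YFuel-tgt f B) (sym (YFuel-tgt f' B))
  ... | no v≢ with tree-out tree v v≢
  YFuel-enough {B} tree zero f' .(src x) r≤f r≤f' | no v≢ | x , Bx , refl with ≤-trans (rank-dst x) r≤f
  ... | ()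
  YFuel-enough {B} tree (suc f) zero .(src x) r≤f r≤f' | no v≢ | x , Bx , refl with ≤-trans (rank-dst x) r≤f'
  ... | ()
  YFuel-enough {B} tree (suc f) (suc f') .(src x) r≤f r≤f' | no v≢ | x , Bx , refl =
    trans (YFuel-edge tree Bx f) (trans (cong (C x +_)
      (YFuel-enough tree f f' (dst x) (≤-pred (≤-trans (rank-dst x) r≤f)) (≤-pred (≤-trans (rank-dst x) r≤f'))))
      (sym (YFuel-edge tree Bx f')))

  Y-edge : ∀ {B} → IsTree B → ∀ {x} → B ∋ x → Y B (src x) ≡ C x + Y B (dst x)
  Y-edge {B} tree {x} Bx = trans (YFuel-edge tree Bx _) (cong (C x +_)
    (YFuel-enough tree _ _ (dst x) (≤-pred (≤-trans (rank-dst x) (rank≤numVtx (src x)))) (rank≤numVtx (dst x))))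

  -- Weak duality for shortest paths: a feasible potential is a lower bound for distances. The
  -- cutoff `m` works because paths only descend in rank; it allows a comparison of distances above
  -- an edge at which feasibility is not known.
  potential≤Y : ∀ {B} → IsTree B → ∀ (g : Vtx → ℕ) m → g tgt ≡ 0 →
    (∀ x → B ∋ x → rank (src x) ≤ m → g (src x) ≤ C x + g (dst x)) → ∀ v → rank v ≤ m → g v ≤ Y B v
  potential≤Y {B} tree g m g0 bell v v≤m = go (rank v) v ≤-refl v≤m
    where
    go : ∀ f v → rank v ≤ f → rank v ≤ m → g v ≤ Y B v
    go f v v≤f v≤m with isTgt? v
    ... | yes refl = ≤-trans (≤-reflexive g0) z≤n
    ... | no v≢ with tree-out tree v v≢
    go zero .(src x) v≤f v≤m | no v≢ | x , Bx , refl with ≤-trans (rank-dst x) v≤f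
    ... | ()
    go (suc f) .(src x) v≤f v≤m | no v≢ | x , Bx , refl = ≤-trans (bell x Bx v≤m)
      (≤-trans (+-monoʳ-≤ (C x) (go f (dst x) (≤-pred (≤-trans (rank-dst x) v≤f)) (≤-trans (<⇒≤ (rank-dst x)) v≤m)))
        (≤-reflexive (sym (Y-edge tree Bx))))

  Y≤potential : ∀ {B} → IsTree B → ∀ (g : Vtx → ℕ) →
    (∀ x → B ∋ x → C x + g (dst x) ≤ g (src x)) → ∀ v → Y B v ≤ g v
  Y≤potential {B} tree g bell v = go (rank v) v ≤-refl
    where
    go : ∀ f v → rank v ≤ f → Y B v ≤ g v
    go f v v≤f with isTgt? v
    ... | yes refl = ≤-trans (≤-reflexive (Y-tgt B)) z≤n
    ... | no v≢ with tree-out tree v v≢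
    go zero .(src x) v≤f | no v≢ | x , Bx , refl with ≤-trans (rank-dst x) v≤f
    ... | ()
    go (suc f) .(src x) v≤f | no v≢ | x , Bx , refl = ≤-trans (≤-reflexive (Y-edge tree Bx))
      (≤-trans (+-monoʳ-≤ (C x) (go f (dst x) (≤-pred (≤-trans (rank-dst x) v≤f)))) (bell x Bx))

  _⊆_ : EdgeSet → EdgeSet → Set
  B ⊆ F = ∀ x → B ∋ x → F ∋ x

  removed : ∀ F e {x} → removeEdge F e ∋ x → F ∋ x × x ≢ label e
  removed F e {x} p with F (edge x) in Fx | edge x Fin.≟ e
  ... | true | no x≢e = refl , λ x≡ → x≢e (trans (cong edge x≡) (edge-label e))

  kept : ∀ F e x → x ≢ label e → removeEdge F e (edge x) ≡ F (edge x)
  kept F e x x≢ with edge x Fin.≟ e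
  ... | yes refl = ⊥-elim (x≢ (sym (label-edge x)))
  ... | no _     = BoolP.∧-identityʳ (F (edge x))

  switched : ∀ B e x → switch B e ∋ x → x ≡ label e ⊎ (B ∋ x × src x ≢ src (label e))
  switched B e x p with edge x Fin.≟ e
  ... | yes refl = inj₁ (sym (label-edge x))
  ... | no _ with src (label (edge x)) == src (label e) in eq
  switched B e x () | no _ | true
  switched B e x p  | no _ | false = inj₂ (p , λ same → ⊥-elim (absurd (trans (sym eq)
      (trans (cong (λ z → src z == src (label e)) (label-edge x)) (trans (cong (_== src (label e)) same) (==-refl (src (label e))))))))
    where
    absurd : false ≢ true
    absurd ()

  switch-new : ∀ B e → switch B e ∋ label e
  switch-new B e with edge (label e) Fin.≟ e
  ... | yes _ = refl
  ... | no ≢  = ⊥-elim (≢ (edge-label e))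

  switch-old : ∀ B e x → B ∋ x → src x ≢ src (label e) → switch B e ∋ x
  switch-old B e x Bx src≢ with edge x Fin.≟ e
  ... | yes _ = refl
  ... | no _ rewrite label-edge x | ≢⇒==false src≢ = Bx

  ≡-dec-Vtx : ∀ (v v' : Vtx) → Dec (v ≡ v')
  ≡-dec-Vtx v v' with v == v' in eq
  ... | true  = yes (==⇒≡ v v' eq)
  ... | false = no λ { refl → case trans (sym eq) (==-refl v) of λ () }

  switch-tree : ∀ {B} → IsTree B → ∀ e → IsTree (switch B e)
  switch-tree {B} tree e v v≢ = choose (≡-dec-Vtx (src (label e)) v)
    where
    Unique-at : Edge → Set
    Unique-at e₀ = ∀ e' → switch B e e' ≡ true → src (label e') ≡ v → e' ≡ e₀
    changed : src (label e) ≡ v → ∀ e' → label e' ≡ label e ⊎ (B ∋ label e' × src (label e') ≢ src (label e)) →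
      src (label e') ≡ v → e' ≡ e
    changed srce e' (inj₁ eq) same = trans (sym (edge-label e')) (trans (cong edge eq) (edge-label e))
    changed srce e' (inj₂ (_ , src≢)) same = ⊥-elim (src≢ (trans same (sym srce)))
    unchanged : src (label e) ≢ v → ∀ e₀ → (∀ e' → B e' ≡ true → src (label e') ≡ v → e' ≡ e₀) →
      ∀ e' → label e' ≡ label e ⊎ (B ∋ label e' × src (label e') ≢ src (label e)) → src (label e') ≡ v → e' ≡ e₀
    unchanged src≢v e₀ unique e' (inj₁ eq) same = ⊥-elim (src≢v (trans (cong src (sym eq)) same))
    unchanged src≢v e₀ unique e' (inj₂ (Be' , _)) same = unique e' (label-∋ {B} {e'} Be') same
    choose : Dec (src (label e) ≡ v) →
      Σ Edge λ e₀ → (switch B e e₀ ≡ true × src (label e₀) ≡ v) × Unique-at e₀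
    choose (yes srce) = e , (label-∋ {switch B e} (switch-new B e) , srce) ,
      λ e' p → changed srce e' (switched B e (label e') (∋-label {switch B e} {e'} p))
    choose (no src≢v) = let (e₀ , (Be₀ , srce₀) , unique) = tree v v≢ in e₀ ,
      (label-∋ {switch B e} (switch-old B e (label e₀) (∋-label {B} {e₀} Be₀)
        (λ same → src≢v (trans (sym same) srce₀))) , srce₀) ,
      λ e' p → unchanged src≢v e₀ unique e' (switched B e (label e') (∋-label {switch B e} {e'} p))

  switch-⊆ : ∀ {B F} e → B ⊆ F → F ∋ label e → switch B e ⊆ F
  switch-⊆ {B} e B⊆F Fe x p with switched B e x p
  ... | inj₁ refl = Fe
  ... | inj₂ (Bx , _) = B⊆F x Bx

  -- The old distances are tight on the kept edges and too large on the new one, so they form an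
  -- upper potential for the new tree.
  switch-Y≤ : ∀ {B} → IsTree B → ∀ e → Better B (label e) → ∀ v → Y (switch B e) v ≤ Y B v
  switch-Y≤ {B} tree e better = Y≤potential (switch-tree tree e) (Y B) λ x p → bell x (switched B e x p)
    where
    bell : ∀ x → x ≡ label e ⊎ (B ∋ x × src x ≢ src (label e)) → C x + Y B (dst x) ≤ Y B (src x)
    bell x (inj₁ refl) = <⇒≤ better
    bell x (inj₂ (Bx , _)) = ≤-reflexive (sym (Y-edge tree Bx))

  switch-Y< : ∀ {B} → IsTree B → ∀ e → Better B (label e) → Y (switch B e) (src (label e)) < Y B (src (label e))
  switch-Y< {B} tree e better = ≤-trans (s≤s (≤-trans (≤-reflexive (Y-edge (switch-tree tree e) (switch-new B e)))
    (+-monoʳ-≤ (C (label e)) (switch-Y≤ tree e better _)))) better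

  Bellman : EdgeSet → EdgeSet → Set
  Bellman F B = ∀ x → F ∋ x → Y B (src x) ≤ C x + Y B (dst x)

  record Optimal (F B : EdgeSet) : Set where
    field
      tree    : IsTree B
      sub     : B ⊆ F
      bellman : Bellman F B

  -- The Bellman inequalities make `Y B` a feasible potential along any tree inside `F`. Applied in
  -- both directions, two optimal trees of the same edge set have equal distances.
  optimal-≤ : ∀ {F B T} → Optimal F B → IsTree T → T ⊆ F → ∀ v → Y B v ≤ Y T v
  optimal-≤ {B = B} opt tree sub v = potential≤Y tree (Y B) (rank v) (Y-tgt B)
    (λ x Tx _ → Optimal.bellman opt x (sub x Tx)) v ≤-refl

-- Optimal trees, bit by bit

≤≡ : ∀ {c x y} → x ≡ y → c ≤ y → c ≤ x
≤≡ refl c≤y = c≤y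

module Structure (n r' s' t : ℕ) where

  open Labels n r' s' t
  open Graph n r s t
  open Trees n r' s' t

  alive : EdgeSet → Fin n → Bool
  alive F i = allF (λ j → F (edge (b1 i j)))

  chain : EdgeSet → Fin n → Fin r → Bool
  chain F i j = allF (λ k → F (edge (a1 i j k)))

  alive-elim : ∀ {F i} → alive F i ≡ true → ∀ j → F ∋ b1 i j
  alive-elim {F} {i} = allF-elim (λ j → F (edge (b1 i j)))

  chain-elim : ∀ {F i j} → chain F i j ≡ true → ∀ k → F ∋ a1 i j k
  chain-elim {F} {i} {j} = allF-elim (λ k → F (edge (a1 i j k)))

  chain-broken : ∀ {F i j} → chain F i j ≡ false → ∃ λ k → ¬ F ∋ a1 i j k
  chain-broken {F} {i} {j} broken = let (k , no-k) = allF-counterexample (λ k → F (edge (a1 i j k))) broken in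
    k , λ yes-k → case trans (sym yes-k) no-k of λ ()

  dead-missing : ∀ {F i} → alive F i ≡ false → ∃ λ j → ¬ F ∋ b1 i j
  dead-missing {F} {i} dead = let (j , no-j) = allF-counterexample (λ j → F (edge (b1 i j))) dead in
    j , λ yes-j → case trans (sym yes-j) no-j of λ ()

  record Copies (F : EdgeSet) : Set where
    field
      hasA0 : ∀ i j k → ∃ λ ℓ → F ∋ a0 i j k ℓ
      hasB0 : ∀ i j → ∃ λ ℓ → F ∋ b0 i j ℓ
      hasU1 : ∀ i → ∃ λ ℓ → F ∋ u1 i ℓ
      hasU0 : ∀ i → ∃ λ ℓ → F ∋ u0 i ℓ
      hasWj : ∀ i j → ∃ λ ℓ → F ∋ wj i j ℓ
      hasW0 : ∀ i → ∃ λ ℓ → F ∋ w0 i ℓ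

  R≤q : ∀ i → R ≤ q i
  R≤q i = m≤m*n R (2 ^ (2 * ix i)) {{m^n≢0 2 (2 * ix i)}}

  s≤R : s ≤ R
  s≤R = m≤m+n s (r' * s)

  q-next : ∀ {i i'} → sucFin i ≡ just i' → q i' ≡ 4 * q i
  q-next {i} eq = trans (cong (λ z → R * 2 ^ (2 * suc z)) (sucFin-just i eq))
    (trans (cong (λ z → R * 2 ^ z) (split (ix i))) (shuffle R (2 ^ (2 * ix i))))
    where
    split : ∀ x → 2 * suc x ≡ 2 + 2 * x
    split = solve-∀
    shuffle : ∀ R x → R * (2 * (2 * x)) ≡ 4 * (R * x)
    shuffle = solve-∀

  module Opt {F B : EdgeSet} (opt : Optimal F B) where
    open Optimal opt

    y! : Vtx → ℕ
    y! = Y B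

    U W : Fin n → ℕ
    U i = y! (nextU i)
    W i = y! (nextW i)

    b-out : ∀ i j → (B ∋ b1 i j × y! (b i j) ≡ y! (dst (b1 i j))) ⊎ y! (b i j) ≡ 2 * q i + R + toℕ j + U i
    b-out i j with tree-out tree (b i j) (λ ())
    ... | b1 _ _ , Bx , refl = inj₁ (Bx , Y-edge tree Bx)
    ... | b0 _ _ ℓ , Bx , refl = inj₂ (Y-edge tree Bx)

    a-out : ∀ i j k → (B ∋ a1 i j k × y! (a i j k) ≡ y! (dst (a1 i j k))) ⊎ y! (a i j k) ≡ 2 * q i + toℕ k + U i
    a-out i j k with tree-out tree (a i j k) (λ ())
    ... | a1 _ _ _ , Bx , refl = inj₁ (Bx , Y-edge tree Bx)
    ... | a0 _ _ _ ℓ , Bx , refl = inj₂ (Y-edge tree Bx)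

    u-out : ∀ i → y! (u i) ≡ y! (b i Fin.zero) ⊎ y! (u i) ≡ q i + U i
    u-out i with tree-out tree (u i) (λ ())
    ... | u1 _ ℓ , Bx , refl = inj₁ (Y-edge tree Bx)
    ... | u0 _ ℓ , Bx , refl = inj₂ (Y-edge tree Bx)

    w-out : ∀ i → (∃ λ j → y! (w i) ≡ y! (a i j Fin.zero)) ⊎ y! (w i) ≡ q i + W i
    w-out i with tree-out tree (w i) (λ ())
    ... | wj _ j ℓ , Bx , refl = inj₁ (j , Y-edge tree Bx)
    ... | w0 _ ℓ , Bx , refl = inj₂ (Y-edge tree Bx)

    b1-dst-≥ : ∀ i j c → (∀ j' → sucFin j ≡ just j' → c ≤ y! (b i j')) → (sucFin j ≡ nothing → c ≤ W i) →
      c ≤ y! (dst (b1 i j))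
    b1-dst-≥ i j c next last with sucFin j
    ... | just j' = next j' refl
    ... | nothing = last refl

    b1-dst-≤ : ∀ i j c → (∀ j' → sucFin j ≡ just j' → y! (b i j') ≤ c) → (sucFin j ≡ nothing → W i ≤ c) →
      y! (dst (b1 i j)) ≤ c
    b1-dst-≤ i j c next last with sucFin j
    ... | just j' = next j' refl
    ... | nothing = last refl

    a1-dst-≥ : ∀ i j k c → (∀ k' → sucFin k ≡ just k' → c ≤ y! (a i j k')) →
      (sucFin k ≡ nothing → c ≤ y! (b i Fin.zero)) → c ≤ y! (dst (a1 i j k))
    a1-dst-≥ i j k c next last with sucFin k
    ... | just k' = next k' refl
    ... | nothing = last refl

    a1-dst-≤ : ∀ i j k c → (∀ k' → sucFin k ≡ just k' → y! (a i j k') ≤ c) →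
      (sucFin k ≡ nothing → y! (b i Fin.zero) ≤ c) → y! (dst (a1 i j k)) ≤ c
    a1-dst-≤ i j k c next last with sucFin k
    ... | just k' = next k' refl
    ... | nothing = last refl

    exitB-≥ : ∀ i (j : Fin R) → 2 * q i + R + U i ≤ 2 * q i + R + toℕ j + U i
    exitB-≥ i j = +-monoˡ-≤ (U i) (m≤m+n _ (toℕ j))

    exitA-≥ : ∀ i (k : Fin s) → 2 * q i + U i ≤ 2 * q i + toℕ k + U i
    exitA-≥ i k = +-monoˡ-≤ (U i) (m≤m+n _ (toℕ k))

    b-lower : ∀ i c → c ≤ 2 * q i + R + U i → c ≤ W i → ∀ j → c ≤ y! (b i j)
    b-lower i c c≤exit c≤W = chainInd (λ j → c ≤ y! (b i j)) λ j ih → case b-out i j of λ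
      { (inj₁ (_ , eq)) → ≤≡ eq (b1-dst-≥ i j c ih (λ _ → c≤W))
      ; (inj₂ eq) → ≤≡ eq (≤-trans c≤exit (exitB-≥ i j)) }

    -- No path along b leaves bit i other than through an exit at or before the missing edge.
    b-lower-cut : ∀ i j* → ¬ F ∋ b1 i j* → ∀ j → toℕ j ≤ toℕ j* → 2 * q i + R + U i ≤ y! (b i j)
    b-lower-cut i j* missing = chainInd (λ j → toℕ j ≤ toℕ j* → exit ≤ y! (b i j)) λ j ih j≤j* → case b-out i j of λ
      { (inj₁ (Bx , eq)) → ≤≡ eq (b1-dst-≥ i j exit
          (λ j' e → ih j' e (subst (_≤ toℕ j*) (sym (sucFin-just j e)) (strict j j≤j* Bx)))
          (λ e → ⊥-elim (<⇒≱ (subst (toℕ j* <_) (sym (sucFin-nothing j e)) (toℕ<n j*)) (strict j j≤j* Bx))))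
      ; (inj₂ eq) → ≤≡ eq (exitB-≥ i j) }
      where
      exit = 2 * q i + R + U i
      strict : ∀ j → toℕ j ≤ toℕ j* → B ∋ b1 i j → toℕ j < toℕ j*
      strict j j≤j* Bx = ≤∧≢⇒< j≤j* λ eq → missing (sub _ (subst (λ z → B ∋ b1 i z) (toℕ-injective eq) Bx))

    a-lower : ∀ i c → c ≤ 2 * q i + U i → c ≤ y! (b i Fin.zero) → ∀ j k → c ≤ y! (a i j k)
    a-lower i c c≤exit c≤b j = chainInd (λ k → c ≤ y! (a i j k)) λ k ih → case a-out i j k of λ
      { (inj₁ (_ , eq)) → ≤≡ eq (a1-dst-≥ i j k c ih (λ _ → c≤b))
      ; (inj₂ eq) → ≤≡ eq (≤-trans c≤exit (exitA-≥ i k)) }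

    a-lower-cut : ∀ i j k* → ¬ F ∋ a1 i j k* → ∀ k → toℕ k ≤ toℕ k* → 2 * q i + U i ≤ y! (a i j k)
    a-lower-cut i j k* missing = chainInd (λ k → toℕ k ≤ toℕ k* → exit ≤ y! (a i j k)) λ k ih k≤k* →
      case a-out i j k of λ
      { (inj₁ (Bx , eq)) → ≤≡ eq (a1-dst-≥ i j k exit
          (λ k' e → ih k' e (subst (_≤ toℕ k*) (sym (sucFin-just k e)) (strict k k≤k* Bx)))
          (λ e → ⊥-elim (<⇒≱ (subst (toℕ k* <_) (sym (sucFin-nothing k e)) (toℕ<n k*)) (strict k k≤k* Bx))))
      ; (inj₂ eq) → ≤≡ eq (exitA-≥ i k) }
      where
      exit = 2 * q i + U i
      strict : ∀ k → toℕ k ≤ toℕ k* → B ∋ a1 i j k → toℕ k < toℕ k*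
      strict k k≤k* Bx = ≤∧≢⇒< k≤k* λ eq → missing (sub _ (subst (λ z → B ∋ a1 i j z) (toℕ-injective eq) Bx))

    b-upper : ∀ i j → (∀ j' → toℕ j ≤ toℕ j' → F ∋ b1 i j') → y! (b i j) ≤ W i
    b-upper i = chainInd (λ j → (∀ j' → toℕ j ≤ toℕ j' → F ∋ b1 i j') → y! (b i j) ≤ W i) λ j ih all →
      ≤-trans (bellman (b1 i j) (all j ≤-refl)) (b1-dst-≤ i j (W i)
        (λ j' e → ih j' e (λ j'' le → all j'' (≤-trans (≤-trans (n≤1+n _) (≤-reflexive (sym (sucFin-just j e)))) le)))
        (λ _ → ≤-refl))

    a-upper : ∀ i j k → (∀ k' → toℕ k ≤ toℕ k' → F ∋ a1 i j k') → y! (a i j k) ≤ y! (b i Fin.zero)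
    a-upper i j = chainInd (λ k → (∀ k' → toℕ k ≤ toℕ k' → F ∋ a1 i j k') → y! (a i j k) ≤ y! (b i Fin.zero))
      λ k ih all → ≤-trans (bellman (a1 i j k) (all k ≤-refl)) (a1-dst-≤ i j k (y! (b i Fin.zero))
        (λ k' e → ih k' e (λ k'' le → all k'' (≤-trans (≤-trans (n≤1+n _) (≤-reflexive (sym (sucFin-just k e)))) le)))
        (λ _ → ≤-refl))

    -- Both lanes have the same distance to go beyond bit `i`. An alive bit with an intact chain
    -- lets both pass at no cost, a dead bit charges `q i` to both, so the equality survives to the
    -- next lower bit. Only an alive bit without an intact chain separates the lanes.
    module Equal (copies : Copies F) (i : Fin n) (U≡W : U i ≡ W i) where
      open Copies copies

      W≤exitB : W i ≤ 2 * q i + R + U i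
      W≤exitB = subst (_≤ 2 * q i + R + U i) U≡W (m≤n+m (U i) (2 * q i + R))

      W≤exitA : W i ≤ 2 * q i + U i
      W≤exitA = subst (_≤ 2 * q i + U i) U≡W (m≤n+m (U i) (2 * q i))

      W≤b : ∀ j → W i ≤ y! (b i j)
      W≤b = b-lower i (W i) W≤exitB ≤-refl

      module Alive (al : alive F i ≡ true) where

        b≡W : ∀ j → y! (b i j) ≡ W i
        b≡W j = ≤-antisym (b-upper i j (λ j' _ → alive-elim {F} {i} al j')) (W≤b j)

        -- Every exit from chain b is strictly more expensive than `W i` because `R` is positive.
        -- Strictness matters here: it determines the edges of the optimal tree and not only its
        -- distances.
        b1∈B : ∀ j → B ∋ b1 i j
        b1∈B j with b-out i j
        ... | inj₁ (Bx , _) = Bx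
        ... | inj₂ eq = ⊥-elim (<⇒≱ (exit>W j) (≤-reflexive (trans (sym eq) (b≡W j))))
          where
          exit>W : ∀ j → W i < 2 * q i + R + toℕ j + U i
          exit>W j = ≤-trans (subst (λ z → suc z ≤ R + U i) U≡W (s≤s (m≤n+m (U i) (s' + r' * s))))
            (≤-trans (+-monoˡ-≤ (U i) (m≤n+m R (2 * q i))) (exitB-≥ i j))

        u≡U : y! (u i) ≡ U i
        u≡U with hasU1 i
        ... | ℓ , Fx = ≤-antisym (≤-trans (bellman (u1 i ℓ) Fx) (≤-reflexive (trans (b≡W Fin.zero) (sym U≡W))))
          (case u-out i of λ
            { (inj₁ eq) → ≤-reflexive (trans U≡W (sym (trans eq (b≡W Fin.zero))))
            ; (inj₂ eq) → ≤-trans (m≤n+m (U i) (q i)) (≤-reflexive (sym eq)) })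

        W≤a : ∀ j k → W i ≤ y! (a i j k)
        W≤a = a-lower i (W i) W≤exitA (W≤b Fin.zero)

        module Chain (j : Fin r) (ch : chain F i j ≡ true) where

          a≡W : ∀ k → y! (a i j k) ≡ W i
          a≡W k = ≤-antisym (≤-trans (a-upper i j k (λ k' _ → chain-elim {F} {i} {j} ch k')) (≤-reflexive (b≡W Fin.zero))) (W≤a j k)

          a1∈B : ∀ k → B ∋ a1 i j k
          a1∈B k with a-out i j k
          ... | inj₁ (Bx , _) = Bx
          ... | inj₂ eq = ⊥-elim (<⇒≱ exit>W (≤-reflexive (trans (sym eq) (a≡W k))))
            where
            exit>W : W i < 2 * q i + toℕ k + U i
            exit>W = ≤-trans (subst (λ z → suc z ≤ R + U i) U≡W (s≤s (m≤n+m (U i) (s' + r' * s))))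
              (≤-trans (+-monoˡ-≤ (U i) (≤-trans (R≤q i) (m≤m+n (q i) _))) (exitA-≥ i k))

          w≡W : y! (w i) ≡ W i
          w≡W with hasWj i j
          ... | ℓ , Fx = ≤-antisym (≤-trans (bellman (wj i j ℓ) Fx) (≤-reflexive (a≡W Fin.zero)))
            (case w-out i of λ
              { (inj₁ (j' , eq)) → ≤-trans (W≤a j' Fin.zero) (≤-reflexive (sym eq))
              ; (inj₂ eq) → ≤-trans (m≤n+m (W i) (q i)) (≤-reflexive (sym eq)) })

          u≡w : y! (u i) ≡ y! (w i)
          u≡w = trans u≡U (trans U≡W (sym w≡W))

        -- Here `w` has to leave bit `i` through `w0` at cost `q i` or through an exit of a chain a
        -- at cost at least `2 * q i`, whereas `u` passes for free.
        module NoChain (nc : ∀ j → chain F i j ≡ false) where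

          w-high : q i + y! (u i) ≤ y! (w i)
          w-high = subst (λ z → q i + z ≤ y! (w i)) (sym u≡U) (case w-out i of λ
            { (inj₁ (j , eq)) → ≤≡ eq (≤-trans (+-monoˡ-≤ (U i) (m≤m+n (q i) _))
                (let (k* , missing) = chain-broken {F} {i} {j} (nc j) in a-lower-cut i j k* missing Fin.zero z≤n))
            ; (inj₂ eq) → ≤-reflexive (trans (cong (_+_ (q i)) U≡W) (sym eq)) })

        a1-better : ∀ j k* → ¬ F ∋ a1 i j k* → (∀ k → k ≢ k* → F ∋ a1 i j k) → Better B (a1 i j k*)
        a1-better j k* missing others = ≤-trans (s≤s dst≤) (<-≤-trans exit>W (a-lower-cut i j k* missing k* ≤-refl))
          where
          exit>W : W i < 2 * q i + U i
          exit>W = ≤-trans (subst (λ z → suc z ≤ R + U i) U≡W (s≤s (m≤n+m (U i) (s' + r' * s))))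
            (+-monoˡ-≤ (U i) (≤-trans (R≤q i) (m≤m+n (q i) _)))
          dst≤ : y! (dst (a1 i j k*)) ≤ W i
          dst≤ = a1-dst-≤ i j k* (W i)
            (λ k' e → ≤-trans (a-upper i j k' (λ k'' le → others k''
                (λ { refl → <⇒≱ (subst (_≤ toℕ k*) (sucFin-just k* e) le) ≤-refl })))
              (≤-reflexive (b≡W Fin.zero)))
            (λ _ → ≤-reflexive (b≡W Fin.zero))

      module Dead (j* : Fin R) (missing : ¬ F ∋ b1 i j*) where

        b₀-high : 2 * q i + R + U i ≤ y! (b i Fin.zero)
        b₀-high = b-lower-cut i j* missing Fin.zero z≤n

        exitA≤b₀ : 2 * q i + U i ≤ y! (b i Fin.zero)
        exitA≤b₀ = ≤-trans (+-monoˡ-≤ (U i) (m≤m+n _ R)) b₀-high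

        q≤exitA : q i + U i ≤ 2 * q i + U i
        q≤exitA = +-monoˡ-≤ (U i) (m≤m+n (q i) _)

        u≡ : y! (u i) ≡ q i + U i
        u≡ with hasU0 i
        ... | ℓ , Fx = ≤-antisym (bellman (u0 i ℓ) Fx) (case u-out i of λ
          { (inj₁ eq) → ≤≡ eq (≤-trans q≤exitA exitA≤b₀)
          ; (inj₂ eq) → ≤-reflexive (sym eq) })

        w≡ : y! (w i) ≡ q i + U i
        w≡ with hasW0 i
        ... | ℓ , Fx = ≤-antisym (≤-trans (bellman (w0 i ℓ) Fx) (≤-reflexive (cong (_+_ (q i)) (sym U≡W)))) (case w-out i of λ
          { (inj₁ (j , eq)) → ≤≡ eq (≤-trans q≤exitA (a-lower i _ ≤-refl exitA≤b₀ j Fin.zero))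
          ; (inj₂ eq) → ≤-reflexive (trans (cong (_+_ (q i)) U≡W) (sym eq)) })

        u≡w : y! (u i) ≡ y! (w i)
        u≡w = trans u≡ (sym w≡)

        -- This is the purpose of the increments of ε in the costs: each later exit of chain a is
        -- one unit dearer, and chain b costs at least `R ≥ s` units more than the first exit.
        -- Walking along chain a therefore loses strictly, which keeps `a1` out of the tree while
        -- chain b is cut.
        a-exit : ∀ j k → 2 * q i + toℕ k + U i ≤ y! (a i j k)
        a-exit j = chainInd (λ k → 2 * q i + toℕ k + U i ≤ y! (a i j k)) λ k ih → case a-out i j k of λ
          { (inj₁ (_ , eq)) → ≤≡ eq (a1-dst-≥ i j k _
              (λ k' e → ≤-trans (+-monoˡ-≤ (U i) (+-monoʳ-≤ (2 * q i)
                (≤-trans (n≤1+n _) (≤-reflexive (sym (sucFin-just k e)))))) (ih k' e))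
              (λ _ → ≤-trans (+-monoˡ-≤ (U i) (+-monoʳ-≤ (2 * q i) (≤-trans (<⇒≤ (toℕ<n k)) s≤R))) b₀-high))
          ; (inj₂ eq) → ≤-reflexive (sym eq) }

        a1∉B : ∀ j k → ¬ B ∋ a1 i j k
        a1∉B j k Bx with hasA0 i j k
        ... | ℓ , Fx = <⇒≱ (≤-trans above (≤-reflexive (sym (Y-edge tree Bx)))) (bellman (a0 i j k ℓ) Fx)
          where
          above : 2 * q i + toℕ k + U i < y! (dst (a1 i j k))
          above = a1-dst-≥ i j k _
            (λ k' e → ≤-trans (+-monoˡ-≤ (U i) (≤-trans (≤-reflexive (sym (+-suc (2 * q i) (toℕ k))))
               (+-monoʳ-≤ (2 * q i) (≤-reflexive (sym (sucFin-just k e)))))) (a-exit j k'))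
            (λ _ → ≤-trans (+-monoˡ-≤ (U i) (≤-trans (≤-reflexive (sym (+-suc (2 * q i) (toℕ k))))
               (+-monoʳ-≤ (2 * q i) (≤-trans (toℕ<n k) s≤R)))) b₀-high)

        b1-better : (∀ j → j ≢ j* → F ∋ b1 i j) → Better B (b1 i j*)
        b1-better others = ≤-trans (s≤s dst≤) (≤-trans exit>W (b-lower-cut i j* missing j* ≤-refl))
          where
          exit>W : W i < 2 * q i + R + U i
          exit>W = ≤-trans (subst (λ z → suc z ≤ R + U i) U≡W (s≤s (m≤n+m (U i) (s' + r' * s))))
            (+-monoˡ-≤ (U i) (m≤n+m R (2 * q i)))
          dst≤ : y! (dst (b1 i j*)) ≤ W i
          dst≤ = b1-dst-≤ i j* (W i)
            (λ j' e → b-upper i j' (λ j'' le → others j''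
              (λ { refl → <⇒≱ (subst (_≤ toℕ j*) (sucFin-just j* e) le) ≤-refl })))
            (λ _ → ≤-refl)

    -- With lane `w` dearer by `4 * q i`, following chain b to its end costs more than even its last
    -- exit, which is below `2 * q i + 2 * R`. An optimal tree then leaves chain b at every vertex,
    -- which is what resetting the bit means.
    module Reset (copies : Copies F) (i : Fin n) (high : 4 * q i + U i ≤ W i) where
      open Copies copies

      b-exit : ∀ j → 2 * q i + R + toℕ j + U i ≤ y! (b i j)
      b1-exit : ∀ j → (∀ j' → sucFin j ≡ just j' → 2 * q i + R + toℕ j' + U i ≤ y! (b i j')) →
        2 * q i + R + toℕ j + U i < y! (dst (b1 i j))
      b1-exit j ih = b1-dst-≥ i j _
        (λ j' e → ≤-trans (+-monoˡ-≤ (U i) (≤-reflexive (trans (sym (+-suc (2 * q i + R) (toℕ j)))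
            (cong (_+_ (2 * q i + R)) (sym (sucFin-just j e)))))) (ih j' e))
        -- The last exit has to stay below the gap `4 * q i`; this uses `R ≤ q i` twice, once for
        -- `R` itself and once for `toℕ j < R`.
        (λ _ → ≤-trans (+-monoˡ-≤ (U i) (begin
          suc (2 * q i + R + toℕ j)  ≡⟨ +-suc (2 * q i + R) (toℕ j) ⟨
          2 * q i + R + suc (toℕ j)  ≤⟨ +-mono-≤ (+-monoʳ-≤ (2 * q i) (R≤q i)) (≤-trans (toℕ<n j) (R≤q i)) ⟩
          2 * q i + q i + q i        ≡⟨ four (q i) ⟩
          4 * q i                    ∎)) high)
        where
        open ≤-Reasoning
        four : ∀ x → 2 * x + x + x ≡ 4 * x
        four = solve-∀
      b-exit = chainInd (λ j → 2 * q i + R + toℕ j + U i ≤ y! (b i j)) λ j ih → case b-out i j of λ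
        { (inj₁ (_ , eq)) → ≤≡ eq (<⇒≤ (b1-exit j ih))
        ; (inj₂ eq) → ≤-reflexive (sym eq) }

      b1∉B : ∀ j → ¬ B ∋ b1 i j
      b1∉B j Bx with hasB0 i j
      ... | ℓ , Fx = <⇒≱ (≤-trans (b1-exit j (λ j' _ → b-exit j')) (≤-reflexive (sym (Y-edge tree Bx)))) (bellman (b0 i j ℓ) Fx)

      -- `u` costs at most `q i + U i` through `u0`, and `w` at least `2 * q i + U i` whichever edge
      -- it takes. By `q-next` the difference `q i` is four times the unit of the bit below, so
      -- `high` holds there as well and the reset propagates.
      w-high : q i + y! (u i) ≤ y! (w i)
      w-high with hasU0 i
      ... | ℓ , Fx = ≤-trans (+-monoʳ-≤ (q i) (bellman (u0 i ℓ) Fx)) (≤-trans (≤-reflexive (double (q i) (U i))) (case w-out i of λ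
          { (inj₁ (j , eq)) → ≤≡ eq (a-lower i _ ≤-refl
              (≤-trans (≤-trans (+-monoˡ-≤ (U i) (m≤m+n _ R)) (exitB-≥ i Fin.zero)) (b-exit Fin.zero)) j Fin.zero)
          ; (inj₂ eq) → ≤≡ eq (≤-trans
              (≤-trans (+-monoˡ-≤ (U i) (*-monoˡ-≤ (q i) {2} {4} (s≤s (s≤s z≤n)))) high) (m≤n+m (W i) (q i))) }))
        where
        double : ∀ x z → x + (x + z) ≡ 2 * x + z
        double = solve-∀

-- Runs of Random-Facet

module Outcomes (n r' s' t : ℕ) where

  open Labels n r' s' t
  open Graph n r s t
  open Trees n r' s' t

  Outcome : Set
  Outcome = ℚ × EdgeSet × ℕ

  Free : EdgeSet → EdgeSet → Edge → Set
  Free F B e = F ∋ label e × ¬ B ∋ label e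

  diffList-free : ∀ F B → All (Free F B) (diffList F B)
  diffList-free F B = All.map (λ {e} → toFree e) (AllP.all-filter (λ e → T? (F e ∧ not (B e))) allEdges)
    where
    not-true : ∀ {x} → not x ≡ true → x ≢ true
    not-true {true} ()
    not-true {false} _ ()
    toFree : ∀ e → T (F e ∧ not (B e)) → Free F B e
    toFree e p = let (Fe , ¬Be) = ∧-true {F e} (T⇒true p) in
      ∋-label {F} {e} Fe , λ Be → not-true ¬Be (label-∋ {B} {e} Be)

  diffList-[] : ∀ F B → diffList F B ≡ [] → F ⊆ B
  diffList-[] F B eq x Fx with B (edge x) in Bx
  ... | true  = refl
  ... | false = ⊥-elim (absurd (subst (edge x ∈_) eq
          (∈-filter⁺ (λ e → T? (F e ∧ not (B e))) (∈-allFin (edge x)) (true⇒T (cong₂ _∧_ Fx (cong not Bx))))))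
    where
    absurd : edge x ∉ []
    absurd ()

  ⊆-removeEdge : ∀ {F B e} → B ⊆ F → ¬ B ∋ label e → B ⊆ removeEdge F e
  ⊆-removeEdge {F} {B} {e} B⊆F e∉B x Bx = trans (kept F e x (λ { refl → e∉B Bx })) (B⊆F x Bx)

  removeEdge-⊆ : ∀ {F} e → removeEdge F e ⊆ F
  removeEdge-⊆ {F} e x = proj₁ ∘ removed F e

  tree-optimal : ∀ {F B} → IsTree B → B ⊆ F → F ⊆ B → Optimal F B
  tree-optimal tree B⊆F F⊆B = record
    { tree = tree ; sub = B⊆F ; bellman = λ x Fx → ≤-reflexive (Y-edge tree (F⊆B x Fx)) }

  optimal-extend : ∀ {F B e} → Optimal (removeEdge F e) B → ¬ Improving B e → Optimal F B
  optimal-extend {F} {B} {e} opt ¬imp = record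
    { tree = tree ; sub = λ x Bx → removeEdge-⊆ {F} e x (sub x Bx) ; bellman = λ x Fx → bell x Fx (edge x Fin.≟ e) }
    where
    open Optimal opt
    bell : ∀ x → F ∋ x → Dec (edge x ≡ e) → Y B (src x) ≤ C x + Y B (dst x)
    bell x Fx (yes refl) = subst (λ z → Y B (src z) ≤ C z + Y B (dst z)) (label-edge x)
      (≮⇒≥ (¬imp ∘ better⇒improving B (edge x)))
    bell x Fx (no x≢e) = bellman x (trans (kept F e x (λ x≡ → x≢e (trans (cong edge x≡) (edge-label e)))) Fx)

  shift-All : ∀ {P : EdgeSet → Set} p k D → All (P ∘ proj₁ ∘ proj₂) D → All (P ∘ proj₁ ∘ proj₂) (shift p k D)
  shift-All p k D all = AllP.map⁺ (All.map id all)

  OptimalOutcome : EdgeSet → Outcome → Set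
  OptimalOutcome F = Optimal F ∘ proj₁ ∘ proj₂

  -- The last recursive call ends with an edge that does not improve, and such an edge satisfies its
  -- Bellman inequality; `optimal-extend` adds it to those known for the smaller edge set.
  outcomes-optimal : ∀ {F B D} → RF F B D → IsTree B → B ⊆ F → All (OptimalOutcome F) D
  branches-optimal : ∀ {F B es D} → Branches F B es D → IsTree B → B ⊆ F → All (Free F B) es → All (OptimalOutcome F) D
  cont-optimal : ∀ {F e D D₁} → Cont F e D D₁ → F ∋ label e → All (OptimalOutcome (removeEdge F e)) D →
    All (OptimalOutcome F) D₁
  outcomes-optimal {F} {B} (rf-done eq) tree sub = tree-optimal tree sub (diffList-[] F B eq) ∷ []
  outcomes-optimal {F} {B} (rf-step {D = D} {es = es} eq br) tree sub = shift-All {Optimal F} ((ℤ.+ 1) / suc (length es)) 0 D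
    (branches-optimal br tree sub (subst (All (Free F B)) eq (diffList-free F B)))
  branches-optimal br-nil tree sub [] = []
  branches-optimal {F} {B} (br-cons {e} rf cont br) tree sub (free-e ∷ free-es) = AllP.++⁺
    (cont-optimal cont (proj₁ free-e) (outcomes-optimal rf tree (⊆-removeEdge {F} {B} {e} sub (proj₂ free-e))))
    (branches-optimal br tree sub free-es)
  cont-optimal c-nil Fe [] = []
  cont-optimal {F} {e} (c-imp {p} {B'} {k} {D' = D'} imp rf cont) Fe (opt ∷ opts) = AllP.++⁺
    (shift-All {Optimal F} p (suc k) D' (outcomes-optimal rf (switch-tree (Optimal.tree opt) e)
      (switch-⊆ {B'} {F} e (λ x Bx → removeEdge-⊆ {F} e x (Optimal.sub opt x Bx)) Fe)))
    (cont-optimal cont Fe opts)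
  cont-optimal {F} {e} (c-not ¬imp cont) Fe (opt ∷ opts) = optimal-extend {F} {e = e} opt ¬imp ∷ cont-optimal cont Fe opts

  private
    count : EdgeSet → ℕ
    count F = Σl allEdges (λ e → if F e then 1 else 0)

    measure : EdgeSet → ℕ
    measure B = Σl allEdges (λ e → Y B (src (label e)))

    count-removeEdge : ∀ F e → F ∋ label e → count (removeEdge F e) < count F
    count-removeEdge F e Fe = Σl-mono-strict allEdges (∈-allFin e) weakly strictly
      where
      weakly : ∀ e' → (if F e' ∧ not (e' ≟E e) then 1 else 0) ≤ (if F e' then 1 else 0)
      weakly e' with F e' | e' ≟E e
      ... | true  | true  = z≤n
      ... | true  | false = ≤-refl
      ... | false | _     = z≤n
      strictly : (if F e ∧ not (e ≟E e) then 1 else 0) < (if F e then 1 else 0)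
      strictly rewrite label-∋ {F} {e} Fe | dec-true (e Fin.≟ e) refl = s≤s z≤n

    measure-switch : ∀ {B} → IsTree B → ∀ e → Better B (label e) → measure (switch B e) < measure B
    measure-switch tree e better = Σl-mono-strict allEdges (∈-allFin e)
      (λ e' → switch-Y≤ tree e better (src (label e'))) (switch-Y< tree e better)

  Runs : EdgeSet → EdgeSet → Set
  Runs F B = IsTree B → B ⊆ F → Σ Dist (RF F B)

  private
    cont-exists : ∀ F e B → F ∋ label e → IsTree B → B ⊆ removeEdge F e →
      (∀ B' → measure B' < measure B → Runs F B') →
      ∀ D → All (OptimalOutcome (removeEdge F e)) D → Σ Dist (Cont F e D)
    cont-exists F e B Fe tree sub runs [] [] = [] , c-nil
    cont-exists F e B Fe tree sub runs ((p , B' , k) ∷ D) (opt ∷ opts) =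
      let (R , cont) = cont-exists F e B Fe tree sub runs D opts in add R cont (improving? B' e)
      where
      open Optimal opt renaming (tree to tree'; sub to sub')
      add : ∀ R → Cont F e D R → Dec (Improving B' e) → Σ Dist (Cont F e ((p , B' , k) ∷ D))
      add R cont (no ¬imp) = _ , c-not ¬imp cont
      add R cont (yes imp) =
        let better = improving⇒better B' e imp
            (D' , rf) = runs (switch B' e)
              (<-≤-trans (measure-switch tree' e better)
                (Σl-mono allEdges (λ e' → optimal-≤ opt tree sub (src (label e')))))
              (switch-tree tree' e)
              (switch-⊆ {B'} {F} e (λ x Bx → removeEdge-⊆ {F} e x (sub' x Bx)) Fe)
        in _ , c-imp imp rf cont

    branches-exist : ∀ F B → IsTree B → B ⊆ F → (∀ e → F ∋ label e → Runs (removeEdge F e) B) →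
      (∀ B' → measure B' < measure B → Runs F B') →
      ∀ es → All (Free F B) es → Σ Dist (Branches F B es)
    branches-exist F B tree sub shorter runs [] [] = [] , br-nil
    branches-exist F B tree sub shorter runs (e ∷ es) ((Fe , Be) ∷ free) =
      let sub' = ⊆-removeEdge {F} {B} {e} sub Be
          (D , rf) = shorter e Fe tree sub'
          (D₁ , cont) = cont-exists F e B Fe tree sub' runs D (outcomes-optimal rf tree sub')
          (R , br) = branches-exist F B tree sub shorter runs es free
      in _ , br-cons rf cont br

    step-exists : ∀ F B → (∀ e → F ∋ label e → Runs (removeEdge F e) B) →
      (∀ B' → measure B' < measure B → Runs F B') → Runs F B
    step-exists F B shorter runs tree sub = go (diffList F B) refl
      where
      go : ∀ es → diffList F B ≡ es → Σ Dist (RF F B)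
      go []       eq = _ , rf-done eq
      go (e ∷ es) eq = let (D , br) = branches-exist F B tree sub shorter runs (e ∷ es)
                             (subst (All (Free F B)) eq (diffList-free F B)) in _ , rf-step eq br

    -- Lexicographic recursion. The first recursive call loses an edge. The second keeps `F` but
    -- starts from a smaller `measure`: `B'` is optimal for the smaller edge set, hence no worse
    -- than `B`, and the switch lowers it strictly.
    runs-bounded : ∀ c F → count F < c → ∀ m B → measure B < m → Runs F B
    runs-bounded (suc c) F count< (suc m) B measure< = step-exists F B
      (λ e Fe → runs-bounded c (removeEdge F e) (<-≤-trans (count-removeEdge F e Fe) (≤-pred count<))
        (suc (measure B)) B ≤-refl)
      (λ B' B'< → runs-bounded (suc c) F count< m B' (<-≤-trans B'< (≤-pred measure<)))

  RF-exists : ∀ F B → Runs F B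
  RF-exists F B = runs-bounded (suc (count F)) F ≤-refl (suc (measure B)) B ≤-refl

  -- The recursive calls are hidden inside lists of outcomes and of branches. Copies of these two
  -- relations that carry `P` for each call yield an induction principle with hypotheses for both
  -- calls of the algorithm.
  module _ (P : EdgeSet → EdgeSet → Dist → Set) where

    data ContWith (F : EdgeSet) (e : Edge) : Dist → Dist → Set where
      nil : ContWith F e [] []
      imp : ∀ {p B' k D D' R} → Improving B' e → RF F (switch B' e) D' → P F (switch B' e) D' →
            ContWith F e D R → ContWith F e ((p , B' , k) ∷ D) (shift p (suc k) D' ++ R)
      stay : ∀ {p B' k D R} → ¬ Improving B' e → ContWith F e D R →
             ContWith F e ((p , B' , k) ∷ D) ((p , B' , k) ∷ R)

    data BranchesWith (F B : EdgeSet) : List Edge → Dist → Set where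
      nil  : BranchesWith F B [] []
      cons : ∀ {e es D D₁ R} → RF (removeEdge F e) B D → P (removeEdge F e) B D → ContWith F e D D₁ →
             BranchesWith F B es R → BranchesWith F B (e ∷ es) (D₁ ++ R)

    module _ (done : ∀ {F B} → diffList F B ≡ [] → P F B ((1ℚ , B , 0) ∷ []))
             (step : ∀ {F B D e es} → diffList F B ≡ e ∷ es → Branches F B (e ∷ es) D → BranchesWith F B (e ∷ es) D →
                     P F B (shift ((ℤ.+ 1) / suc (length es)) 0 D)) where

      RF-ind : ∀ {F B D} → RF F B D → P F B D
      branches-ind : ∀ {F B es D} → Branches F B es D → BranchesWith F B es D
      cont-ind : ∀ {F e D D₁} → Cont F e D D₁ → ContWith F e D D₁
      RF-ind (rf-done eq) = done eq
      RF-ind (rf-step eq br) = step eq br (branches-ind br)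
      branches-ind br-nil = nil
      branches-ind (br-cons rf cont br) = cons rf (RF-ind rf) (cont-ind cont) (branches-ind br)
      cont-ind c-nil = nil
      cont-ind (c-imp i rf cont) = imp i rf (RF-ind rf) (cont-ind cont)
      cont-ind (c-not ¬i cont) = stay ¬i (cont-ind cont)

-- Expectations

open +-*-Solver using (solve; _:=_; _:+_; _:*_)

-- X ≤ Y τ + Z; the form in which lower bounds on expectations are averaged without subtraction.
record LowerBound (Y X Z : ℕ) (τ : ℚ) : Set where
  constructor lower
  field bound : ℕtoℚ X ℚ.≤ ℕtoℚ Y ℚ.* τ ℚ.+ ℕtoℚ Z

open LowerBound

lowerBound-scale : ∀ c {Y X Z τ} → LowerBound Y X Z τ → LowerBound (c * Y) (c * X) (c * Z) τ
lowerBound-scale c {Y} {X} {Z} {τ} low = lower (subst₂ ℚ._≤_ (sym (ℕtoℚ-* c X)) eq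
  (ℚP.*-monoˡ-≤-nonNeg (ℕtoℚ c) {{ℕtoℚ-nonNeg c}} (bound low)))
  where
  eq : ℕtoℚ c ℚ.* (ℕtoℚ Y ℚ.* τ ℚ.+ ℕtoℚ Z) ≡ ℕtoℚ (c * Y) ℚ.* τ ℚ.+ ℕtoℚ (c * Z)
  eq = trans (solve 4 (λ c y τ z → c :* (y :* τ :+ z) := (c :* y) :* τ :+ c :* z) refl (ℕtoℚ c) (ℕtoℚ Y) τ (ℕtoℚ Z))
    (cong₂ ℚ._+_ (cong (ℚ._* τ) (sym (ℕtoℚ-* c Y))) (sym (ℕtoℚ-* c Z)))

lowerBound-cancel : ∀ c {Y X Z τ} → LowerBound (suc c * Y) (suc c * X) (suc c * Z) τ → LowerBound Y X Z τ
lowerBound-cancel c {Y} {X} {Z} {τ} low = lower (ℚP.*-cancelˡ-≤-pos (ℕtoℚ (suc c)) {{ℕtoℚ-pos c}}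
  (subst₂ ℚ._≤_ (ℕtoℚ-* (suc c) X) eq (bound low)))
  where
  eq : ℕtoℚ (suc c * Y) ℚ.* τ ℚ.+ ℕtoℚ (suc c * Z) ≡ ℕtoℚ (suc c) ℚ.* (ℕtoℚ Y ℚ.* τ ℚ.+ ℕtoℚ Z)
  eq = trans (cong₂ ℚ._+_ (cong (ℚ._* τ) (ℕtoℚ-* (suc c) Y)) (ℕtoℚ-* (suc c) Z))
    (solve 4 (λ c y τ z → (c :* y) :* τ :+ c :* z := c :* (y :* τ :+ z)) refl (ℕtoℚ (suc c)) (ℕtoℚ Y) τ (ℕtoℚ Z))

lowerBound-relax : ∀ {Y X Z X' Z' τ} → X' ≤ X → Z ≤ Z' → LowerBound Y X Z τ → LowerBound Y X' Z' τ
lowerBound-relax {Y} {τ = τ} X'≤X Z≤Z' low = lower (ℚP.≤-trans (ℕtoℚ-mono-≤ X'≤X)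
  (ℚP.≤-trans (bound low) (ℚP.+-monoʳ-≤ (ℕtoℚ Y ℚ.* τ) (ℕtoℚ-mono-≤ Z≤Z'))))

lowerBound-trivial : ∀ {Y X Z τ} → 0ℚ ℚ.≤ τ → X ≤ Z → LowerBound Y X Z τ
lowerBound-trivial {Y} {X} {Z} {τ} 0≤τ X≤Z = lower (ℚP.≤-trans (ℕtoℚ-mono-≤ X≤Z)
  (subst (ℚ._≤ ℕtoℚ Y ℚ.* τ ℚ.+ ℕtoℚ Z) (ℚP.+-identityˡ (ℕtoℚ Z)) (ℚP.+-monoˡ-≤ (ℕtoℚ Z)
    (subst (ℚ._≤ ℕtoℚ Y ℚ.* τ) (ℚP.*-zeroʳ (ℕtoℚ Y)) (ℚP.*-monoˡ-≤-nonNeg (ℕtoℚ Y) {{ℕtoℚ-nonNeg Y}} 0≤τ)))))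

module Expectation (n r' s' t : ℕ) where

  open Labels n r' s' t
  open Graph n r s t
  open Trees n r' s' t
  open Outcomes n r' s' t

  sumD : (ℕ → ℚ) → Dist → ℚ
  sumD f [] = 0ℚ
  sumD f ((p , _ , k) ∷ D) = p ℚ.* f k ℚ.+ sumD f D

  -- On a distribution of mass 1, `total` is one plus the expected number of switches. This is the
  -- quantity that obeys the counting recursion exactly, and it is at least 1 for every run.
  mass total : Dist → ℚ
  mass = sumD (λ _ → 1ℚ)
  total = sumD (λ k → ℕtoℚ (suc k))

  NonNeg : Dist → Set
  NonNeg = All (λ o → 0ℚ ℚ.≤ proj₁ o)

  sumD-++ : ∀ f D D' → sumD f (D ++ D') ≡ sumD f D ℚ.+ sumD f D'
  sumD-++ f [] D' = sym (ℚP.+-identityˡ (sumD f D'))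
  sumD-++ f ((p , _ , k) ∷ D) D' = trans (cong (p ℚ.* f k ℚ.+_) (sumD-++ f D D'))
    (sym (ℚP.+-assoc (p ℚ.* f k) (sumD f D) (sumD f D')))

  ℕtoℚ-suc : ∀ k → ℕtoℚ (suc k) ≡ 1ℚ ℚ.+ ℕtoℚ k
  ℕtoℚ-suc k = ℕtoℚ-+ 1 k

  total≡mass+switches : ∀ D → total D ≡ mass D ℚ.+ expectedSwitches D
  total≡mass+switches [] = refl
  total≡mass+switches ((p , _ , k) ∷ D) = trans (cong₂ (λ x y → p ℚ.* x ℚ.+ y) (ℕtoℚ-suc k) (total≡mass+switches D))
    (solve 5 (λ p one k m e → p :* (one :+ k) :+ (m :+ e) := (p :* one :+ m) :+ (p :* k :+ e)) refl
      p 1ℚ (ℕtoℚ k) (mass D) (expectedSwitches D))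

  mass-shift : ∀ p k D → mass (shift p k D) ≡ p ℚ.* mass D
  mass-shift p k [] = sym (ℚP.*-zeroʳ p)
  mass-shift p k ((p' , _ , k') ∷ D) = trans (cong (p ℚ.* p' ℚ.* 1ℚ ℚ.+_) (mass-shift p k D))
    (solve 4 (λ p p' one m → (p :* p') :* one :+ p :* m := p :* (p' :* one :+ m)) refl p p' 1ℚ (mass D))

  total-shift : ∀ p k D → total (shift p k D) ≡ p ℚ.* (total D ℚ.+ ℕtoℚ k ℚ.* mass D)
  total-shift p k [] = sym (trans (cong (p ℚ.*_) (trans (ℚP.+-identityˡ _) (ℚP.*-zeroʳ (ℕtoℚ k)))) (ℚP.*-zeroʳ p))
  total-shift p k ((p' , _ , k') ∷ D) = trans
    (cong₂ (λ x y → p ℚ.* p' ℚ.* x ℚ.+ y)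
      (trans (cong ℕtoℚ (sym (+-suc k k'))) (ℕtoℚ-+ k (suc k')))
      (total-shift p k D))
    (trans (cong (λ z → p ℚ.* p' ℚ.* (z ℚ.+ ℕtoℚ (suc k')) ℚ.+ p ℚ.* (total D ℚ.+ ℕtoℚ k ℚ.* mass D)) (sym (ℚP.*-identityʳ (ℕtoℚ k))))
    (solve 7 (λ p p' k one k' x m →
      (p :* p') :* (k :* one :+ k') :+ p :* (x :+ k :* m) := p :* ((p' :* k' :+ x) :+ k :* (p' :* one :+ m))) refl
      p p' (ℕtoℚ k) 1ℚ (ℕtoℚ (suc k')) (total D) (mass D)))

  nonNeg-* : ∀ {x y} → 0ℚ ℚ.≤ x → 0ℚ ℚ.≤ y → 0ℚ ℚ.≤ x ℚ.* y
  nonNeg-* {x} {y} 0≤x 0≤y = subst (ℚ._≤ x ℚ.* y) (ℚP.*-zeroʳ x)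
    (ℚP.*-monoˡ-≤-nonNeg x {{ℚ.nonNegative 0≤x}} 0≤y)

  nonNeg-shift : ∀ {p} k {D} → 0ℚ ℚ.≤ p → NonNeg D → NonNeg (shift p k D)
  nonNeg-shift k 0≤p nn = AllP.map⁺ (All.map (nonNeg-* 0≤p) nn)

  RF-nonNeg : ∀ {F B D} → RF F B D → NonNeg D
  branches-nonNeg : ∀ {F B es D} → Branches F B es D → NonNeg D
  cont-nonNeg : ∀ {F e D D₁} → Cont F e D D₁ → NonNeg D → NonNeg D₁
  RF-nonNeg (rf-done _) = ℕtoℚ-mono-≤ {0} {1} z≤n ∷ []
  RF-nonNeg (rf-step {es = es} _ br) = nonNeg-shift {(ℤ.+ 1) / suc (length es)} 0
    (ℚP.<⇒≤ (ℚP.positive⁻¹ _ {{reciprocal-pos (length es)}})) (branches-nonNeg br)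
  branches-nonNeg br-nil = []
  branches-nonNeg (br-cons rf cont br) = AllP.++⁺ (cont-nonNeg cont (RF-nonNeg rf)) (branches-nonNeg br)
  cont-nonNeg c-nil [] = []
  cont-nonNeg (c-imp {k = k} _ rf cont) (0≤p ∷ nn) = AllP.++⁺ (nonNeg-shift (suc k) 0≤p (RF-nonNeg rf)) (cont-nonNeg cont nn)
  cont-nonNeg (c-not _ cont) (0≤p ∷ nn) = 0≤p ∷ cont-nonNeg cont nn

  RF-mass : ∀ {F B D} → RF F B D → mass D ≡ 1ℚ
  branches-mass : ∀ {F B es D} → Branches F B es D → mass D ≡ ℕtoℚ (length es)
  cont-mass : ∀ {F e D D₁} → Cont F e D D₁ → mass D₁ ≡ mass D
  RF-mass (rf-done _) = trans (ℚP.+-identityʳ (1ℚ ℚ.* 1ℚ)) (ℚP.*-identityʳ 1ℚ)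
  RF-mass (rf-step {D = D} {es = es} _ br) = trans (mass-shift ((ℤ.+ 1) / suc (length es)) 0 D)
    (trans (cong ((ℤ.+ 1) / suc (length es) ℚ.*_) (branches-mass br))
      (trans (ℚP.*-comm ((ℤ.+ 1) / suc (length es)) (ℕtoℚ (suc (length es)))) (reciprocal (length es))))
  branches-mass br-nil = refl
  branches-mass (br-cons {es = es} {D = D} {D₁} {R} rf cont br) = trans (sumD-++ (λ _ → 1ℚ) D₁ R)
    (trans (cong₂ ℚ._+_ (trans (cont-mass cont) (RF-mass rf)) (branches-mass br)) (sym (ℕtoℚ-suc (length es))))
  cont-mass c-nil = refl
  cont-mass (c-imp {p} {k = k} {D' = D'} {R = R} _ rf cont) = trans (sumD-++ (λ _ → 1ℚ) (shift p (suc k) D') R)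
    (cong₂ ℚ._+_ (trans (mass-shift p (suc k) D') (cong (p ℚ.*_) (RF-mass rf))) (cont-mass cont))
  cont-mass (c-not {p} _ cont) = cong (p ℚ.* 1ℚ ℚ.+_) (cont-mass cont)

  mass≤total : ∀ {D} → NonNeg D → mass D ℚ.≤ total D
  mass≤total [] = ℚP.≤-refl
  mass≤total {(p , _ , k) ∷ D} (0≤p ∷ nn) = ℚP.+-mono-≤
    (ℚP.*-monoˡ-≤-nonNeg p {{ℚ.nonNegative 0≤p}} (ℕtoℚ-mono-≤ {1} {suc k} (s≤s z≤n))) (mass≤total nn)

  1≤total : ∀ {F B D} → RF F B D → 1ℚ ℚ.≤ total D
  1≤total {D = D} rf = subst (ℚ._≤ total D) (RF-mass rf) (mass≤total (RF-nonNeg rf))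

  0≤total : ∀ {F B D} → RF F B D → 0ℚ ℚ.≤ total D
  0≤total rf = ℚP.≤-trans (ℕtoℚ-mono-≤ {0} {1} z≤n) (1≤total rf)

  total-imp : ∀ p k {F B D'} R → RF F B D' →
    total (shift p (suc k) D' ++ R) ≡ p ℚ.* (total D' ℚ.+ ℕtoℚ (suc k)) ℚ.+ total R
  total-imp p k {D' = D'} R rf = trans (sumD-++ (λ k → ℕtoℚ (suc k)) (shift p (suc k) D') R) (cong (ℚ._+ total R)
    (trans (total-shift p (suc k) D') (cong (λ z → p ℚ.* (total D' ℚ.+ z))
      (trans (cong (ℕtoℚ (suc k) ℚ.*_) (RF-mass rf)) (ℚP.*-identityʳ (ℕtoℚ (suc k)))))))

  module _ {P : EdgeSet → EdgeSet → Dist → Set} where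

    cont-total-≥ : ∀ {F e D D₁} → ContWith P F e D D₁ → NonNeg D → total D ℚ.≤ total D₁
    cont-total-≥ nil [] = ℚP.≤-refl
    cont-total-≥ (stay {p} {k = k} _ cont) (_ ∷ nn) = ℚP.+-monoʳ-≤ (p ℚ.* ℕtoℚ (suc k)) (cont-total-≥ cont nn)
    cont-total-≥ (imp {p} {k = k} {D} {D'} {R} _ rf _ cont) (0≤p ∷ nn) = subst (p ℚ.* ℕtoℚ (suc k) ℚ.+ total D ℚ.≤_) (sym (total-imp p k R rf))
      (ℚP.+-mono-≤ (ℚP.*-monoˡ-≤-nonNeg p {{ℚ.nonNegative 0≤p}}
        (subst (ℚ._≤ total D' ℚ.+ ℕtoℚ (suc k)) (ℚP.+-identityˡ (ℕtoℚ (suc k))) (ℚP.+-monoˡ-≤ (ℕtoℚ (suc k)) (0≤total rf))))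
        (cont-total-≥ cont nn))

    -- If `k` switches precede the switch on `e` and `k'` follow it, then `suc (k + suc k')` is
    -- `suc k + suc k'`: the switch on `e` supplies the additional one, so the totals of the two
    -- recursive calls simply add up.
    cont-total-imp : ∀ {F e D D₁} Y X Z → ContWith P F e D D₁ → NonNeg D →
      All (λ o → Improving (proj₁ (proj₂ o)) e ×
        (∀ {D'} → RF F (switch (proj₁ (proj₂ o)) e) D' → P F (switch (proj₁ (proj₂ o)) e) D' → LowerBound Y X Z (total D'))) D →
      ℕtoℚ Y ℚ.* total D ℚ.+ ℕtoℚ X ℚ.* mass D ℚ.≤ ℕtoℚ Y ℚ.* total D₁ ℚ.+ ℕtoℚ Z ℚ.* mass D
    cont-total-imp Y X Z nil [] [] = ℚP.≤-reflexive (cong (ℕtoℚ Y ℚ.* 0ℚ ℚ.+_)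
      (trans (ℚP.*-zeroʳ (ℕtoℚ X)) (sym (ℚP.*-zeroʳ (ℕtoℚ Z)))))
    cont-total-imp Y X Z (stay ¬i _) (_ ∷ _) ((i , _) ∷ _) = ⊥-elim (¬i i)
    cont-total-imp Y X Z (imp {p} {k = k} {D} {D'} {R} _ rf pd cont) (0≤p ∷ nn) ((_ , low) ∷ lows) =
      subst₂ ℚ._≤_
        (solve 7 (λ p y k x d one m → p :* (y :* k :+ x :* one) :+ (y :* d :+ x :* m) :=
            y :* (p :* k :+ d) :+ x :* (p :* one :+ m)) refl
          p (ℕtoℚ Y) (ℕtoℚ (suc k)) (ℕtoℚ X) (total D) 1ℚ (mass D))
        (trans (solve 8 (λ p y k z d' one m R' → p :* (y :* k :+ (y :* d' :+ z :* one)) :+ (y :* R' :+ z :* m) :=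
            y :* (p :* (d' :+ k) :+ R') :+ z :* (p :* one :+ m)) refl
          p (ℕtoℚ Y) (ℕtoℚ (suc k)) (ℕtoℚ Z) (total D') 1ℚ (mass D) (total R))
          (cong (λ z → ℕtoℚ Y ℚ.* z ℚ.+ ℕtoℚ Z ℚ.* (p ℚ.* 1ℚ ℚ.+ mass D)) (sym (total-imp p k R rf))))
        (ℚP.+-mono-≤ (ℚP.*-monoˡ-≤-nonNeg p {{ℚ.nonNegative 0≤p}} (ℚP.+-monoʳ-≤ (ℕtoℚ Y ℚ.* ℕtoℚ (suc k))
            (subst₂ (λ x z → x ℚ.≤ ℕtoℚ Y ℚ.* total D' ℚ.+ z) (sym (ℚP.*-identityʳ (ℕtoℚ X)))
              (sym (ℚP.*-identityʳ (ℕtoℚ Z))) (bound (low rf pd)))))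
          (cont-total-imp Y X Z cont nn lows))

    lowerBound-cont : ∀ {F F' B e D D₁ Y X Z} → RF F' B D → ContWith P F e D D₁ →
      LowerBound Y X Z (total D) → LowerBound Y X Z (total D₁)
    lowerBound-cont {Y = Y} {Z = Z} rf cont low = lower (ℚP.≤-trans (bound low) (ℚP.+-monoˡ-≤ (ℕtoℚ Z)
      (ℚP.*-monoˡ-≤-nonNeg (ℕtoℚ Y) {{ℕtoℚ-nonNeg Y}} (cont-total-≥ cont (RF-nonNeg rf)))))

    lowerBound-imp : ∀ {F B F' e D D₁ Y X₁ Z₁ X Z} → RF F' B D → ContWith P F e D D₁ →
      LowerBound Y X₁ Z₁ (total D) →
      All (λ o → Improving (proj₁ (proj₂ o)) e ×
        (∀ {D'} → RF F (switch (proj₁ (proj₂ o)) e) D' → P F (switch (proj₁ (proj₂ o)) e) D' → LowerBound Y X Z (total D'))) D →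
      LowerBound Y (X₁ + X) (Z₁ + Z) (total D₁)
    lowerBound-imp {D = D} {D₁} {Y} {X₁} {Z₁} {X} {Z} rf cont low all = lower (begin
      ℕtoℚ (X₁ + X)                                        ≡⟨ ℕtoℚ-+ X₁ X ⟩
      ℕtoℚ X₁ ℚ.+ ℕtoℚ X                                   ≤⟨ ℚP.+-monoˡ-≤ (ℕtoℚ X) (bound low) ⟩
      (yt ℚ.+ ℕtoℚ Z₁) ℚ.+ ℕtoℚ X                          ≡⟨ solve 3 (λ x z w → (x :+ z) :+ w := z :+ (x :+ w)) refl yt (ℕtoℚ Z₁) (ℕtoℚ X) ⟩
      ℕtoℚ Z₁ ℚ.+ (yt ℚ.+ ℕtoℚ X)                          ≤⟨ ℚP.+-monoʳ-≤ (ℕtoℚ Z₁)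
                                                               (subst₂ (λ c z → yt ℚ.+ c ℚ.≤ yt₁ ℚ.+ z) (unit X) (unit Z)
                                                                 (cont-total-imp Y X Z cont (RF-nonNeg rf) all)) ⟩
      ℕtoℚ Z₁ ℚ.+ (yt₁ ℚ.+ ℕtoℚ Z)                         ≡⟨ solve 3 (λ x z w → x :+ (z :+ w) := z :+ (x :+ w)) refl (ℕtoℚ Z₁) yt₁ (ℕtoℚ Z) ⟩
      yt₁ ℚ.+ (ℕtoℚ Z₁ ℚ.+ ℕtoℚ Z)                         ≡⟨ cong (yt₁ ℚ.+_) (ℕtoℚ-+ Z₁ Z) ⟨
      yt₁ ℚ.+ ℕtoℚ (Z₁ + Z)                                ∎)
      where
      open ℚP.≤-Reasoning
      yt yt₁ : ℚ
      yt = ℕtoℚ Y ℚ.* total D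
      yt₁ = ℕtoℚ Y ℚ.* total D₁
      unit : ∀ k → ℕtoℚ k ℚ.* mass D ≡ ℕtoℚ k
      unit k = trans (cong (ℕtoℚ k ℚ.*_) (RF-mass rf)) (ℚP.*-identityʳ (ℕtoℚ k))

    branches-lower : ∀ {F B es D} Y (X Z : Edge → ℕ) → BranchesWith P F B es D →
      (∀ e → e ∈ es → ∀ {D D₁} → RF (removeEdge F e) B D → P (removeEdge F e) B D → ContWith P F e D D₁ →
        LowerBound Y (X e) (Z e) (total D₁)) →
      LowerBound Y (Σl es X) (Σl es Z) (total D)
    branches-lower Y X Z nil bounds = lowerBound-trivial {Y} {0} {0} ℚP.≤-refl z≤n
    branches-lower Y X Z (cons {e} {es} {D₁ = D₁} {R} rf pd cont br) bounds = lower (subst₂ ℚ._≤_ (sym (ℕtoℚ-+ (X e) (Σl es X)))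
      (trans (solve 5 (λ y t z r w → (y :* t :+ z) :+ (y :* r :+ w) := y :* (t :+ r) :+ (z :+ w)) refl
          (ℕtoℚ Y) (total D₁) (ℕtoℚ (Z e)) (total R) (ℕtoℚ (Σl es Z)))
        (cong₂ (λ t z → ℕtoℚ Y ℚ.* t ℚ.+ z) (sym (sumD-++ (λ k → ℕtoℚ (suc k)) D₁ R)) (sym (ℕtoℚ-+ (Z e) (Σl es Z)))))
      (ℚP.+-mono-≤ (bound (bounds e (here refl) rf pd cont)) (bound (branches-lower Y X Z br (λ e' e'∈ → bounds e' (there e'∈))))))
  
    -- The condition on the sums says that the average of `Xₑ - Zₑ` over the branches is at least
    -- `X - Z`, with the negative terms moved to the other side.
    average-lower : ∀ {F B e es D} Y X Z (Xₑ Zₑ : Edge → ℕ) → BranchesWith P F B (e ∷ es) D →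
      (∀ e' → e' ∈ e ∷ es → ∀ {D D₁} → RF (removeEdge F e') B D → P (removeEdge F e') B D → ContWith P F e' D D₁ →
        LowerBound Y (Xₑ e') (Zₑ e') (total D₁)) →
      Σl (e ∷ es) (λ e' → X + Zₑ e') ≤ Σl (e ∷ es) (λ e' → Xₑ e' + Z) →
      LowerBound Y X Z (total (shift ((ℤ.+ 1) / suc (length es)) 0 D))
    average-lower {e = e} {es} {D} Y X Z Xₑ Zₑ br bounds sums =
      lower (ℚP.*-cancelˡ-≤-pos N {{ℕtoℚ-pos (length es)}} (cancel (begin
        N ℚ.* ℕtoℚ X ℚ.+ zs                            ≡⟨ cong₂ ℚ._+_ (ℕtoℚ-* (suc (length es)) X) refl ⟨
        ℕtoℚ (suc (length es) * X) ℚ.+ zs              ≡⟨ ℕtoℚ-+ (suc (length es) * X) (Σl (e ∷ es) Zₑ) ⟨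
        ℕtoℚ (suc (length es) * X + Σl (e ∷ es) Zₑ)   ≤⟨ ℕtoℚ-mono-≤ sums' ⟩
        ℕtoℚ (Σl (e ∷ es) Xₑ + suc (length es) * Z)   ≡⟨ ℕtoℚ-+ (Σl (e ∷ es) Xₑ) (suc (length es) * Z) ⟩
        ℕtoℚ (Σl (e ∷ es) Xₑ) ℚ.+ ℕtoℚ (suc (length es) * Z)
                                                      ≤⟨ ℚP.+-monoˡ-≤ _ (bound (branches-lower Y Xₑ Zₑ br bounds)) ⟩
        (ys ℚ.* total D ℚ.+ zs) ℚ.+ ℕtoℚ (suc (length es) * Z)
                                                      ≡⟨ cong₂ (λ t w → (ys ℚ.* t ℚ.+ zs) ℚ.+ w) unshift (ℕtoℚ-* (suc (length es)) Z) ⟩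
        (ys ℚ.* (N ℚ.* τ) ℚ.+ zs) ℚ.+ N ℚ.* ℕtoℚ Z      ≡⟨ solve 5 (λ y m t z w → (y :* (m :* t) :+ z) :+ m :* w :=
                                                           m :* (y :* t :+ w) :+ z) refl ys N τ zs (ℕtoℚ Z) ⟩
        N ℚ.* (ys ℚ.* τ ℚ.+ ℕtoℚ Z) ℚ.+ zs              ∎)))
      where
      open ℚP.≤-Reasoning
      N zs ys τ : ℚ
      N = ℕtoℚ (suc (length es))
      zs = ℕtoℚ (Σl (e ∷ es) Zₑ)
      ys = ℕtoℚ Y
      τ = total (shift ((ℤ.+ 1) / suc (length es)) 0 D)
      sums' : suc (length es) * X + Σl (e ∷ es) Zₑ ≤ Σl (e ∷ es) Xₑ + suc (length es) * Z
      sums' = subst₂ _≤_ (trans (Σl-+ (e ∷ es) (λ _ → X) Zₑ) (cong (_+ Σl (e ∷ es) Zₑ) (Σl-const (e ∷ es) X)))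
        (trans (Σl-+ (e ∷ es) Xₑ (λ _ → Z)) (cong (Σl (e ∷ es) Xₑ +_) (Σl-const (e ∷ es) Z))) sums
      unshift : total D ≡ N ℚ.* τ
      unshift = sym (trans (cong (N ℚ.*_) (total-shift ((ℤ.+ 1) / suc (length es)) 0 D))
        (trans (sym (ℚP.*-assoc N ((ℤ.+ 1) / suc (length es)) _)) (trans (cong₂ ℚ._*_ (reciprocal (length es))
          (trans (cong (total D ℚ.+_) (ℚP.*-zeroˡ (mass D))) (ℚP.+-identityʳ (total D)))) (ℚP.*-identityˡ (total D)))))
      cancel : ∀ {p q} → p ℚ.+ zs ℚ.≤ q ℚ.+ zs → p ℚ.≤ q
      cancel {p} {q} le = subst₂ ℚ._≤_ (drop p) (drop q) (ℚP.+-monoˡ-≤ (ℚ.- zs) le)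
        where
        drop : ∀ p → (p ℚ.+ zs) ℚ.+ ℚ.- zs ≡ p
        drop p = trans (ℚP.+-assoc p zs (ℚ.- zs)) (trans (cong (p ℚ.+_) (ℚP.+-inverseʳ zs)) (ℚP.+-identityʳ p))

-- Penalties

∑-drop : ∀ {n} (f f' : Fin n → ℕ) i → f i ≡ suc (f' i) → (∀ j → j ≢ i → f j ≡ f' j) → ∑ f ≡ suc (∑ f')
∑-drop f f' Fin.zero at others = cong₂ _+_ at (∑-cong (λ j → others (Fin.suc j) (λ ())))
∑-drop f f' (Fin.suc i) at others = trans (cong₂ _+_ (others Fin.zero (λ ()))
  (∑-drop (f ∘ Fin.suc) (f' ∘ Fin.suc) i at (λ j j≢i → others (Fin.suc j) (j≢i ∘ FinP.suc-injective))))
  (+-suc (f' Fin.zero) _)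

∑-zero : ∀ n → ∑ {n} (λ _ → 0) ≡ 0
∑-zero n = trans (∑-const n 0) (*-zeroʳ n)

indicator : Bool → ℕ
indicator x = if x then 1 else 0

below : ∀ {n} → (Fin n → Bool) → ℕ → Fin n → Bool
below al p i = (toℕ i Data.Nat.<ᵇ p) ∧ al i

-- The i-th selected index, in increasing order, has i selected indices below it.
∑-ranks : ∀ {n} (al : Fin n → Bool) p (g : ℕ → ℕ) →
  ∑ (λ i → if below al p i then g (∑ (indicator ∘ below al (toℕ i))) else 0) ≡
  ∑ {∑ (indicator ∘ below al p)} (g ∘ toℕ)
∑-ranks {zero}  al p g = refl
∑-ranks {suc n} al zero g = trans (∑-zero n) (sym (cong (λ m → ∑ {m} (g ∘ toℕ)) (∑-zero n)))
∑-ranks {suc n} al (suc p) g with al Fin.zero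
... | true = cong₂ _+_ (cong g (∑-zero n)) (∑-ranks (al ∘ Fin.suc) p (g ∘ suc))
... | false = ∑-ranks (al ∘ Fin.suc) p g

+-bumpˡ : ∀ x z d {x' z'} → x' ≤ x + d → z' ≤ z → x' + z' ≤ (x + z) + d
+-bumpˡ x z d l r = ≤-trans (+-mono-≤ l r) (≤-reflexive (swap x d z))
  where
  swap : ∀ x d z → (x + d) + z ≡ (x + z) + d
  swap = solve-∀

+-bumpʳ : ∀ x z d {x' z'} → x' ≤ x → z' ≤ z + d → x' + z' ≤ (x + z) + d
+-bumpʳ x z d l r = ≤-trans (+-mono-≤ l r) (≤-reflexive (sym (+-assoc x z d)))

module Penalty (n r' s' t : ℕ) where

  open Labels n r' s' t
  open Graph n r s t
  open Trees n r' s' t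
  open Structure n r' s' t

  active : EdgeSet → ℕ → Fin n → Bool
  active F = below (alive F)

  #active : EdgeSet → ℕ → ℕ
  #active F p = ∑ (indicator ∘ active F p)

  weight : EdgeSet → (Fin t → EdgeLabel) → ℕ
  weight F x = 2 ^ gaps (λ ℓ → F (edge (x ℓ)))

  chainWeight : EdgeSet → ℕ → Fin n → ℕ
  chainWeight F p i = if active F p i then 2 ^ gaps (chain F i) else 0

  penA penB penWj fromWj fromU0 fromU1 fromB bitPenalty : EdgeSet → Fin n → ℕ
  penA F i = ∑ (λ j → ∑ λ k → weight F (a0 i j k))
  penB F i = ∑ (λ j → weight F (b0 i j))
  penWj F i = ∑ (λ j → weight F (wj i j))
  fromWj F i = penWj F i + weight F (w0 i)
  fromU0 F i = weight F (u0 i) + fromWj F i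
  fromU1 F i = weight F (u1 i) + fromU0 F i
  fromB F i = penB F i + fromU1 F i
  bitPenalty F i = penA F i + fromB F i

  -- Each group of parallel alternatives, t copies of an edge or the chains a of an active bit, weighs 2 to the number of
  -- alternatives already removed.  As long as the total stays below 2ᵗ, every group still has an alternative.
  penalty : EdgeSet → ℕ → ℕ
  penalty F p = ∑ (λ i → bitPenalty F i + chainWeight F p i)

  active-intro : ∀ {F p i} → toℕ i < p → alive F i ≡ true → active F p i ≡ true
  active-intro i<p al = cong₂ _∧_ (T⇒true (<⇒<ᵇ i<p)) al

  active-elim : ∀ {F p i} → active F p i ≡ true → toℕ i < p × alive F i ≡ true
  active-elim {F} {p} {i} act = let (lt , al) = ∧-true {toℕ i Data.Nat.<ᵇ p} act in <ᵇ⇒< (toℕ i) p (true⇒T lt) , al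

  private
    2^-cancel-< : ∀ {x z} → 2 ^ x < 2 ^ z → x < z
    2^-cancel-< {x} {z} lt with x <? z
    ... | yes p = p
    ... | no ¬p = ⊥-elim (<⇒≱ lt (^-monoʳ-≤ 2 (≮⇒≥ ¬p)))

    available : ∀ F x {m} → weight F x ≤ m → m < 2 ^ t → ∃ λ ℓ → F ∋ x ℓ
    available F x w≤m m< = gaps<⇒∃ (λ ℓ → F (edge (x ℓ))) (2^-cancel-< (≤-<-trans w≤m m<))

    bit≤penalty : ∀ F p i → bitPenalty F i + chainWeight F p i ≤ penalty F p
    bit≤penalty F p = term≤∑ (λ i → bitPenalty F i + chainWeight F p i)

  small-penalty⇒copies : ∀ F p → penalty F p < 2 ^ t → Copies F
  small-penalty⇒copies F p small = record
    { hasA0 = λ i j k → available F (a0 i j k) (≤-trans (term≤∑ (λ k → weight F (a0 i j k)) k)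
        (≤-trans (term≤∑ (λ j → ∑ λ k → weight F (a0 i j k)) j) (≤-trans (m≤m+n _ _) (bit≤ i)))) small
    ; hasB0 = λ i j → available F (b0 i j) (≤-trans (term≤∑ (λ j → weight F (b0 i j)) j)
        (≤-trans (m≤m+n _ _) (copies i))) small
    ; hasU1 = λ i → available F (u1 i) (≤-trans (m≤m+n _ _) (≤-trans (m≤n+m _ (penB F i)) (copies i))) small
    ; hasU0 = λ i → available F (u0 i) (≤-trans (m≤m+n _ _) (≤-trans (m≤n+m _ (weight F (u1 i)))
        (≤-trans (m≤n+m _ (penB F i)) (copies i)))) small
    ; hasWj = λ i j → available F (wj i j) (≤-trans (term≤∑ (λ j → weight F (wj i j)) j) (≤-trans (m≤m+n _ _)
        (lastTwo i))) small
    ; hasW0 = λ i → available F (w0 i) (≤-trans (m≤n+m _ (penWj F i)) (lastTwo i)) small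
    }
    where
    bit≤ : ∀ i → bitPenalty F i ≤ penalty F p
    bit≤ i = ≤-trans (m≤m+n _ _) (bit≤penalty F p i)
    copies : ∀ i → fromB F i ≤ penalty F p
    copies i = ≤-trans (m≤n+m _ (penA F i)) (bit≤ i)
    lastTwo : ∀ i → penWj F i + weight F (w0 i) ≤ penalty F p
    lastTwo i = ≤-trans (m≤n+m _ (weight F (u0 i))) (≤-trans (m≤n+m _ (weight F (u1 i)))
      (≤-trans (m≤n+m _ (penB F i)) (copies i)))

  small-penalty⇒chain : ∀ F p → penalty F p < 2 ^ r → ∀ i → toℕ i < p → alive F i ≡ true →
    ∃ λ j → chain F i j ≡ true
  small-penalty⇒chain F p small i i<p al = gaps<⇒∃ (chain F i) (2^-cancel-< (≤-<-trans le small))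
    where
    le : 2 ^ gaps (chain F i) ≤ penalty F p
    le = ≤-trans (≤-reflexive (cong (λ x → if x then 2 ^ gaps (chain F i) else 0) (sym (active-intro {F} {p} {i} i<p al))))
      (≤-trans (m≤n+m _ (bitPenalty F i)) (bit≤penalty F p i))

  active-mono : ∀ F {p p'} → p ≤ p' → ∀ i c → (if active F p i then c else 0) ≤ (if active F p' i then c else 0)
  active-mono F {p} {p'} p≤p' i c with active F p i in act
  ... | false = z≤n
  ... | true = ≤-reflexive (cong (λ x → if x then c else 0) (sym (let (lt , al) = active-elim {F} {p} {i} act in
    active-intro {F} {p'} {i} (<-≤-trans lt p≤p') al)))

  penalty-mono : ∀ F {p p'} → p ≤ p' → penalty F p ≤ penalty F p'
  penalty-mono F p≤p' = ∑-mono (λ i → +-monoʳ-≤ (bitPenalty F i) (active-mono F p≤p' i _))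

  #active-below< : ∀ F p i → active F p i ≡ true → #active F (toℕ i) < #active F p
  #active-below< F p i act = subst (_≤ #active F p) count (∑-mono {f = f} {g = indicator ∘ active F p} f≤)
    where
    -- `f` marks the active bits below `i` together with `i` itself, and is dominated by the
    -- indicator of `active F p`.
    f : Fin n → ℕ
    f j = if does (j Fin.≟ i) then 1 else indicator (active F (toℕ i) j)
    f≤ : ∀ j → f j ≤ indicator (active F p j)
    f≤ j with j Fin.≟ i
    ... | yes refl = ≤-reflexive (cong indicator (sym act))
    ... | no _ = active-mono F (<⇒≤ (proj₁ (active-elim {F} {p} {i} act))) j 1
    self : active F (toℕ i) i ≡ false
    self with active F (toℕ i) i in eq
    ... | false = refl
    ... | true = ⊥-elim (<-irrefl refl (proj₁ (active-elim {F} {toℕ i} {i} eq)))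
    count : ∑ f ≡ suc (#active F (toℕ i))
    count = ∑-drop f (indicator ∘ active F (toℕ i)) i at others
      where
      at : f i ≡ suc (indicator (active F (toℕ i) i))
      at rewrite dec-true (i Fin.≟ i) refl | self = refl
      others : ∀ j → j ≢ i → f j ≡ indicator (active F (toℕ i) j)
      others j j≢i rewrite dec-false (j Fin.≟ i) j≢i = refl

  alive-kept : ∀ F e i → (∀ j → b1 i j ≢ label e) → alive (removeEdge F e) i ≡ alive F i
  alive-kept F e i ≢ = allF-cong (λ j → kept F e (b1 i j) (≢ j))

  chain-kept : ∀ F e i j → (∀ k → a1 i j k ≢ label e) → chain (removeEdge F e) i j ≡ chain F i j
  chain-kept F e i j ≢ = allF-cong (λ k → kept F e (a1 i j k) (≢ k))

  alive-removed : ∀ F e i → alive (removeEdge F e) i ≡ true → alive F i ≡ true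
  alive-removed F e i al = allF-intro _ (λ j → proj₁ (removed F e (alive-elim {removeEdge F e} {i} al j)))

  chain-removed : ∀ F e i j → chain (removeEdge F e) i j ≡ true → chain F i j ≡ true
  chain-removed F e i j ch = allF-intro _ (λ k → proj₁ (removed F e (chain-elim {removeEdge F e} {i} {j} ch k)))

  ≡true⇔⇒≡ : ∀ {x z} → (x ≡ true → z ≡ true) → (z ≡ true → x ≡ true) → x ≡ z
  ≡true⇔⇒≡ {true}  {z}     f g = sym (f refl)
  ≡true⇔⇒≡ {false} {false} f g = refl
  ≡true⇔⇒≡ {false} {true}  f g = g refl

  cut-dead : ∀ F e {i j} → label e ≡ b1 i j → alive (removeEdge F e) i ≡ false
  cut-dead F e {i} {j} eq with alive (removeEdge F e) i in al
  ... | false = refl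
  ... | true = ⊥-elim (proj₂ (removed F e (alive-elim {removeEdge F e} {i} al j)) (sym eq))

  cut-chain : ∀ F e {i j k} → label e ≡ a1 i j k → chain (removeEdge F e) i j ≡ false
  cut-chain F e {i} {j} {k} eq with chain (removeEdge F e) i j in ch
  ... | false = refl
  ... | true = ⊥-elim (proj₂ (removed F e (chain-elim {removeEdge F e} {i} {j} ch k)) (sym eq))

  -- An upper bound on the increase of the penalty when an edge is removed: one group loses one alternative.
  drain : EdgeSet → (Fin n → ℕ) → EdgeLabel → ℕ
  drain F c (a1 i j k) = c i
  drain F c (a0 i j k ℓ) = weight F (a0 i j k)
  drain F c (b1 i j) = 0
  drain F c (b0 i j ℓ) = weight F (b0 i j)
  drain F c (u1 i ℓ) = weight F (u1 i)
  drain F c (u0 i ℓ) = weight F (u0 i)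
  drain F c (wj i j ℓ) = weight F (wj i j)
  drain F c (w0 i ℓ) = weight F (w0 i)

  ∑-drain : ∀ F c → Σl allLabels (drain F c) ≡ ∑ (λ i → R * c i + t * bitPenalty F i)
  ∑-drain F c = trans (∑-labels (drain F c)) (∑-cong λ i → trans
    (cong₂ _+_ (sumA i) (cong₂ _+_ (sums (λ j → weight F (b0 i j))) (cong₂ _+_ (∑-const t _) (cong₂ _+_ (∑-const t _)
      (cong₂ _+_ (sums (λ j → weight F (wj i j))) (∑-const t _))))))
    (collect t (R * c i) (penA F i) (penB F i) (weight F (u1 i)) (weight F (u0 i)) (penWj F i) (weight F (w0 i))))
    where
    collect : ∀ t x A B U V J W → (x + t * A) + (t * B + (t * U + (t * V + (t * J + t * W)))) ≡
      x + t * (A + (B + (U + (V + (J + W)))))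
    collect = solve-∀
    sums : ∀ {m} (f : Fin m → ℕ) → ∑ (λ j → ∑ {t} (λ _ → f j)) ≡ t * ∑ f
    sums f = trans (∑-cong (λ j → ∑-const t (f j))) (∑-scale t f)
    sumA : ∀ i → ∑ (λ j → ∑ λ k → c i + ∑ {t} (λ _ → weight F (a0 i j k))) ≡ R * c i + t * penA F i
    sumA i = trans (∑-cong (λ j → trans (∑-distrib-+ (λ _ → c i) (λ k → ∑ {t} (λ _ → weight F (a0 i j k))))
        (cong₂ _+_ (∑-const s (c i)) (sums (λ k → weight F (a0 i j k))))))
      (trans (∑-distrib-+ (λ j → s * c i) (λ j → t * ∑ λ k → weight F (a0 i j k)))
        (cong₂ _+_ (trans (∑-const r (s * c i)) (sym (*-assoc r s (c i)))) (∑-scale t (λ j → ∑ λ k → weight F (a0 i j k)))))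

  ∑-drain-copies : ∀ F p → Σl allLabels (drain F (λ _ → 0)) ≤ t * penalty F p
  ∑-drain-copies F p = ≤-trans (≤-reflexive (trans (∑-drain F (λ _ → 0))
    (trans (∑-cong (λ i → cong (_+ t * bitPenalty F i) (*-zeroʳ R))) (∑-scale t (bitPenalty F)))))
    (*-monoʳ-≤ t (∑-mono {f = bitPenalty F} {g = λ i → bitPenalty F i + chainWeight F p i} (λ i → m≤m+n _ _)))

  -- Each of the `R` edges `a1` of a bit adds at most its chain weight, and each of the `t ≤ R`
  -- copies in a group adds at most the weight of the group. The common factor `R` is also the
  -- number of edges in one chain b, against which this total is balanced.
  ∑-drain-all : t ≤ R → ∀ F p → Σl allLabels (drain F (chainWeight F p)) ≤ R * penalty F p
  ∑-drain-all t≤R F p = ≤-trans (≤-reflexive (∑-drain F (chainWeight F p)))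
    (≤-trans (∑-mono (λ i → ≤-trans (+-monoʳ-≤ (R * chainWeight F p i) (*-monoˡ-≤ (bitPenalty F i) t≤R))
      (≤-reflexive (trans (+-comm (R * chainWeight F p i) _) (sym (*-distribˡ-+ R (bitPenalty F i) (chainWeight F p i)))))))
    (≤-reflexive (∑-scale R (λ i → bitPenalty F i + chainWeight F p i))))

  module _ (F : EdgeSet) (e : Edge) where

    private
      F' : EdgeSet
      F' = removeEdge F e

    weight-kept : ∀ (x : Fin t → EdgeLabel) → (∀ ℓ → x ℓ ≢ label e) → weight F' x ≡ weight F x
    weight-kept x ≢ = cong (2 ^_) (gaps-cong (λ ℓ → kept F e (x ℓ) (≢ ℓ)))

    weight-cut : ∀ (x : Fin t → EdgeLabel) ℓ → (∀ {ℓ' ℓ''} → x ℓ' ≡ x ℓ'' → ℓ' ≡ ℓ'') → label e ≡ x ℓ →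
      weight F' x ≤ weight F x + weight F x
    weight-cut x ℓ inj eq = 2^gaps-drop (λ ℓ → F (edge (x ℓ))) (λ ℓ → F' (edge (x ℓ))) ℓ
      (λ ℓ' ℓ'≢ → kept F e (x ℓ') (λ same → ℓ'≢ (inj (trans same eq))))

    penA-kept : ∀ i → (∀ j k ℓ → a0 i j k ℓ ≢ label e) → penA F' i ≤ penA F i
    penA-kept i ≢ = ∑-mono (λ j → ∑-mono (λ k → ≤-reflexive (weight-kept (a0 i j k) (≢ j k))))

    penB-kept : ∀ i → (∀ j ℓ → b0 i j ℓ ≢ label e) → penB F' i ≤ penB F i
    penB-kept i ≢ = ∑-mono (λ j → ≤-reflexive (weight-kept (b0 i j) (≢ j)))

    penWj-kept : ∀ i → (∀ j ℓ → wj i j ℓ ≢ label e) → penWj F' i ≤ penWj F i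
    penWj-kept i ≢ = ∑-mono (λ j → ≤-reflexive (weight-kept (wj i j) (≢ j)))

    -- The hypothesis is restricted to labels that come in copies, so that it also applies when `e`
    -- is an edge `a1` or `b1` of bit `i`.
    copies-kept : ∀ i → (∀ x → bit x ≡ i → (∀ i j k → x ≢ a1 i j k) → (∀ i j → x ≢ b1 i j) → x ≢ label e) →
      bitPenalty F' i ≤ bitPenalty F i
    copies-kept i ≢ = +-mono-≤ (penA-kept i (λ j k ℓ → ≢ (a0 i j k ℓ) refl (λ _ _ _ ()) (λ _ _ ())))
      (+-mono-≤ (penB-kept i (λ j ℓ → ≢ (b0 i j ℓ) refl (λ _ _ _ ()) (λ _ _ ())))
      (+-mono-≤ (≤-reflexive (weight-kept (u1 i) (λ ℓ → ≢ (u1 i ℓ) refl (λ _ _ _ ()) (λ _ _ ()))))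
      (+-mono-≤ (≤-reflexive (weight-kept (u0 i) (λ ℓ → ≢ (u0 i ℓ) refl (λ _ _ _ ()) (λ _ _ ()))))
      (+-mono-≤ (penWj-kept i (λ j ℓ → ≢ (wj i j ℓ) refl (λ _ _ _ ()) (λ _ _ ())))
        (≤-reflexive (weight-kept (w0 i) (λ ℓ → ≢ (w0 i ℓ) refl (λ _ _ _ ()) (λ _ _ ()))))))))

    chainWeight-≤ : ∀ p i → (∀ j k → a1 i j k ≢ label e) → chainWeight F' p i ≤ chainWeight F p i
    chainWeight-≤ p i ≢ with active F' p i in act
    ... | false = z≤n
    ... | true = let (lt , al) = active-elim {F'} {p} {i} act in ≤-reflexive (trans
      (cong (2 ^_) (gaps-cong (λ j → chain-kept F e i j (≢ j))))
      (cong (λ x → if x then 2 ^ gaps (chain F i) else 0)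
        (sym (active-intro {F} {p} {i} lt (alive-removed F e i al)))))

    chainWeight-cut : ∀ p {i j k} → label e ≡ a1 i j k → chainWeight F' p i ≤ chainWeight F p i + chainWeight F p i
    chainWeight-cut p {i} {j} {k} eq with active F' p i in act
    ... | false = z≤n
    ... | true = let (lt , al) = active-elim {F'} {p} {i} act in ≤-trans
      (2^gaps-drop (chain F i) (chain F' i) j (λ j' j'≢ → chain-kept F e i j' (λ k' → ≢-via eq λ { refl → j'≢ refl })))
      (≤-reflexive (cong (λ x → (if x then 2 ^ gaps (chain F i) else 0) + (if x then 2 ^ gaps (chain F i) else 0))
        (sym (active-intro {F} {p} {i} lt (alive-removed F e i al)))))

    -- The increase on a chain a is left as a parameter because the phases differ: during counting a
    -- cut may double a chain weight, whereas during the setting of a bit chain weights do not grow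
    -- at all.
    penalty-bump : ∀ p c →
      (∀ i j k → label e ≡ a1 i j k → chainWeight F' p i ≤ chainWeight F p i + c i) →
      penalty F' p ≤ penalty F p + drain F c (label e)
    penalty-bump p c onA1 = ∑-bump (λ i → bitPenalty F' i + chainWeight F' p i) (λ i → bitPenalty F i + chainWeight F p i)
      (bit (label e)) (drain F c (label e)) elsewhere (here' (label e) refl)
      where
      elsewhere : ∀ i → i ≢ bit (label e) → bitPenalty F' i + chainWeight F' p i ≤ bitPenalty F i + chainWeight F p i
      elsewhere i i≢ = +-mono-≤ (copies-kept i (λ x bx _ _ same → i≢ (trans (sym bx) (cong bit same))))
        (chainWeight-≤ p i (λ j k same → i≢ (cong bit same)))
      cw : ∀ i → (∀ i j k → label e ≢ a1 i j k) → chainWeight F' p i ≤ chainWeight F p i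
      cw i ≢ = chainWeight-≤ p i (λ j k same → ≢ i j k (sym same))
      here' : ∀ x → label e ≡ x → bitPenalty F' (bit x) + chainWeight F' p (bit x) ≤
        bitPenalty F (bit x) + chainWeight F p (bit x) + drain F c x
      here' (a1 i j k) eq = +-bumpʳ (bitPenalty F i) (chainWeight F p i) (c i)
        (copies-kept i (λ x _ ≢a1 _ same → ≢a1 i j k (trans same eq))) (onA1 i j k eq)
      here' (b1 i j) eq = +-bumpʳ (bitPenalty F i) (chainWeight F p i) 0
        (copies-kept i (λ x _ _ ≢b1 same → ≢b1 i j (trans same eq)))
        (≤-trans (cw i (λ _ _ _ same → case trans (sym eq) same of λ ())) (m≤m+n _ 0))
      here' (a0 i j k ℓ) eq = +-bumpˡ (bitPenalty F i) (chainWeight F p i) d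
          (+-bumpˡ (penA F i) (fromB F i) d (∑-bump (λ j → ∑ λ k → weight F' (a0 i j k)) (λ j → ∑ λ k → weight F (a0 i j k)) j d
            (λ j' j'≢ → ∑-mono (λ k' → ≤-reflexive (weight-kept (a0 i j' k') (λ ℓ' → ≢-via eq λ { refl → j'≢ refl }))))
            (∑-bump (λ k → weight F' (a0 i j k)) (λ k → weight F (a0 i j k)) k d
              (λ k' k'≢ → ≤-reflexive (weight-kept (a0 i j k') (λ ℓ' → ≢-via eq λ { refl → k'≢ refl })))
              (weight-cut (a0 i j k) ℓ (λ { refl → refl }) eq)))
          (+-mono-≤ (penB-kept i (λ _ _ → ≢-via eq λ ()))
          (+-mono-≤ (≤-reflexive (weight-kept (u1 i) (λ _ → ≢-via eq λ ())))
          (+-mono-≤ (≤-reflexive (weight-kept (u0 i) (λ _ → ≢-via eq λ ())))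
          (+-mono-≤ (penWj-kept i (λ _ _ → ≢-via eq λ ()))
          (≤-reflexive (weight-kept (w0 i) (λ _ → ≢-via eq λ ()))))))))
        (cw i (λ _ _ _ same → case trans (sym eq) same of λ ()))
        where
        d : ℕ
        d = weight F (a0 i j k)
      here' (b0 i j ℓ) eq = +-bumpˡ (bitPenalty F i) (chainWeight F p i) d
          (+-bumpʳ (penA F i) (fromB F i) d (penA-kept i (λ _ _ _ → ≢-via eq λ ()))
          (+-bumpˡ (penB F i) (fromU1 F i) d (∑-bump (λ j → weight F' (b0 i j)) (λ j → weight F (b0 i j)) j d
            (λ j' j'≢ → ≤-reflexive (weight-kept (b0 i j') (λ ℓ' → ≢-via eq λ { refl → j'≢ refl })))
            (weight-cut (b0 i j) ℓ (λ { refl → refl }) eq))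
          (+-mono-≤ (≤-reflexive (weight-kept (u1 i) (λ _ → ≢-via eq λ ())))
          (+-mono-≤ (≤-reflexive (weight-kept (u0 i) (λ _ → ≢-via eq λ ())))
          (+-mono-≤ (penWj-kept i (λ _ _ → ≢-via eq λ ()))
          (≤-reflexive (weight-kept (w0 i) (λ _ → ≢-via eq λ ()))))))))
        (cw i (λ _ _ _ same → case trans (sym eq) same of λ ()))
        where
        d : ℕ
        d = weight F (b0 i j)
      here' (u1 i ℓ) eq = +-bumpˡ (bitPenalty F i) (chainWeight F p i) d
          (+-bumpʳ (penA F i) (fromB F i) d (penA-kept i (λ _ _ _ → ≢-via eq λ ()))
          (+-bumpʳ (penB F i) (fromU1 F i) d (penB-kept i (λ _ _ → ≢-via eq λ ()))
          (+-bumpˡ (weight F (u1 i)) (fromU0 F i) d (weight-cut (u1 i) ℓ (λ { refl → refl }) eq)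
          (+-mono-≤ (≤-reflexive (weight-kept (u0 i) (λ _ → ≢-via eq λ ())))
          (+-mono-≤ (penWj-kept i (λ _ _ → ≢-via eq λ ()))
          (≤-reflexive (weight-kept (w0 i) (λ _ → ≢-via eq λ ()))))))))
        (cw i (λ _ _ _ same → case trans (sym eq) same of λ ()))
        where
        d : ℕ
        d = weight F (u1 i)
      here' (u0 i ℓ) eq = +-bumpˡ (bitPenalty F i) (chainWeight F p i) d
          (+-bumpʳ (penA F i) (fromB F i) d (penA-kept i (λ _ _ _ → ≢-via eq λ ()))
          (+-bumpʳ (penB F i) (fromU1 F i) d (penB-kept i (λ _ _ → ≢-via eq λ ()))
          (+-bumpʳ (weight F (u1 i)) (fromU0 F i) d (≤-reflexive (weight-kept (u1 i) (λ _ → ≢-via eq λ ())))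
          (+-bumpˡ (weight F (u0 i)) (fromWj F i) d (weight-cut (u0 i) ℓ (λ { refl → refl }) eq)
          (+-mono-≤ (penWj-kept i (λ _ _ → ≢-via eq λ ()))
          (≤-reflexive (weight-kept (w0 i) (λ _ → ≢-via eq λ ()))))))))
        (cw i (λ _ _ _ same → case trans (sym eq) same of λ ()))
        where
        d : ℕ
        d = weight F (u0 i)
      here' (wj i j ℓ) eq = +-bumpˡ (bitPenalty F i) (chainWeight F p i) d
          (+-bumpʳ (penA F i) (fromB F i) d (penA-kept i (λ _ _ _ → ≢-via eq λ ()))
          (+-bumpʳ (penB F i) (fromU1 F i) d (penB-kept i (λ _ _ → ≢-via eq λ ()))
          (+-bumpʳ (weight F (u1 i)) (fromU0 F i) d (≤-reflexive (weight-kept (u1 i) (λ _ → ≢-via eq λ ())))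
          (+-bumpʳ (weight F (u0 i)) (fromWj F i) d (≤-reflexive (weight-kept (u0 i) (λ _ → ≢-via eq λ ())))
          (+-bumpˡ (penWj F i) (weight F (w0 i)) d (∑-bump (λ j → weight F' (wj i j)) (λ j → weight F (wj i j)) j d
            (λ j' j'≢ → ≤-reflexive (weight-kept (wj i j') (λ ℓ' → ≢-via eq λ { refl → j'≢ refl })))
            (weight-cut (wj i j) ℓ (λ { refl → refl }) eq))
          (≤-reflexive (weight-kept (w0 i) (λ _ → ≢-via eq λ ()))))))))
        (cw i (λ _ _ _ same → case trans (sym eq) same of λ ()))
        where
        d : ℕ
        d = weight F (wj i j)
      here' (w0 i ℓ) eq = +-bumpˡ (bitPenalty F i) (chainWeight F p i) d
          (+-bumpʳ (penA F i) (fromB F i) d (penA-kept i (λ _ _ _ → ≢-via eq λ ()))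
          (+-bumpʳ (penB F i) (fromU1 F i) d (penB-kept i (λ _ _ → ≢-via eq λ ()))
          (+-bumpʳ (weight F (u1 i)) (fromU0 F i) d (≤-reflexive (weight-kept (u1 i) (λ _ → ≢-via eq λ ())))
          (+-bumpʳ (weight F (u0 i)) (fromWj F i) d (≤-reflexive (weight-kept (u0 i) (λ _ → ≢-via eq λ ())))
          (+-bumpʳ (penWj F i) (weight F (w0 i)) d (penWj-kept i (λ _ _ → ≢-via eq λ ()))
          (weight-cut (w0 i) ℓ (λ { refl → refl }) eq))))))
        (cw i (λ _ _ _ same → case trans (sym eq) same of λ ()))
        where
        d : ℕ
        d = weight F (w0 i)

    #active-cut : ∀ p {i j} → label e ≡ b1 i j → active F p i ≡ true → #active F p ≡ suc (#active F' p)
    #active-cut p {i} {j} eq act = ∑-drop (indicator ∘ active F p) (indicator ∘ active F' p) i at others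
      where
      at : indicator (active F p i) ≡ suc (indicator (active F' p i))
      at = trans (cong indicator act) (cong (suc ∘ indicator) (sym (trans
        (cong ((toℕ i Data.Nat.<ᵇ p) ∧_) (cut-dead F e eq)) (BoolP.∧-zeroʳ (toℕ i Data.Nat.<ᵇ p)))))
      others : ∀ i' → i' ≢ i → indicator (active F p i') ≡ indicator (active F' p i')
      others i' i'≢ = cong (λ x → indicator ((toℕ i' Data.Nat.<ᵇ p) ∧ x)) (sym (alive-kept F e i'
        (λ j' same → i'≢ (cong bit (trans same eq)))))

    #active-kept : ∀ p → (∀ i j → label e ≡ b1 i j → active F p i ≡ false) → #active F' p ≡ #active F p
    #active-kept p inactive = ∑-cong (λ i → cong indicator (≡true⇔⇒≡ (to i) (from i)))
      where
      to : ∀ i → active F' p i ≡ true → active F p i ≡ true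
      to i act = let (lt , al) = active-elim {F'} {p} {i} act in active-intro {F} {p} {i} lt (alive-removed F e i al)
      from : ∀ i → active F p i ≡ true → active F' p i ≡ true
      from i act = let (lt , al) = active-elim {F} {p} {i} act in active-intro {F'} {p} {i} lt
        (trans (alive-kept F e i (λ j same → case trans (sym act) (inactive i j (sym same)) of λ ())) al)

-- The two phases of counting

module Phases (n r' s' t : ℕ) where

  open Labels n r' s' t
  open Graph n r s t
  open Trees n r' s' t
  open Structure n r' s' t
  open Outcomes n r' s' t
  open Penalty n r' s' t

  -- Optimality of the part beyond bit `i` only. Later trees never have larger distances, and these
  -- two are already least possible, so they remain fixed, and equal, whatever happens at lower
  -- bits.
  record Level (F B : EdgeSet) (i : Fin n) : Set where
    field
      equal : Y B (nextU i) ≡ Y B (nextW i)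
      minU  : ∀ {T} → IsTree T → T ⊆ F → Y B (nextU i) ≤ Y T (nextU i)
      minW  : ∀ {T} → IsTree T → T ⊆ F → Y B (nextW i) ≤ Y T (nextW i)

  level-shrink : ∀ {F F' B i} → F' ⊆ F → Level F B i → Level F' B i
  level-shrink F'⊆F level = record
    { equal = equal
    ; minU = λ tree sub → minU tree (λ x → F'⊆F x ∘ sub x)
    ; minW = λ tree sub → minW tree (λ x → F'⊆F x ∘ sub x) }
    where open Level level

  level-improve : ∀ {F B T i} → Level F B i → IsTree T → T ⊆ F → (∀ v → Y T v ≤ Y B v) → Level F T i
  level-improve {B = B} {T} {i} level tree sub T≤B = record
    { equal = trans sameU (trans equal (sym sameW))
    ; minU = λ tree' sub' → ≤-trans (T≤B _) (minU tree' sub')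
    ; minW = λ tree' sub' → ≤-trans (T≤B _) (minW tree' sub') }
    where
    open Level level
    sameU : Y T (nextU i) ≡ Y B (nextU i)
    sameU = ≤-antisym (T≤B _) (minU tree sub)
    sameW : Y T (nextW i) ≡ Y B (nextW i)
    sameW = ≤-antisym (T≤B _) (minW tree sub)

  HasChain : EdgeSet → Fin n → Set
  HasChain F i = ∃ λ j → chain F i j ≡ true

  module _ {F B : EdgeSet} (opt : Optimal F B) (copies : Copies F) where

    open Opt opt using (module Equal; U; W)

    bits-agree : ∀ i → U i ≡ W i → (alive F i ≡ true → HasChain F i) → Y B (u i) ≡ Y B (w i)
    bits-agree i U≡W hasChain = go (alive F i) refl
      where
      go : ∀ x → alive F i ≡ x → Y B (u i) ≡ Y B (w i)
      go true  al = let (j , ch) = hasChain al in Equal.Alive.Chain.u≡w copies i U≡W al j ch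
      go false dead = let (j , missing) = dead-missing {F} {i} dead in Equal.Dead.u≡w copies i U≡W j missing

    -- The induction starts at the target or at bit `p`; `bits-agree` passes the equality through
    -- each bit further down.
    lanes-agree : ∀ p → (∀ i → toℕ i ≡ p → Y B (u i) ≡ Y B (w i)) →
      (∀ i → toℕ i < p → alive F i ≡ true → HasChain F i) → ∀ i → toℕ i < p → U i ≡ W i
    lanes-agree p top hasChain = chainInd (λ i → toℕ i < p → U i ≡ W i) λ i ih i<p → go i ih i<p (sucFin i) refl
      where
      go : ∀ i → (∀ i' → sucFin i ≡ just i' → toℕ i' < p → U i' ≡ W i') → toℕ i < p →
        ∀ m → sucFin i ≡ m → U i ≡ W i
      go i ih i<p nothing eq = cong (Y B) (trans (nextU-nothing i eq) (sym (nextW-nothing i eq)))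
      go i ih i<p (just i') eq = trans (cong (Y B) (nextU-just i eq))
        (trans (agree (m≤n⇒m<n∨m≡n (subst (_≤ p) (sym (sucFin-just i eq)) i<p))) (sym (cong (Y B) (nextW-just i eq))))
        where
        agree : toℕ i' < p ⊎ toℕ i' ≡ p → Y B (u i') ≡ Y B (w i')
        agree (inj₂ at) = top i' at
        agree (inj₁ i'<p) = bits-agree i' (ih i' eq i'<p) (hasChain i' i'<p)

  -- Bit p was set last (p = n: none was), all bits below it are reset, and the alive ones are about to be counted.
  record Phase1 (F B : EdgeSet) (p : ℕ) : Set where
    field
      tree  : IsTree B
      sub   : B ⊆ F
      -- This makes all `R` edges of an active chain b candidates for removal.
      clean : ∀ i j → toℕ i < p → ¬ B ∋ b1 i j
      level : ∀ i → toℕ i ≡ p → Level F B i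
      -- Edges of `B` are not removed while `B` is the current tree, so bit `p` stays alive until
      -- the next switch.
      set   : ∀ i → toℕ i ≡ p → ∀ j → B ∋ b1 i j
      path  : ∀ i → toℕ i ≡ p → HasChain F i

  -- All alive bits below i are set; chain b of bit i is being completed while its chains a are still unused.
  record Phase2 (F B : EdgeSet) (i : Fin n) : Set where
    field
      tree   : IsTree B
      sub    : B ⊆ F
      level  : Level F B i
      self   : alive F i ≡ true
      path   : HasChain F i
      -- All edges of the intact chains of bit `i` are therefore free; the growth of the penalty is
      -- charged to them.
      fresh  : ∀ j k → ¬ B ∋ a1 i j k
      -- Being tree edges, these and those of `lowerA` cannot be removed, which keeps the active
      -- bits alive and their chain weights constant until the reset.
      lowerB : ∀ i' → toℕ i' < toℕ i → alive F i' ≡ true → ∀ j → B ∋ b1 i' j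
      lowerA : ∀ i' → toℕ i' < toℕ i → alive F i' ≡ true → ∀ j → chain F i' j ≡ true → ∀ k → B ∋ a1 i' j k

  phase1-remove : ∀ {F B p e} → Phase1 F B p → ¬ B ∋ label e →
    (∀ i → toℕ i ≡ p → HasChain (removeEdge F e) i) → Phase1 (removeEdge F e) B p
  phase1-remove {F} {B} {e = e} ph e∉B path' = record
    { tree = tree ; sub = ⊆-removeEdge {F} {B} {e} sub e∉B ; clean = clean
    ; level = λ i at → level-shrink (removeEdge-⊆ {F} e) (level i at) ; set = set ; path = path' }
    where open Phase1 ph

  phase2-remove : ∀ {F B i e} → Phase2 F B i → ¬ B ∋ label e → (∀ j → b1 i j ≢ label e) →
    HasChain (removeEdge F e) i → Phase2 (removeEdge F e) B i
  phase2-remove {F} {B} {i} {e} ph e∉B ≢b1 path' = record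
    { tree = tree ; sub = ⊆-removeEdge {F} {B} {e} sub e∉B
    ; level = level-shrink (removeEdge-⊆ {F} e) level
    ; self = trans (alive-kept F e i ≢b1) self
    ; path = path' ; fresh = fresh
    ; lowerB = λ i' lt al → lowerB i' lt (alive-removed F e i' al)
    ; lowerA = λ i' lt al j ch → lowerA i' lt (alive-removed F e i' al) j (chain-removed F e i' j ch) }
    where open Phase2 ph

  copies-remove : ∀ {F e} → (∀ x → (∀ i j k → x ≢ a1 i j k) → (∀ i j → x ≢ b1 i j) → x ≢ label e) →
    Copies F → Copies (removeEdge F e)
  copies-remove {F} {e} ≢e copies = record
    { hasA0 = λ i j k → keep (a0 i j k) (λ _ _ _ _ ()) (λ _ _ _ ()) (hasA0 i j k)
    ; hasB0 = λ i j → keep (b0 i j) (λ _ _ _ _ ()) (λ _ _ _ ()) (hasB0 i j)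
    ; hasU1 = λ i → keep (u1 i) (λ _ _ _ _ ()) (λ _ _ _ ()) (hasU1 i)
    ; hasU0 = λ i → keep (u0 i) (λ _ _ _ _ ()) (λ _ _ _ ()) (hasU0 i)
    ; hasWj = λ i j → keep (wj i j) (λ _ _ _ _ ()) (λ _ _ _ ()) (hasWj i j)
    ; hasW0 = λ i → keep (w0 i) (λ _ _ _ _ ()) (λ _ _ _ ()) (hasW0 i) }
    where
    open Copies copies
    keep : ∀ (x : Fin t → EdgeLabel) → (∀ ℓ i j k → x ℓ ≢ a1 i j k) → (∀ ℓ i j → x ℓ ≢ b1 i j) →
      (∃ λ ℓ → F ∋ x ℓ) → ∃ λ ℓ → removeEdge F e ∋ x ℓ
    keep x ≢a1 ≢b1 (ℓ , Fx) = ℓ , trans (kept F e (x ℓ) (≢e (x ℓ) (≢a1 ℓ) (≢b1 ℓ))) Fx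

  copies-removeB1 : ∀ {F e i j} → label e ≡ b1 i j → Copies F → Copies (removeEdge F e)
  copies-removeB1 eq = copies-remove (λ x _ ≢b1 → ≢-via eq (≢b1 _ _))

  copies-removeA1 : ∀ {F e i j k} → label e ≡ a1 i j k → Copies F → Copies (removeEdge F e)
  copies-removeA1 eq = copies-remove (λ x ≢a1 _ → ≢-via eq (≢a1 _ _ _))

  -- Adding back the missing edge of chain b at bit i, with all lower bits complete.
  module Setting {F B' e i j} (eq : label e ≡ b1 i j) (al : alive F i ≡ true) (copies : Copies F)
    (opt : Optimal (removeEdge F e) B') (U≡W : Y B' (nextU i) ≡ Y B' (nextW i)) (path : HasChain F i)
    (paths : ∀ i' → toℕ i' < toℕ i → alive F i' ≡ true → HasChain F i') where

    private
      F' B″ : EdgeSet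
      F' = removeEdge F e
      B″ = switch B' e

      open Optimal opt renaming (tree to tree'; sub to sub'; bellman to bellman')
      open Opt opt using (module Equal)

      copies' : Copies F'
      copies' = copies-removeB1 {F} {e} eq copies

      missing : ¬ F' ∋ b1 i j
      missing Fx = proj₂ (removed F e Fx) (sym eq)

      F∋e : F ∋ label e
      F∋e = subst (F ∋_) (sym eq) (alive-elim {F} {i} al j)

      B'⊆F : B' ⊆ F
      B'⊆F x Bx = removeEdge-⊆ {F} e x (sub' x Bx)

      better : Better B' (label e)
      better = subst (Better B') (sym eq) (Equal.Dead.b1-better copies' i U≡W j missing
        (λ j' j'≢ → trans (kept F e (b1 i j') (≢-via eq λ { refl → j'≢ refl }))
          (alive-elim {F} {i} al j')))

      hasChain' : ∀ i' → HasChain F i' → HasChain F' i'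
      hasChain' i' (j' , ch) = j' , trans (chain-kept F e i' j' (λ k → ≢-via eq λ ())) ch

      other : ∀ i' → toℕ i' < toℕ i → alive F i' ≡ true → alive F' i' ≡ true
      other i' lt al' = trans (alive-kept F e i' (λ j' same → <-irrefl (cong (toℕ ∘ bit) (trans same eq)) lt)) al'

      lower-equal : ∀ i' → toℕ i' < toℕ i → Y B' (nextU i') ≡ Y B' (nextW i')
      lower-equal = lanes-agree opt copies' (toℕ i)
        (λ i' at → subst (λ z → Y B' (u z) ≡ Y B' (w z)) (sym (toℕ-injective at)) (Equal.Dead.u≡w copies' i U≡W j missing))
        (λ i' lt al' → hasChain' i' (paths i' lt (alive-removed F e i' al')))

      keep : ∀ x → src x ≢ b i j → B' ∋ x → B″ ∋ x
      keep x ≢ Bx = switch-old B' e x Bx (λ same → ≢ (trans same (cong src eq)))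

      above-e : ∀ {v} x → rank v ≡ (n ∸ suc (toℕ i)) * K → rank (src x) ≤ rank v → x ≢ label e
      above-e x rv le refl = <⇒≱ (m<m+n _ (m<n⇒0<n∸m (toℕ<n j))) (subst₂ _≤_ (cong (rank ∘ src) eq) rv le)

      -- Although `B'` is optimal only without `e`, paths from the vertices beyond bit `i` stay
      -- below the rank at which `e` starts. There `Y B'` remains a feasible potential for trees
      -- that may contain `e`.
      minimal : ∀ v → rank v ≡ (n ∸ suc (toℕ i)) * K → ∀ {T} → IsTree T → T ⊆ F → Y B' v ≤ Y T v
      minimal v rv tree sub = potential≤Y tree (Y B') (rank v) (Y-tgt B')
        (λ x Tx le → bellman' x (trans (kept F e x (above-e {v} x rv le)) (sub x Tx))) v ≤-refl

      level' : Level F B' i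
      level' = record { equal = U≡W ; minU = minimal (nextU i) (rank-nextU i) ; minW = minimal (nextW i) (rank-nextW i) }

    set-improving : Improving B' e
    set-improving = better⇒improving B' e better

    set-phase2 : Phase2 F B″ i
    set-phase2 = record
      { tree = switch-tree tree' e
      ; sub = switch-⊆ {B'} {F} e B'⊆F F∋e
      ; level = level-improve level' (switch-tree tree' e) (switch-⊆ {B'} {F} e B'⊆F F∋e) (switch-Y≤ tree' e better)
      ; self = al
      ; path = path
      -- As long as chain b was cut, an exit from chain a was cheapest at each of its vertices, and
      -- the switch changes only an edge of chain b.
      ; fresh = λ j' k Bx → fresh' j' k (switched B' e (a1 i j' k) Bx)
      ; lowerB = λ i' lt al' j' → keep (b1 i' j') (λ { refl → <-irrefl refl lt })
          (Equal.Alive.b1∈B copies' i' (lower-equal i' lt) (other i' lt al') j')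
      ; lowerA = λ i' lt al' j' ch k → keep (a1 i' j' k) (λ ())
          (Equal.Alive.Chain.a1∈B copies' i' (lower-equal i' lt) (other i' lt al') j'
            (trans (chain-kept F e i' j' (λ k → ≢-via eq λ ())) ch) k)
      }
      where
      fresh' : ∀ j' k → a1 i j' k ≡ label e ⊎ (B' ∋ a1 i j' k × src (a1 i j' k) ≢ src (label e)) → ⊥
      fresh' j' k (inj₁ same) = case trans same eq of λ ()
      fresh' j' k (inj₂ (Bx , _)) = Equal.Dead.a1∉B copies' i U≡W j missing j' k Bx

  -- Adding back the missing edge of the last chain a at bit i, after all lower bits were reset.
  module Resetting {F B B' e i j k} (eq : label e ≡ a1 i j k) (al : alive F i ≡ true) (copies : Copies F)
    (tree : IsTree B) (B⊆F' : B ⊆ removeEdge F e) (opt : Optimal (removeEdge F e) B') (level : Level F B i)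
    (ch : chain F i j ≡ true) (broken : ∀ j' → chain (removeEdge F e) i j' ≡ false) where

    private
      F' B″ : EdgeSet
      F' = removeEdge F e
      B″ = switch B' e

      open Optimal opt renaming (tree to tree'; sub to sub'; bellman to bellman')
      open Opt opt using (module Equal; module Reset)

      copies' : Copies F'
      copies' = copies-removeA1 {F} {e} eq copies

      F∋e : F ∋ label e
      F∋e = subst (F ∋_) (sym eq) (chain-elim {F} {i} {j} ch k)

      B'⊆F : B' ⊆ F
      B'⊆F x Bx = removeEdge-⊆ {F} e x (sub' x Bx)

      level' : Level F B' i
      level' = level-improve level tree' B'⊆F (optimal-≤ opt tree B⊆F')

      U≡W : Y B' (nextU i) ≡ Y B' (nextW i)
      U≡W = Level.equal level'

      al' : alive F' i ≡ true
      al' = trans (alive-kept F e i (λ j → ≢-via eq λ ())) al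

      better : Better B' (label e)
      better = subst (Better B') (sym eq) (Equal.Alive.a1-better copies' i U≡W al' j k
        (λ Fx → proj₂ (removed F e Fx) (sym eq))
        (λ k' k'≢ → trans (kept F e (a1 i j k') (≢-via eq λ { refl → k'≢ refl }))
          (chain-elim {F} {i} {j} ch k')))

      -- The gap originates at bit `i`, which without an intact chain puts `w` above `u` by `q i`.
      -- Each lower bit turns a gap of four of its units into a gap of one unit, and that is four
      -- units of the next bit.
      high : ∀ i' → toℕ i' < toℕ i → 4 * q i' + Y B' (nextU i') ≤ Y B' (nextW i')
      high = chainInd (λ i' → toℕ i' < toℕ i → 4 * q i' + Y B' (nextU i') ≤ Y B' (nextW i'))
        λ i' ih lt → go i' ih lt (sucFin i') refl
        where
        go : ∀ i' → (∀ i″ → sucFin i' ≡ just i″ → toℕ i″ < toℕ i → 4 * q i″ + Y B' (nextU i″) ≤ Y B' (nextW i″)) →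
          toℕ i' < toℕ i → ∀ m → sucFin i' ≡ m → 4 * q i' + Y B' (nextU i') ≤ Y B' (nextW i')
        go i' ih lt nothing sf = ⊥-elim (<⇒≱ (toℕ<n i) (subst (_≤ toℕ i) (sucFin-nothing i' sf) lt))
        go i' ih lt (just i″) sf = subst₂ (λ z v → z + Y B' v ≤ Y B' (nextW i')) (q-next sf) (sym (nextU-just i' sf))
          (subst (λ v → q i″ + Y B' (u i″) ≤ Y B' v) (sym (nextW-just i' sf))
            (at (m≤n⇒m<n∨m≡n (subst (_≤ toℕ i) (sym (sucFin-just i' sf)) lt))))
          where
          at : toℕ i″ < toℕ i ⊎ toℕ i″ ≡ toℕ i → q i″ + Y B' (u i″) ≤ Y B' (w i″)
          at (inj₁ lt') = Reset.w-high copies' i″ (ih i″ sf lt')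
          at (inj₂ same) = subst (λ z → q z + Y B' (u z) ≤ Y B' (w z)) (sym (toℕ-injective same))
            (Equal.Alive.NoChain.w-high copies' i U≡W al' broken)

    reset-improving : Improving B' e
    reset-improving = better⇒improving B' e better

    reset-phase1 : Phase1 F B″ (toℕ i)
    reset-phase1 = record
      { tree = switch-tree tree' e
      ; sub = switch-⊆ {B'} {F} e B'⊆F F∋e
      ; clean = λ i' j' lt Bx → clean' i' j' lt (switched B' e (b1 i' j') Bx)
      ; level = λ i' at → subst (Level F B″) (sym (toℕ-injective at))
          (level-improve level' (switch-tree tree' e) (switch-⊆ {B'} {F} e B'⊆F F∋e) (switch-Y≤ tree' e better))
      ; set = λ i' at j' → subst (λ z → B″ ∋ b1 z j') (sym (toℕ-injective at))
          (switch-old B' e (b1 i j') (Equal.Alive.b1∈B copies' i U≡W al' j') (λ same → case trans same (cong src eq) of λ ()))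
      ; path = λ i' at → subst (HasChain F) (sym (toℕ-injective at)) (j , ch)
      }
      where
      clean' : ∀ i' j' → toℕ i' < toℕ i → b1 i' j' ≡ label e ⊎ (B' ∋ b1 i' j' × src (b1 i' j') ≢ src (label e)) → ⊥
      clean' i' j' lt (inj₁ same) = case trans same eq of λ ()
      clean' i' j' lt (inj₂ (Bx , _)) = Reset.b1∉B copies' i' (high i' lt) j' Bx

  phase1-lanes : ∀ {F B p e i j B'} → Phase1 F B p → label e ≡ b1 i j → toℕ i < p → Copies F →
    (∀ i' → toℕ i' < p → alive F i' ≡ true → HasChain F i') → ¬ B ∋ label e → Optimal (removeEdge F e) B' →
    Y B' (nextU i) ≡ Y B' (nextW i)
  phase1-lanes {F} {B} {p} {e} {i} {j} {B'} ph eq i<p copies paths e∉B opt =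
    lanes-agree opt copies' p top (λ i' lt al → hasChain' i' (paths i' lt (alive-removed F e i' al))) i i<p
    where
    open Phase1 ph
    F' : EdgeSet
    F' = removeEdge F e
    copies' : Copies F'
    copies' = copies-removeB1 {F} {e} eq copies
    hasChain' : ∀ i' → HasChain F i' → HasChain F' i'
    hasChain' i' (j' , ch) = j' , trans (chain-kept F e i' j' (λ k → ≢-via eq λ ())) ch
    top : ∀ i' → toℕ i' ≡ p → Y B' (u i') ≡ Y B' (w i')
    top i' at = bits-agree opt copies' i'
      (Level.equal (level-improve (level i' at) (Optimal.tree opt)
        (λ x Bx → removeEdge-⊆ {F} e x (Optimal.sub opt x Bx))
        (optimal-≤ opt tree (⊆-removeEdge {F} {B} {e} sub e∉B))))
      (λ _ → hasChain' i' (path i' at))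

  -- Dead bits carry no chain weight, and alive chains below bit i already lie in the tree.
  phase2-chainWeight : ∀ {F B i e i' j k} → Phase2 F B i → ¬ B ∋ label e → label e ≡ a1 i' j k →
    chainWeight (removeEdge F e) (toℕ i) i' ≤ chainWeight F (toℕ i) i' + 0
  phase2-chainWeight {F} {B} {i} {e} {i'} {j} {k} ph e∉B eq = go (active F' (toℕ i) i') refl
    where
    open Phase2 ph
    F' : EdgeSet
    F' = removeEdge F e
    go : ∀ x → active F' (toℕ i) i' ≡ x → chainWeight F' (toℕ i) i' ≤ chainWeight F (toℕ i) i' + 0
    go false act = subst (λ x → (if x then 2 ^ gaps (chain F' i') else 0) ≤ chainWeight F (toℕ i) i' + 0) (sym act) z≤n
    go true act = ≤-trans (≤-reflexive (cong₂ (λ x g → if x then 2 ^ g else 0)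
        (trans act (sym (active-intro {F} {toℕ i} {i'} lt al))) (gaps-cong same))) (m≤m+n _ 0)
      where
      lt : toℕ i' < toℕ i
      lt = proj₁ (active-elim {F'} {toℕ i} {i'} act)
      al : alive F i' ≡ true
      al = alive-removed F e i' (proj₂ (active-elim {F'} {toℕ i} {i'} act))
      same : ∀ j' → chain F' i' j' ≡ chain F i' j'
      same j' = ≡true⇔⇒≡ (chain-removed F e i' j') λ ch → trans (chain-kept F e i' j' (λ k' same' →
        e∉B (subst (B ∋_) same' (lowerA i' lt al j' ch k')))) ch

-- Claims and binomial identities

absorption : ∀ N k → suc k * (suc N C suc k) ≡ suc N * (N C k)
absorption zero zero = refl
absorption zero (suc k) = trans (cong (suc (suc k) *_) (k>n⇒nCk≡0 {1} {suc (suc k)} (s≤s (s≤s z≤n)))) (*-zeroʳ (suc (suc k)))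
absorption (suc N) zero = trans (+-identityʳ _) (trans (sym (nCk+nC[k+1]≡[n+1]C[k+1] (suc N) 0))
  (trans (cong (1 +_) (trans (sym (+-identityʳ _)) (absorption N 0))) (sym (*-suc-one N))))
  where
  *-suc-one : ∀ N → suc (suc N) * 1 ≡ 1 + suc N * 1
  *-suc-one = solve-∀
absorption (suc N) (suc k) = begin
  suc (suc k) * (suc (suc N) C suc (suc k))                      ≡⟨ cong (suc (suc k) *_) (nCk+nC[k+1]≡[n+1]C[k+1] (suc N) (suc k)) ⟨
  suc (suc k) * (c + (suc N C suc (suc k)))                      ≡⟨ *-distribˡ-+ (suc (suc k)) c _ ⟩
  suc (suc k) * c + suc (suc k) * (suc N C suc (suc k))          ≡⟨ cong₂ _+_ (cong (c +_) (absorption N k)) (absorption N (suc k)) ⟩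
  (c + suc N * (N C k)) + suc N * (N C suc k)                    ≡⟨ collect c (suc N) (N C k) (N C suc k) ⟩
  c + suc N * ((N C k) + (N C suc k))                            ≡⟨ cong (λ z → c + suc N * z) (nCk+nC[k+1]≡[n+1]C[k+1] N k) ⟩
  suc (suc N) * c                                                ∎
  where
  open Relation.Binary.PropositionalEquality.≡-Reasoning
  c : ℕ
  c = suc N C suc k
  collect : ∀ c n x y → (c + n * x) + n * y ≡ c + n * (x + y)
  collect = solve-∀

∑-snoc : ∀ N (g : ℕ → ℕ) → ∑ {suc N} (g ∘ toℕ) ≡ ∑ {N} (g ∘ toℕ) + g N
∑-snoc zero    g = +-comm (g 0) 0
∑-snoc (suc N) g = trans (cong (g 0 +_) (∑-snoc N (g ∘ suc))) (sym (+-assoc (g 0) _ (g (suc N))))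

hockeyStick : ∀ N k → ∑ {N} (λ ρ → toℕ ρ C k) ≡ N C suc k
hockeyStick zero    k = sym (k>n⇒nCk≡0 {0} {suc k} (s≤s z≤n))
hockeyStick (suc N) k = trans (∑-snoc N (_C k)) (trans (cong (_+ (N C k)) (hockeyStick N k))
  (trans (+-comm (N C suc k) (N C k)) (nCk+nC[k+1]≡[n+1]C[k+1] N k)))

-- The counting recursion for the coefficients `C(N,k)/k!`, multiplied by `suc N` and by `suc k !`.
∑-gain : ∀ N k → ∑ {suc N} (λ ρ → (N C suc k) + suc k * (toℕ ρ C k)) ≡ suc N * (suc N C suc k)
∑-gain N k = begin
  ∑ {suc N} (λ ρ → (N C suc k) + suc k * (toℕ ρ C k))        ≡⟨ ∑-distrib-+ {suc N} (λ _ → N C suc k) (λ ρ → suc k * (toℕ ρ C k)) ⟩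
  ∑ {suc N} (λ _ → N C suc k) + ∑ {suc N} (λ ρ → suc k * (toℕ ρ C k))
                                                             ≡⟨ cong₂ _+_ (∑-const (suc N) (N C suc k)) (∑-scale (suc k) (λ (ρ : Fin (suc N)) → toℕ ρ C k)) ⟩
  suc N * (N C suc k) + suc k * ∑ {suc N} (λ ρ → toℕ ρ C k)  ≡⟨ cong (λ z → suc N * (N C suc k) + suc k * z) (hockeyStick (suc N) k) ⟩
  suc N * (N C suc k) + suc k * (suc N C suc k)              ≡⟨ cong (suc N * (N C suc k) +_) (absorption N k) ⟩
  suc N * (N C suc k) + suc N * (N C k)                      ≡⟨ *-distribˡ-+ (suc N) (N C suc k) (N C k) ⟨
  suc N * ((N C suc k) + (N C k))                            ≡⟨ cong (suc N *_) (trans (+-comm (N C suc k) (N C k)) (nCk+nC[k+1]≡[n+1]C[k+1] N k)) ⟩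
  suc N * (suc N C suc k)                                    ∎
  where open Relation.Binary.PropositionalEquality.≡-Reasoning

-- A claim X ≤ Y τ + Z with X = c Mᵏ V and Z = c (M+1)ᵏ N P has content only when P < V.
nontrivial : ∀ c M k N P V → c * suc M ^ k * suc N * P < c * (M ^ k * V) → P < V
nontrivial c M k N P V lt = *-cancelˡ-< (c * suc M ^ k) P V (begin-strict
  c * suc M ^ k * P              ≡⟨ cong (_* P) (*-identityʳ (c * suc M ^ k)) ⟨
  c * suc M ^ k * 1 * P          ≤⟨ *-monoˡ-≤ P (*-monoʳ-≤ (c * suc M ^ k) {1} {suc N} (s≤s z≤n)) ⟩
  c * suc M ^ k * suc N * P      <⟨ lt ⟩
  c * (M ^ k * V)                ≤⟨ *-monoʳ-≤ c (*-monoˡ-≤ V (^-monoˡ-≤ k (n≤1+n M))) ⟩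
  c * (suc M ^ k * V)            ≡⟨ *-assoc c (suc M ^ k) V ⟨
  c * suc M ^ k * V              ∎)
  where open ≤-Reasoning

-- The number of copies is taken equal to the number `r` of chains, so that the single threshold
-- `2 ^ r` for the penalty guarantees both a copy in every group and an intact chain at every active
-- bit.
module Counting (n r' s' m : ℕ) (1≤m : 1 ≤ m) (long : 2 * (suc r' * suc r' * m) ≤ suc s') where

  open Labels n r' s' (suc r')
  open Graph n r s r
  open Trees n r' s' r hiding (C)
  open Structure n r' s' r
  open Outcomes n r' s' r
  open Expectation n r' s' r
  open Penalty n r' s' r
  open Phases n r' s' r

  -- The common denominator of `(1 + 1/m)ᵏ` and of the penalty threshold.
  Q : ℕ → ℕ
  Q k = m ^ k * 2 ^ r

  Y₁ : ℕ → ℕ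
  Y₁ k = k ! * Q k

  X₁ : ℕ → ℕ → ℕ
  X₁ k N = (N C k) * Q k

  Z₁ : ℕ → ℕ → ℕ → ℕ
  Z₁ k N P = (N C k) * suc m ^ k * N * P

  -- E[1 + switches] ≥ C(N,k)/k! · (1 − (1 + 1/m)ᵏ N penalty / 2ʳ) for N active bits.
  Claim₁ : EdgeSet → Dist → ℕ → ℕ → Set
  Claim₁ F D k p = LowerBound (Y₁ k) (X₁ k (#active F p)) (Z₁ k (#active F p) (penalty F p)) (total D)

  Y₂ : ℕ → ℕ
  Y₂ k = r * m * Y₁ k

  X₂ : ℕ → ℕ → ℕ
  X₂ k N = r * m * X₁ k N

  Z₂ : ℕ → ℕ → ℕ → ℕ → ℕ
  Z₂ k N P x = Z₁ k N P * (r * m + x)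

  #chains : EdgeSet → Fin n → ℕ
  #chains F i = r ∸ gaps (chain F i)

  -- The penalty term of Claim₁ times 1 + x/(r m), where x chains a of bit i remain to be cut before the reset.
  Claim₂ : EdgeSet → Dist → ℕ → Fin n → Set
  Claim₂ F D k i = LowerBound (Y₂ k) (X₂ k (#active F (toℕ i)))
    (Z₂ k (#active F (toℕ i)) (penalty F (toℕ i)) (#chains F i)) (total D)

  Claims : EdgeSet → EdgeSet → Dist → Set
  Claims F B D = (∀ k p → Phase1 F B p → Claim₁ F D k p) × (∀ k i → Phase2 F B i → Claim₂ F D k i)

  Z₁-mono : ∀ k N {P P'} → P ≤ P' → Z₁ k N P ≤ Z₁ k N P'
  Z₁-mono k N = *-monoʳ-≤ ((N C k) * suc m ^ k * N)

  lowerBound-1 : ∀ Y Z {τ} → 1ℚ ℚ.≤ τ → LowerBound Y Y Z τ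
  lowerBound-1 Y Z {τ} 1≤τ = lower (ℚP.≤-trans (subst₂ ℚ._≤_ (ℚP.*-identityʳ (ℕtoℚ Y)) (sym (ℚP.+-identityʳ (ℕtoℚ Y ℚ.* τ)))
    (ℚP.*-monoˡ-≤-nonNeg (ℕtoℚ Y) {{ℕtoℚ-nonNeg Y}} 1≤τ)) (ℚP.+-monoʳ-≤ (ℕtoℚ Y ℚ.* τ) (ℕtoℚ-mono-≤ {0} {Z} z≤n)))

  -- Since `x ≤ r`, the factor `1 + x/(r m)` is at most `(m + 1)/m`, exactly what the error term may
  -- gain from `k` to `suc k` resets. Scaling by `suc k` brings `k !` to the denominator `suc k !`
  -- shared with the other part of the recursion.
  phase2-used : ∀ k N x P N₀ P₀ {τ} → x ≤ r → N ≤ N₀ → P ≤ P₀ → LowerBound (Y₂ k) (X₂ k N) (Z₂ k N P x) τ →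
    LowerBound (Y₁ (suc k)) (suc k * (N C k) * Q (suc k)) (suc k * (N C k) * (suc m ^ suc k * N₀ * P₀)) τ
  phase2-used k N x P N₀ P₀ {τ} x≤r N≤ P≤ low = lowerBound-cancel r'
    (subst₂ (λ Y X → LowerBound Y X (r * Z₀) τ)
      (scaleY (suc k) r m (k !) (m ^ k) (2 ^ r)) (scaleX (suc k) r m (N C k) (m ^ k) (2 ^ r))
      (lowerBound-relax ≤-refl le (lowerBound-scale (suc k) low)))
    where
    X₀ Z₀ : ℕ
    X₀ = suc k * (N C k) * Q (suc k)
    Z₀ = suc k * (N C k) * (suc m ^ suc k * N₀ * P₀)
    scaleY : ∀ k r m f mk V → k * (r * m * (f * (mk * V))) ≡ r * ((k * f) * (m * mk * V))
    scaleY = solve-∀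
    scaleX : ∀ k r m c mk V → k * (r * m * (c * (mk * V))) ≡ r * (k * c * (m * mk * V))
    scaleX = solve-∀
    shuffle : ∀ k c A N P y → k * (c * A * N * P * y) ≡ k * c * (A * N * P * y)
    shuffle = solve-∀
    regroup : ∀ r k c A N P m' → k * c * (A * N * P * (r * m')) ≡ r * (k * c * (m' * A * N * P))
    regroup = solve-∀
    expand : ∀ r m → r * m + r ≡ r * suc m
    expand = solve-∀
    open ≤-Reasoning
    le : suc k * Z₂ k N P x ≤ r * (suc k * (N C k) * (suc m ^ suc k * N₀ * P₀))
    le = begin
      suc k * ((N C k) * suc m ^ k * N * P * (r * m + x))         ≡⟨ shuffle (suc k) (N C k) (suc m ^ k) N P (r * m + x) ⟩
      suc k * (N C k) * (suc m ^ k * N * P * (r * m + x))         ≤⟨ *-monoʳ-≤ (suc k * (N C k)) (*-mono-≤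
                                                                       (*-mono-≤ (*-monoʳ-≤ (suc m ^ k) N≤) P≤)
                                                                       (≤-trans (+-monoʳ-≤ (r * m) x≤r) (≤-reflexive (expand r m)))) ⟩
      suc k * (N C k) * (suc m ^ k * N₀ * P₀ * (r * suc m))       ≡⟨ regroup r (suc k) (N C k) (suc m ^ k) N₀ P₀ (suc m) ⟩
      r * (suc k * (N C k) * (suc m ^ suc k * N₀ * P₀))           ∎

  onB1 : (Fin n → ℕ) → EdgeLabel → ℕ
  onB1 g (b1 i j) = g i
  onB1 g _ = 0

  ∑-onB1 : ∀ g → Σl allLabels (onB1 g) ≡ R * ∑ g
  ∑-onB1 g = trans (∑-labels (onB1 g)) (trans (∑-cong perBit) (∑-scale R g))
    where
    vanish : ∀ {m} (f : Fin m → ℕ) → (∀ i → f i ≡ 0) → ∑ f ≡ 0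
    vanish {m} f f≡0 = trans (∑-cong f≡0) (∑-zero m)
    onA : ∀ i → ∑ (λ j → ∑ λ k → onB1 g (a1 i j k) + ∑ (onB1 g ∘ a0 i j k)) ≡ 0
    onA i = vanish (λ j → ∑ λ k → onB1 g (a1 i j k) + ∑ (onB1 g ∘ a0 i j k))
      (λ j → vanish (λ k → onB1 g (a1 i j k) + ∑ (onB1 g ∘ a0 i j k)) (λ k → ∑-zero r))
    onB : ∀ i → ∑ (λ j → onB1 g (b1 i j) + ∑ (onB1 g ∘ b0 i j)) ≡ R * g i
    onB i = trans (∑-cong {x = λ (j : Fin R) → g i + ∑ {r} (λ _ → 0)} {y = λ _ → g i}
      (λ j → trans (cong (g i +_) (∑-zero r)) (+-identityʳ (g i)))) (∑-const R (g i))
    onWj : ∀ i → ∑ (λ j → ∑ (onB1 g ∘ wj i j)) ≡ 0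
    onWj i = vanish (λ j → ∑ (onB1 g ∘ wj i j)) (λ j → ∑-zero r)
    perBit : ∀ i →
      ∑ (λ j → ∑ λ k → onB1 g (a1 i j k) + ∑ (onB1 g ∘ a0 i j k)) + (∑ (λ j → onB1 g (b1 i j) + ∑ (onB1 g ∘ b0 i j)) +
      (∑ (onB1 g ∘ u1 i) + (∑ (onB1 g ∘ u0 i) + (∑ (λ j → ∑ (onB1 g ∘ wj i j)) + ∑ (onB1 g ∘ w0 i))))) ≡ R * g i
    perBit i rewrite onA i | onB i | onWj i | ∑-zero r = +-identityʳ (R * g i)

  ∑-onA1-≥ : ∀ (f : EdgeLabel → ℕ) i j → ∑ (λ k → f (a1 i j k)) ≤ Σl allLabels f
  ∑-onA1-≥ f i j = subst (∑ (λ k → f (a1 i j k)) ≤_) (sym (∑-labels f))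
    (≤-trans (≤-trans (∑-mono {f = λ k → f (a1 i j k)} (λ k → m≤m+n _ (∑ (f ∘ a0 i j k))))
      (≤-trans (term≤∑ (λ j → ∑ λ k → f (a1 i j k) + ∑ (f ∘ a0 i j k)) j) (m≤m+n _ _)))
      (term≤∑ (λ i → ∑ (λ j → ∑ λ k → f (a1 i j k) + ∑ (f ∘ a0 i j k)) + (∑ (λ j → f (b1 i j) + ∑ (f ∘ b0 i j)) +
        (∑ (f ∘ u1 i) + (∑ (f ∘ u0 i) + (∑ (λ j → ∑ (f ∘ wj i j)) + ∑ (f ∘ w0 i)))))) i))

  -- Which edges are free depends on the tree, so the comparison is made label by label: a gain is
  -- claimed only where freeness is known or an equal loss is booked, and a loss may be booked on
  -- every label. The two accounts are then summed by bits and indices.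
  diffList-compare : ∀ F B (f g gain loss : EdgeLabel → ℕ) →
    (∀ x → (if free F B x then f x else 0) + gain x ≤ (if free F B x then g x else 0) + loss x) →
    Σl allLabels loss ≤ Σl allLabels gain →
    Σl (diffList F B) (f ∘ label) ≤ Σl (diffList F B) (g ∘ label)
  diffList-compare F B f g gain loss pointwise total-loss = subst₂ _≤_ (sym (∑-diffList F B f)) (sym (∑-diffList F B g))
    (+-cancelʳ-≤ (Σl allLabels gain) _ _ (≤-trans
      (≤-trans (≤-reflexive (sym (Σl-+ allLabels (λ x → if free F B x then f x else 0) gain)))
        (≤-trans (Σl-mono allLabels pointwise) (≤-reflexive (Σl-+ allLabels (λ x → if free F B x then g x else 0) loss))))
      (+-monoʳ-≤ _ total-loss)))

  hasChain? : ∀ F i → HasChain F i ⊎ (∀ j → chain F i j ≡ false)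
  hasChain? F i with FinP.any? (λ j → chain F i j BoolP.≟ true)
  ... | yes found = inj₁ found
  ... | no none = inj₂ (λ j → BoolP.¬-not (λ ch → none (j , ch)))

  hasChain-kept : ∀ F e i → (∀ j k → a1 i j k ≢ label e) → HasChain F i → HasChain (removeEdge F e) i
  hasChain-kept F e i ≢ (j , ch) = j , trans (chain-kept F e i j (≢ j)) ch

  last-chain : ∀ F e {i j k} → label e ≡ a1 i j k → HasChain F i → (∀ j → chain (removeEdge F e) i j ≡ false) →
    chain F i j ≡ true
  last-chain F e {i} {j} eq (j₀ , ch) broken with j₀ Fin.≟ j
  ... | yes refl = ch
  ... | no j₀≢j = case trans (sym (trans (chain-kept F e i j₀ (λ k → ≢-via eq λ { refl → j₀≢j refl })) ch))
                    (broken j₀) of λ ()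

-- Averaging over the removed edge

module Induction (n r' s' m : ℕ) (1≤m : 1 ≤ m) (long : 2 * (suc r' * suc r' * m) ≤ suc s') where

  open Labels n r' s' (suc r')
  open Graph n r s r
  open Trees n r' s' r hiding (C)
  open Structure n r' s' r
  open Outcomes n r' s' r
  open Expectation n r' s' r
  open Penalty n r' s' r
  open Phases n r' s' r
  open Counting n r' s' m 1≤m long

  free-true : ∀ {F B x} → F ∋ x → ¬ B ∋ x → free F B x ≡ true
  free-true Fx ¬Bx = cong₂ _∧_ Fx (cong not (BoolP.¬-not ¬Bx))

  same-chains : ∀ F e {i j k} → label e ≡ a1 i j k → chain F i j ≡ false →
    ∀ j' → chain (removeEdge F e) i j' ≡ chain F i j'
  same-chains F e {i} {j} eq broken j' = ≡true⇔⇒≡ (chain-removed F e i j') λ ch →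
    trans (chain-kept F e i j' (λ k' → ≢-via eq λ { refl → case trans (sym ch) broken of λ () })) ch

  module Step1 {F B : EdgeSet} (k p : ℕ) (ph : Phase1 F B p) (N₀ : ℕ) (N≡ : #active F p ≡ suc N₀)
    (small : penalty F p < 2 ^ r) where

    open Phase1 ph

    N P c X Z V : ℕ
    N = suc N₀
    P = penalty F p
    c = (N C suc k) * suc m ^ suc k * N
    X = X₁ (suc k) N
    Z = Z₁ (suc k) N P
    V = suc m ^ suc k * N₀ * P

    copies : Copies F
    copies = small-penalty⇒copies F p small

    paths : ∀ i → toℕ i < p → alive F i ≡ true → HasChain F i
    paths = small-penalty⇒chain F p small

    -- The yield, over `suc k !`, of cutting an active bit with `ρ` active bits below it: `N₀` bits
    -- until the edge returns, then `ρ` bits with one reset fewer.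
    D : ℕ → ℕ
    D ρ = (N₀ C suc k) + suc k * (ρ C k)

    ρ : Fin n → ℕ
    ρ i = #active F (toℕ i)

    drain₁ : EdgeLabel → ℕ
    drain₁ = drain F (chainWeight F p)

    chooseB : ∀ {A : Set} → A → (Fin n → A) → EdgeLabel → A
    chooseB other onActive (b1 i j) = if active F p i then onActive i else other
    chooseB other onActive _ = other

    Xₗ Zₗ : EdgeLabel → ℕ
    Xₗ = chooseB X (λ i → Q (suc k) * D (ρ i))
    Zₗ x = chooseB (c * (P + drain₁ x)) (λ i → V * D (ρ i)) x

    -- For an edge of an active chain b the two sides of the comparison are booked in full, each on
    -- the account opposite to it. This leaves an equality for the label and sums over active bits
    -- that `∑-ranks` evaluates.
    gain loss : Fin n → ℕ
    gain i = if active F p i then Q (suc k) * D (ρ i) + Z else 0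
    loss i = if active F p i then X + V * D (ρ i) else 0

    inert : ∀ y x l → (if y then X + c * (P + drain₁ x) else 0) + 0 ≤ (if y then X + Z else 0) + (l + c * drain₁ x)
    inert false x l = z≤n
    inert true x l = ≤-trans (≤-reflexive (expand X c P (drain₁ x))) (+-monoʳ-≤ (X + Z) (m≤n+m _ l))
      where
      expand : ∀ X c P d → (X + c * (P + d)) + 0 ≡ (X + c * P) + c * d
      expand = solve-∀

    pointwise : ∀ x → (if free F B x then X + Zₗ x else 0) + onB1 gain x ≤
      (if free F B x then Xₗ x + Z else 0) + (onB1 loss x + c * drain₁ x)
    pointwise x@(a1 _ _ _) = inert (free F B x) x 0
    pointwise x@(a0 _ _ _ _) = inert (free F B x) x 0
    pointwise x@(b0 _ _ _) = inert (free F B x) x 0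
    pointwise x@(u1 _ _) = inert (free F B x) x 0
    pointwise x@(u0 _ _) = inert (free F B x) x 0
    pointwise x@(wj _ _ _) = inert (free F B x) x 0
    pointwise x@(w0 _ _) = inert (free F B x) x 0
    -- The booking needs the edges of active chains b to be free, which is `clean`; it rules out the
    -- case of an active edge that is not free.
    pointwise x@(b1 i j) = go (active F p i) (free F B x) λ act → let (i<p , al) = active-elim {F} {p} {i} act in
        free-true {F} {B} {x} (alive-elim {F} {i} al j) (clean i j i<p)
      where
      swap : ∀ x z y c → (x + z) + y ≡ y + ((x + z) + c * 0)
      swap = solve-∀
      go : ∀ y fr → (y ≡ true → fr ≡ true) →
        (if fr then X + (if y then V * D (ρ i) else c * (P + 0)) else 0) + (if y then Q (suc k) * D (ρ i) + Z else 0) ≤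
        (if fr then (if y then Q (suc k) * D (ρ i) else X) + Z else 0) + ((if y then X + V * D (ρ i) else 0) + c * 0)
      go false fr fr! = inert fr (b1 i j) 0
      go true true fr! = ≤-reflexive (swap X (V * D (ρ i)) (Q (suc k) * D (ρ i) + Z) c)
      go true false fr! = case fr! refl of λ ()

    ∑-active : ∀ (g : ℕ → ℕ) → ∑ (λ i → if active F p i then g (ρ i) else 0) ≡ ∑ {N} (g ∘ toℕ)
    ∑-active g = trans (∑-ranks (alive F) p g) (cong (λ z → ∑ {z} (g ∘ toℕ)) N≡)

    ∑-D : ∑ {N} (D ∘ toℕ) ≡ N * (N C suc k)
    ∑-D = ∑-gain N₀ k

    -- After `∑-gain` the main terms cancel. What remains is that `N * R` cutting edges, each with
    -- `N₀` in place of `N` in its error term, pay for the total drain `R * P` taken `N` times;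
    -- `balance` shows that nothing is left over.
    total-loss : Σl allLabels (λ x → onB1 loss x + c * drain₁ x) ≤ Σl allLabels (onB1 gain)
    total-loss = begin
      Σl allLabels (λ x → onB1 loss x + c * drain₁ x)                 ≡⟨ Σl-+ allLabels (onB1 loss) (λ x → c * drain₁ x) ⟩
      Σl allLabels (onB1 loss) + Σl allLabels (λ x → c * drain₁ x)    ≡⟨ cong₂ _+_ (∑-onB1 loss) (Σl-scale allLabels c drain₁) ⟩
      R * ∑ loss + c * Σl allLabels drain₁                            ≤⟨ +-mono-≤ (≤-reflexive (cong (R *_) ∑-loss))
                                                                           (*-monoʳ-≤ c (∑-drain-all (m≤m*n r s) F p)) ⟩
      R * (N * X + V * (N * (N C suc k))) + c * (R * P)               ≡⟨ balance R N₀ (N C suc k) (Q (suc k)) (suc m ^ suc k) P ⟩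
      R * (Q (suc k) * (N * (N C suc k)) + N * Z)                     ≡⟨ cong (R *_) ∑-gain' ⟨
      R * ∑ gain                                                      ≡⟨ ∑-onB1 gain ⟨
      Σl allLabels (onB1 gain)                                        ∎
      where
      open ≤-Reasoning
      balance : ∀ R N₀ CN Q A P →
        R * (suc N₀ * (CN * Q) + (A * N₀ * P) * (suc N₀ * CN)) + (CN * A * suc N₀) * (R * P) ≡
        R * (Q * (suc N₀ * CN) + suc N₀ * ((CN * A * suc N₀) * P))
      balance = solve-∀
      ∑-loss : ∑ loss ≡ N * X + V * (N * (N C suc k))
      ∑-loss = trans (∑-active (λ ρ → X + V * D ρ)) (trans (∑-distrib-+ {N} (λ _ → X) (λ i → V * D (toℕ i)))
        (cong₂ _+_ (∑-const N X) (trans (∑-scale {N} V (D ∘ toℕ)) (cong (V *_) ∑-D))))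
      ∑-gain' : ∑ gain ≡ Q (suc k) * (N * (N C suc k)) + N * Z
      ∑-gain' = trans (∑-active (λ ρ → Q (suc k) * D ρ + Z)) (trans (∑-distrib-+ {N} (λ i → Q (suc k) * D (toℕ i)) (λ _ → Z))
        (cong₂ _+_ (trans (∑-scale {N} (Q (suc k)) (D ∘ toℕ)) (cong (Q (suc k) *_) ∑-D)) (∑-const N Z)))

    sums : Σl (diffList F B) (λ e → X + Zₗ (label e)) ≤ Σl (diffList F B) (λ e → Xₗ (label e) + Z)
    sums = diffList-compare F B (λ x → X + Zₗ x) (λ x → Xₗ x + Z) (onB1 gain) (λ x → onB1 loss x + c * drain₁ x)
      pointwise total-loss

    module _ {e : Edge} {D₀ D₁ : Dist} (F∋e : F ∋ label e) (e∉B : ¬ B ∋ label e)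
      (rf : RF (removeEdge F e) B D₀) (claims : Claims (removeEdge F e) B D₀) (cont : ContWith Claims F e D₀ D₁) where

      private
        F' : EdgeSet
        F' = removeEdge F e

        sub' : B ⊆ F'
        sub' = ⊆-removeEdge {F} {B} {e} sub e∉B

        Responds : ℕ → ℕ → Outcome → Set
        Responds X Z (_ , B' , _) = Improving B' e × (∀ {D'} → RF F (switch B' e) D' → Claims F (switch B' e) D' →
          LowerBound (Y₁ (suc k)) X Z (total D'))

        penalty' : penalty F' p ≤ P + drain₁ (label e)
        penalty' = penalty-bump F e p (chainWeight F p) (λ i j k → chainWeight-cut F e p)

      by-removal : (∀ i → toℕ i ≡ p → HasChain F' i) → (∀ i j → label e ≡ b1 i j → active F p i ≡ false) →
        LowerBound (Y₁ (suc k)) X (c * (P + drain₁ (label e))) (total D₁)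
      by-removal path' inactive = lowerBound-cont rf cont (lowerBound-relax
        (≤-reflexive (cong (X₁ (suc k)) (sym N'≡)))
        (≤-trans (≤-reflexive (cong (λ z → Z₁ (suc k) z (penalty F' p)) N'≡)) (Z₁-mono (suc k) N penalty'))
        (proj₁ claims (suc k) p (phase1-remove {F} {B} {p} {e} ph e∉B path')))
        where
        N'≡ : #active F' p ≡ N
        N'≡ = trans (#active-kept F e p inactive) N≡

      by-cutting : ∀ {i j} → label e ≡ b1 i j → active F p i ≡ true →
        LowerBound (Y₁ (suc k)) (Q (suc k) * D (ρ i)) (V * D (ρ i)) (total D₁)
      by-cutting {i} {j} eq act = lowerBound-relax (≤-reflexive (splitX (Q (suc k)) (N₀ C suc k) (suc k * (ρ i C k))))
        (≤-reflexive (splitZ V (N₀ C suc k) (suc k * (ρ i C k))))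
        (lowerBound-imp rf cont removal (All.map (λ {o} → addBack {o}) (outcomes-optimal rf tree sub')))
        where
        splitX : ∀ Q x y → Q * (x + y) ≡ x * Q + y * Q
        splitX = solve-∀
        splitZ : ∀ V x y → x * V + y * V ≡ V * (x + y)
        splitZ = solve-∀
        i<p : toℕ i < p
        i<p = proj₁ (active-elim {F} {p} {i} act)
        al : alive F i ≡ true
        al = proj₂ (active-elim {F} {p} {i} act)
        ρ≤N₀ : ρ i ≤ N₀
        ρ≤N₀ = ≤-pred (subst (ρ i <_) N≡ (#active-below< F p i act))
        module Set' {B'} (opt : Optimal F' B') = Setting {F} {B'} {e} {i} {j} eq al copies opt
          (phase1-lanes {F} {B} {p} {e} {i} {j} ph eq i<p copies paths e∉B opt) (paths i i<p al)
          (λ i' lt → paths i' (<-trans lt i<p))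
        addBack : ∀ {o} → OptimalOutcome F' o →
          Responds (suc k * (ρ i C k) * Q (suc k)) (suc k * (ρ i C k) * V) o
        addBack opt = Set'.set-improving opt , λ {_} _ claims' →
          -- After the return of `e` only the `ρ i ≤ N₀` bits below `i` count, with a penalty over
          -- fewer chains. So the error `V`, scaled by the respective coefficient, covers both
          -- parts.
          phase2-used k (ρ i) (#chains F i) (penalty F (toℕ i)) N₀ P (m∸n≤m r (gaps (chain F i))) ρ≤N₀ (penalty-mono F (<⇒≤ i<p))
            (proj₂ claims' k i (Set'.set-phase2 opt))
        N'≡ : #active F' p ≡ N₀
        N'≡ = suc-injective (trans (sym (#active-cut F e p eq act)) N≡)
        removal : LowerBound (Y₁ (suc k)) ((N₀ C suc k) * Q (suc k)) ((N₀ C suc k) * V) (total D₀)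
        removal = lowerBound-relax (≤-reflexive (cong (X₁ (suc k)) (sym N'≡)))
          (≤-trans (≤-reflexive (cong (λ z → Z₁ (suc k) z (penalty F' p)) N'≡)) (≤-trans
            (Z₁-mono (suc k) N₀ (≤-trans penalty' (≤-reflexive (trans (cong (λ z → P + drain₁ z) eq) (+-identityʳ P)))))
            (≤-reflexive (regroup (N₀ C suc k) (suc m ^ suc k) N₀ P))))
          (proj₁ claims (suc k) p (phase1-remove {F} {B} {p} {e} ph e∉B
            (λ i' at → hasChain-kept F e i' (λ j' k' → ≢-via eq λ ()) (path i' at))))
          where
          regroup : ∀ c A N P → c * A * N * P ≡ c * (A * N * P)
          regroup = solve-∀

      -- Removing an edge of the last chain of the topmost bit only delays the same phase-1 state.
      by-resetting : ∀ {i j l} → label e ≡ a1 i j l → toℕ i ≡ p → (∀ j' → chain F' i j' ≡ false) →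
        LowerBound (Y₁ (suc k)) X (c * (P + drain₁ (label e))) (total D₁)
      by-resetting {i} {j} {l} eq at broken = lowerBound-relax ≤-refl (*-monoʳ-≤ c (m≤m+n P _))
        -- The recursive call itself is credited with nothing. The whole bound comes from the run
        -- after the return of `e`, whose edge set is again `F`.
        (lowerBound-imp rf cont (lowerBound-trivial {Y₁ (suc k)} {0} {0} (0≤total rf) z≤n)
          (All.map (λ {o} → addBack {o}) (outcomes-optimal rf tree sub')))
        where
        module Reset' {B'} (opt : Optimal F' B') = Resetting {F} {B} {B'} {e} {i} {j} {l} eq
          (allF-intro _ (λ j → sub _ (set i at j))) copies tree sub' opt (level i at)
          (last-chain F e eq (path i at) broken) broken
        addBack : ∀ {o} → OptimalOutcome F' o → Responds X Z o
        addBack {_ , B' , _} opt = Reset'.reset-improving opt , λ {D'} _ claims' →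
          subst (λ z → LowerBound (Y₁ (suc k)) (X₁ (suc k) z) (Z₁ (suc k) z P) (total D')) N≡
            (proj₁ claims' (suc k) p (subst (Phase1 F (switch B' e)) at (Reset'.reset-phase1 opt)))

      bounds : LowerBound (Y₁ (suc k)) (Xₗ (label e)) (Zₗ (label e)) (total D₁)
      bounds = go (label e) refl
        where
        keeps : (∀ i j l → label e ≢ a1 i j l) → ∀ i → toℕ i ≡ p → HasChain F' i
        keeps ≢ i at = hasChain-kept F e i (λ j l same → ≢ i j l (sym same)) (path i at)
        go-b1 : ∀ i j → label e ≡ b1 i j → ∀ y → active F p i ≡ y →
          LowerBound (Y₁ (suc k)) (if y then Q (suc k) * D (ρ i) else X)
            (if y then V * D (ρ i) else c * (P + 0)) (total D₁)
        go-b1 i j eq true act = by-cutting eq act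
        go-b1 i j eq false act = subst (λ z → LowerBound (Y₁ (suc k)) X (c * (P + drain₁ z)) (total D₁)) eq
          (by-removal (keeps (λ _ _ _ same → case trans (sym same) eq of λ ()))
            (λ i' j' same → case trans (sym eq) same of λ { refl → act }))
        go-a1 : ∀ i j l → label e ≡ a1 i j l → Dec (toℕ i ≡ p) → HasChain F' i ⊎ (∀ j' → chain F' i j' ≡ false) →
          LowerBound (Y₁ (suc k)) X (c * (P + drain₁ (label e))) (total D₁)
        go-a1 i j l eq (no i≢p) _ = by-removal
          (λ i' at → hasChain-kept F e i' (λ j' l' → ≢-via eq λ { refl → i≢p at }) (path i' at))
          (λ _ _ same → case trans (sym same) eq of λ ())
        go-a1 i j l eq (yes at) (inj₁ found) = by-removal
          (λ i' at' → subst (HasChain F') (toℕ-injective (trans at (sym at'))) found)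
          (λ _ _ same → case trans (sym same) eq of λ ())
        go-a1 i j l eq (yes at) (inj₂ broken) = by-resetting eq at broken
        ordinary : ∀ x → label e ≡ x → (∀ i j l → x ≢ a1 i j l) → (∀ i j → x ≢ b1 i j) →
          LowerBound (Y₁ (suc k)) X (c * (P + drain₁ x)) (total D₁)
        ordinary x refl ≢a1 ≢b1 = by-removal (keeps ≢a1) (λ i j same → ⊥-elim (≢b1 i j same))
        go : ∀ x → label e ≡ x → LowerBound (Y₁ (suc k)) (Xₗ x) (Zₗ x) (total D₁)
        go (b1 i j) eq = go-b1 i j eq (active F p i) refl
        go (a1 i j l) eq = subst (λ z → LowerBound (Y₁ (suc k)) X (c * (P + drain₁ z)) (total D₁)) eq
          (go-a1 i j l eq (toℕ i Data.Nat.≟ p) (hasChain? F' i))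
        go x@(a0 _ _ _ _) eq = ordinary x eq (λ _ _ _ ()) (λ _ _ ())
        go x@(b0 _ _ _) eq = ordinary x eq (λ _ _ _ ()) (λ _ _ ())
        go x@(u1 _ _) eq = ordinary x eq (λ _ _ _ ()) (λ _ _ ())
        go x@(u0 _ _) eq = ordinary x eq (λ _ _ _ ()) (λ _ _ ())
        go x@(wj _ _ _) eq = ordinary x eq (λ _ _ _ ()) (λ _ _ ())
        go x@(w0 _ _) eq = ordinary x eq (λ _ _ _ ()) (λ _ _ ())

  module Step2 {F B : EdgeSet} (k : ℕ) (i : Fin n) (ph : Phase2 F B i) (N₀ : ℕ) (N≡ : #active F (toℕ i) ≡ suc N₀)
    (small : penalty F (toℕ i) < 2 ^ r) where

    open Phase2 ph

    p N P c x X Z : ℕ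
    p = toℕ i
    N = suc N₀
    P = penalty F p
    c = (N C suc k) * suc m ^ suc k * N
    x = #chains F i
    X = X₂ (suc k) N
    Z = Z₂ (suc k) N P x

    copies : Copies F
    copies = small-penalty⇒copies F p small

    paths : ∀ i' → toℕ i' < p → alive F i' ≡ true → HasChain F i'
    paths = small-penalty⇒chain F p small

    drain₂ : EdgeLabel → ℕ
    drain₂ = drain F (λ _ → 0)

    x-pos : 1 ≤ x
    x-pos = m<n⇒0<n∸m (∃⇒gaps< (chain F i) (proj₁ path) (proj₂ path))

    -- The edges whose removal breaks one more chain of bit `i`, thereby lowering `x` or leading to
    -- the reset.
    hit : EdgeLabel → Bool
    hit (a1 i' j l) = does (i' Fin.≟ i) ∧ chain F i' j
    hit _ = false

    Z-hit : ℕ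
    Z-hit = c * P * (r * m + (x ∸ 1))

    Zₗ gain loss : EdgeLabel → ℕ
    Zₗ y = if hit y then Z-hit else c * (P + drain₂ y) * (r * m + x)
    gain y = if hit y then c * P else 0
    loss y = c * (r * m + x) * drain₂ y

    hit-free : ∀ y → hit y ≡ true → free F B y ≡ true
    hit-free (a1 i' j l) h with i' Fin.≟ i
    ... | yes refl = free-true {F} {B} {a1 i j l} (chain-elim {F} {i} {j} h l) (fresh j l)

    pointwise : ∀ y → (if free F B y then X + Zₗ y else 0) + gain y ≤ (if free F B y then X + Z else 0) + loss y
    pointwise y = go (hit y) (free F B y) (hit-free y) (drain₂ y)
      where
      expand : ∀ X c P d w → (X + c * (P + d) * w) + 0 ≡ (X + c * P * w) + c * w * d
      expand = solve-∀
      one-less : ∀ X v w x → (X + v * (w + x)) + v ≡ X + v * (w + suc x)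
      one-less = solve-∀
      go : ∀ h fr → (h ≡ true → fr ≡ true) → ∀ d →
        (if fr then X + (if h then Z-hit else c * (P + d) * (r * m + x)) else 0) + (if h then c * P else 0) ≤
        (if fr then X + Z else 0) + c * (r * m + x) * d
      go false false _ d = z≤n
      go false true _ d = ≤-reflexive (expand X c P d (r * m + x))
      go true false fr! d = case fr! refl of λ ()
      go true true fr! d = ≤-trans (≤-reflexive (trans (one-less X (c * P) (r * m) (x ∸ 1))
        (cong (λ z → X + c * P * (r * m + z)) (m+[n∸m]≡n x-pos)))) (m≤m+n _ _)

    gain-≥ : s * (c * P) ≤ Σl allLabels gain
    gain-≥ = ≤-trans (≤-reflexive (sym (trans (∑-cong {s} on-chain) (∑-const s (c * P))))) (∑-onA1-≥ gain i (proj₁ path))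
      where
      on-chain : ∀ l → gain (a1 i (proj₁ path) l) ≡ c * P
      on-chain l = cong (λ h → if h then c * P else 0) (cong₂ _∧_ (dec-true (i Fin.≟ i) refl) (proj₂ path))

    -- Here `long` is used. Copies drain at most `r * P`, each unit weighing
    -- `r * m + x ≤ 2 * (r * m)`; every edge of an intact chain saves `c * P` by lowering `x`. One
    -- intact chain exists, and its `s ≥ 2 * (r * r * m)` edges are enough.
    total-loss : Σl allLabels loss ≤ Σl allLabels gain
    total-loss = begin
      Σl allLabels loss                                 ≡⟨ Σl-scale allLabels (c * (r * m + x)) drain₂ ⟩
      c * (r * m + x) * Σl allLabels drain₂             ≤⟨ *-mono-≤ (*-monoʳ-≤ c (+-monoʳ-≤ (r * m) (≤-trans (m∸n≤m r (gaps (chain F i)))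
                                                             (m≤m*n r m {{Data.Nat.>-nonZero 1≤m}})))) (∑-drain-copies F p) ⟩
      c * (r * m + r * m) * (r * P)                     ≡⟨ regroup c r m P ⟩
      2 * (r * r * m) * (c * P)                         ≤⟨ *-monoˡ-≤ (c * P) long ⟩
      s * (c * P)                                       ≤⟨ gain-≥ ⟩
      Σl allLabels gain                                 ∎
      where
      open ≤-Reasoning
      regroup : ∀ c r m P → c * (r * m + r * m) * (r * P) ≡ 2 * (r * r * m) * (c * P)
      regroup = solve-∀

    sums : Σl (diffList F B) (λ e → X + Zₗ (label e)) ≤ Σl (diffList F B) (λ e → X + Z)
    sums = diffList-compare F B (λ y → X + Zₗ y) (λ _ → X + Z) gain loss pointwise total-loss

    module _ {e : Edge} {D₀ D₁ : Dist} (F∋e : F ∋ label e) (e∉B : ¬ B ∋ label e)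
      (rf : RF (removeEdge F e) B D₀) (claims : Claims (removeEdge F e) B D₀) (cont : ContWith Claims F e D₀ D₁) where

      private
        F' : EdgeSet
        F' = removeEdge F e

        sub' : B ⊆ F'
        sub' = ⊆-removeEdge {F} {B} {e} sub e∉B

        Responds : ℕ → ℕ → Outcome → Set
        Responds X Z (_ , B' , _) = Improving B' e × (∀ {D'} → RF F (switch B' e) D' → Claims F (switch B' e) D' →
          LowerBound (Y₂ (suc k)) X Z (total D'))

        penalty' : penalty F' p ≤ P + drain₂ (label e)
        penalty' = penalty-bump F e p (λ _ → 0) (λ i' j l → phase2-chainWeight {F} {B} {i} {e} {i'} {j} {l} ph e∉B)

      -- The bound `x'` is `x` in general and `x ∸ 1` if the removed edge breaks an intact chain of
      -- bit `i`.
      by-removal : (∀ j → label e ≢ b1 i j) → HasChain F' i → ∀ x' → #chains F' i ≤ x' →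
        LowerBound (Y₂ (suc k)) X (c * (P + drain₂ (label e)) * (r * m + x')) (total D₁)
      by-removal ≢b1 path' x' x'≥ = lowerBound-cont rf cont (lowerBound-relax
        (≤-reflexive (cong (X₂ (suc k)) (sym N'≡)))
        (≤-trans (≤-reflexive (cong (λ z → Z₂ (suc k) z (penalty F' p) (#chains F' i)) N'≡))
          (*-mono-≤ (*-monoʳ-≤ c penalty') (+-monoʳ-≤ (r * m) x'≥)))
        (proj₂ claims (suc k) i (phase2-remove {F} {B} {i} {e} ph e∉B (λ j same → ≢b1 j (sym same)) path')))
        where
        N'≡ : #active F' p ≡ N
        N'≡ = trans (#active-kept F e p inactive) N≡
          where
          -- alive bits below bit i have all their b-edges in the tree
          inactive : ∀ i' j → label e ≡ b1 i' j → active F p i' ≡ false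
          inactive i' j eq = BoolP.¬-not λ act → let (lt , al) = active-elim {F} {p} {i'} act in
            e∉B (subst (B ∋_) (sym eq) (lowerB i' lt al j))

      by-setting : ∀ {j} → label e ≡ b1 i j →
        LowerBound (Y₂ (suc k)) X (c * (P + drain₂ (label e)) * (r * m + x)) (total D₁)
      by-setting {j} eq = lowerBound-relax ≤-refl (*-monoˡ-≤ (r * m + x) (*-monoʳ-≤ c (m≤m+n P _)))
        (lowerBound-imp rf cont (lowerBound-trivial {Y₂ (suc k)} {0} {0} (0≤total rf) z≤n)
          (All.map (λ {o} → addBack {o}) (outcomes-optimal rf tree sub')))
        where
        module Set' {B'} (opt : Optimal F' B') = Setting {F} {B'} {e} {i} {j} eq self copies opt
          (Level.equal (level-improve level (Optimal.tree opt) (λ y By → removeEdge-⊆ {F} e y (Optimal.sub opt y By))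
            (optimal-≤ opt tree sub'))) path paths
        addBack : ∀ {o} → OptimalOutcome F' o → Responds X Z o
        addBack {_ , B' , _} opt = Set'.set-improving opt , λ {D'} _ claims' →
          subst (λ z → LowerBound (Y₂ (suc k)) (X₂ (suc k) z) (Z₂ (suc k) z P x) (total D')) N≡
            (proj₂ claims' (suc k) i (Set'.set-phase2 opt))

      by-resetting : ∀ {j l} → label e ≡ a1 i j l → (∀ j' → chain F' i j' ≡ false) →
        LowerBound (Y₂ (suc k)) X Z-hit (total D₁)
      by-resetting {j} {l} eq broken =
        lowerBound-imp rf cont (lowerBound-trivial {Y₂ (suc k)} {0} {0} (0≤total rf) z≤n)
          (All.map (λ {o} → addBack {o}) (outcomes-optimal rf tree sub'))
        where
        module Reset' {B'} (opt : Optimal F' B') = Resetting {F} {B} {B'} {e} {i} {j} {l} eq self copies tree sub' opt level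
          (last-chain F e eq path broken) broken
        addBack : ∀ {o} → OptimalOutcome F' o → Responds X Z-hit o
        addBack {_ , B' , _} opt = Reset'.reset-improving opt , λ {D'} _ claims' →
          -- After the reset no surcharge is left: `Claim₁` scaled by `r * m` is the phase-2 bound
          -- with `x = 0`. The remaining `x ∸ 1` only weakens it.
          lowerBound-relax ≤-refl (≤-trans (≤-reflexive (*-comm (r * m) (c * P))) (*-monoʳ-≤ (c * P) (m≤m+n (r * m) (x ∸ 1))))
            (lowerBound-scale (r * m)
              (subst (λ z → LowerBound (Y₁ (suc k)) (X₁ (suc k) z) (Z₁ (suc k) z P) (total D')) N≡
                (proj₁ claims' (suc k) p (Reset'.reset-phase1 opt))))

      bounds : LowerBound (Y₂ (suc k)) X (Zₗ (label e)) (total D₁)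
      bounds = go (label e) refl
        where
        same-gaps : (∀ j → chain F' i j ≡ chain F i j) → #chains F' i ≤ x
        same-gaps same = ≤-reflexive (cong (r ∸_) (gaps-cong same))
        still : (∀ j → chain F' i j ≡ chain F i j) → HasChain F' i
        still same = proj₁ path , trans (same (proj₁ path)) (proj₂ path)
        ordinary : ∀ y → label e ≡ y → (∀ j → y ≢ b1 i j) → (∀ j → chain F' i j ≡ chain F i j) →
          LowerBound (Y₂ (suc k)) X (c * (P + drain₂ y) * (r * m + x)) (total D₁)
        ordinary y refl ≢b1 same = by-removal ≢b1 (still same) x (same-gaps same)
        untouched : ∀ y → label e ≡ y → (∀ j l → a1 i j l ≢ y) → ∀ j → chain F' i j ≡ chain F i j
        untouched y refl ≢a1 j = chain-kept F e i j (≢a1 j)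
        go-hit : ∀ j l → label e ≡ a1 i j l → chain F i j ≡ true → HasChain F' i ⊎ (∀ j' → chain F' i j' ≡ false) →
          LowerBound (Y₂ (suc k)) X Z-hit (total D₁)
        go-hit j l eq ch (inj₂ broken) = by-resetting eq broken
        go-hit j l eq ch (inj₁ found) = subst (λ z → LowerBound (Y₂ (suc k)) X (c * z * (r * m + (x ∸ 1))) (total D₁))
          (trans (cong (λ z → P + drain₂ z) eq) (+-identityʳ P))
          (by-removal (λ _ same → case trans (sym same) eq of λ ()) found (x ∸ 1)
            (≤-trans (≤-reflexive (cong (r ∸_) more)) (≤-reflexive (sym (trans (∸-+-assoc r (gaps (chain F i)) 1)
              (cong (r ∸_) (+-comm (gaps (chain F i)) 1)))))))
          where
          more : gaps (chain F' i) ≡ suc (gaps (chain F i))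
          more = ∑-drop (gap ∘ chain F' i) (gap ∘ chain F i) j
            (trans (cong gap (cut-chain F e eq)) (cong (suc ∘ gap) (sym ch)))
            (λ j' j'≢ → cong gap (chain-kept F e i j' (λ l' → ≢-via eq λ { refl → j'≢ refl })))
        go-a1 : ∀ i' j l → label e ≡ a1 i' j l → Dec (i' ≡ i) → ∀ h → does (i' Fin.≟ i) ∧ chain F i' j ≡ h →
          LowerBound (Y₂ (suc k)) X (if h then Z-hit else c * (P + 0) * (r * m + x)) (total D₁)
        go-a1 i' j l eq (yes refl) true h = go-hit j l eq (proj₂ (∧-true {does (i Fin.≟ i)} h)) (hasChain? F' i)
        go-a1 i' j l eq (yes refl) false h = ordinary (a1 i j l) eq (λ _ ())
          (same-chains F e eq (trans (cong (_∧ chain F i j) (sym (dec-true (i Fin.≟ i) refl))) h))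
        go-a1 i' j l eq (no i'≢i) true h = case trans (sym (dec-false (i' Fin.≟ i) i'≢i)) (proj₁ (∧-true {does (i' Fin.≟ i)} h)) of λ ()
        go-a1 i' j l eq (no i'≢i) false h = ordinary (a1 i' j l) eq (λ _ ())
          (untouched (a1 i' j l) eq (λ { _ _ refl → i'≢i refl }))
        go-b1 : ∀ i' j → label e ≡ b1 i' j → Dec (i' ≡ i) →
          LowerBound (Y₂ (suc k)) X (c * (P + 0) * (r * m + x)) (total D₁)
        go-b1 i' j eq (yes refl) = subst (λ z → LowerBound (Y₂ (suc k)) X (c * (P + drain₂ z) * (r * m + x)) (total D₁)) eq
          (by-setting eq)
        go-b1 i' j eq (no i'≢i) = ordinary (b1 i' j) eq (λ { _ refl → i'≢i refl }) (untouched (b1 i' j) eq (λ _ _ ()))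
        go : ∀ y → label e ≡ y → LowerBound (Y₂ (suc k)) X (Zₗ y) (total D₁)
        go (a1 i' j l) eq = go-a1 i' j l eq (i' Fin.≟ i) (hit (a1 i' j l)) refl
        go (b1 i' j) eq = go-b1 i' j eq (i' Fin.≟ i)
        go y@(a0 _ _ _ _) eq = ordinary y eq (λ _ ()) (untouched y eq (λ _ _ ()))
        go y@(b0 _ _ _) eq = ordinary y eq (λ _ ()) (untouched y eq (λ _ _ ()))
        go y@(u1 _ _) eq = ordinary y eq (λ _ ()) (untouched y eq (λ _ _ ()))
        go y@(u0 _ _) eq = ordinary y eq (λ _ ()) (untouched y eq (λ _ _ ()))
        go y@(wj _ _ _) eq = ordinary y eq (λ _ ()) (untouched y eq (λ _ _ ()))
        go y@(w0 _ _) eq = ordinary y eq (λ _ ()) (untouched y eq (λ _ _ ()))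

-- Lower bounds for complete runs

∑-indicator-pos : ∀ {n N} (h : Fin n → Bool) → ∑ (indicator ∘ h) ≡ suc N → ∃ λ i → h i ≡ true
∑-indicator-pos {suc n} h eq with h Fin.zero in h₀
... | true = Fin.zero , h₀
... | false = let (i , hi) = ∑-indicator-pos (h ∘ Fin.suc) eq in Fin.suc i , hi

module Bound (n r' s' m : ℕ) (1≤m : 1 ≤ m) (long : 2 * (suc r' * suc r' * m) ≤ suc s') where

  open Labels n r' s' (suc r')
  open Graph n r s r
  open Trees n r' s' r hiding (C)
  open Structure n r' s' r
  open Outcomes n r' s' r
  open Expectation n r' s' r
  open Penalty n r' s' r
  open Phases n r' s' r
  open Counting n r' s' m 1≤m long
  open Induction n r' s' m 1≤m long

  LowerBounds : EdgeSet → EdgeSet → ℚ → Set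
  LowerBounds F B τ = (∀ k p → Phase1 F B p → ∀ N₀ → #active F p ≡ suc N₀ → penalty F p < 2 ^ r →
      LowerBound (Y₁ (suc k)) (X₁ (suc k) (suc N₀)) (Z₁ (suc k) (suc N₀) (penalty F p)) τ) ×
    (∀ k i → Phase2 F B i → ∀ N₀ → #active F (toℕ i) ≡ suc N₀ → penalty F (toℕ i) < 2 ^ r →
      LowerBound (Y₂ (suc k)) (X₂ (suc k) (suc N₀)) (Z₂ (suc k) (suc N₀) (penalty F (toℕ i)) (#chains F i)) τ)

  -- The remaining cases hold for any run: `k = 0` only asks for a total of at least 1, without
  -- active bits the binomial coefficient vanishes, and once the penalty has reached `2 ^ r` the
  -- error term outweighs the main term.
  claims-from : ∀ {F B D} → RF F B D → LowerBounds F B (total D) → Claims F B D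
  claims-from {F} {B} {D} rf (low₁ , low₂) = claim₁ , claim₂
    where
    claim₁ : ∀ k p → Phase1 F B p → Claim₁ F D k p
    claim₁ zero p ph = lowerBound-1 (Y₁ 0) _ (1≤total rf)
    claim₁ (suc k) p ph = go (#active F p) refl
      where
      P : ℕ
      P = penalty F p
      go : ∀ N → #active F p ≡ N → LowerBound (Y₁ (suc k)) (X₁ (suc k) N) (Z₁ (suc k) N P) (total D)
      go zero eq = lowerBound-trivial (0≤total rf) (≤-trans (≤-reflexive (cong (_* Q (suc k)) (k>n⇒nCk≡0 {0} {suc k} (s≤s z≤n)))) z≤n)
      go (suc N₀) eq with Z₁ (suc k) (suc N₀) P <? X₁ (suc k) (suc N₀)
      ... | no Z≮X = lowerBound-trivial (0≤total rf) (≮⇒≥ Z≮X)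
      ... | yes Z<X = low₁ k p ph N₀ eq (nontrivial (suc N₀ C suc k) m (suc k) N₀ P (2 ^ r) Z<X)
    claim₂ : ∀ k i → Phase2 F B i → Claim₂ F D k i
    claim₂ zero i ph = lowerBound-1 (Y₂ 0) _ (1≤total rf)
    claim₂ (suc k) i ph = go (#active F (toℕ i)) refl
      where
      P x : ℕ
      P = penalty F (toℕ i)
      x = #chains F i
      go : ∀ N → #active F (toℕ i) ≡ N → LowerBound (Y₂ (suc k)) (X₂ (suc k) N) (Z₂ (suc k) N P x) (total D)
      go zero eq = lowerBound-trivial (0≤total rf) (≤-trans (≤-reflexive
        (trans (cong (λ z → r * m * (z * Q (suc k))) (k>n⇒nCk≡0 {0} {suc k} (s≤s z≤n))) (*-zeroʳ (r * m)))) z≤n)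
      go (suc N₀) eq with Z₁ (suc k) (suc N₀) P <? X₁ (suc k) (suc N₀)
      ... | no Z≮X = lowerBound-trivial (0≤total rf) (≤-trans (*-monoʳ-≤ (r * m) (≮⇒≥ Z≮X))
              (≤-trans (≤-reflexive (*-comm (r * m) (Z₁ (suc k) (suc N₀) P))) (*-monoʳ-≤ (Z₁ (suc k) (suc N₀) P) (m≤m+n (r * m) x))))
      ... | yes Z<X = low₂ k i ph N₀ eq (nontrivial (suc N₀ C suc k) m (suc k) N₀ P (2 ^ r) Z<X)

  -- A run cannot stop in these states: an active bit has its chain b outside the tree by `clean`,
  -- and a bit being set has an intact chain a outside the tree by `fresh`.
  claims-done : ∀ {F B} → diffList F B ≡ [] → Claims F B ((1ℚ , B , 0) ∷ [])
  claims-done {F} {B} eq = claims-from (rf-done eq)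
    ( (λ k p ph N₀ N≡ _ → let (i , act) = ∑-indicator-pos (active F p) N≡ ; (lt , al) = active-elim {F} {p} {i} act in
        ⊥-elim (Phase1.clean ph i Fin.zero lt (diffList-[] F B eq _ (alive-elim {F} {i} al Fin.zero))))
    , (λ k i ph N₀ _ _ → let (j , ch) = Phase2.path ph in
        ⊥-elim (Phase2.fresh ph j Fin.zero (diffList-[] F B eq _ (chain-elim {F} {i} {j} ch Fin.zero)))) )

  claims-step : ∀ {F B D e es} → diffList F B ≡ e ∷ es → Branches F B (e ∷ es) D → BranchesWith Claims F B (e ∷ es) D →
    Claims F B (shift ((ℤ.+ 1) / suc (length es)) 0 D)
  claims-step {F} {B} {D} {e} {es} eq br brs = claims-from (rf-step eq br)
    ( (λ k p ph N₀ N≡ small → let open Step1 {F} {B} k p ph N₀ N≡ small in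
        average-lower (Y₁ (suc k)) X Z (Xₗ ∘ label) (Zₗ ∘ label) brs
          (λ e' e'∈ rf claims cont → bounds (proj₁ (isFree e' e'∈)) (proj₂ (isFree e' e'∈)) rf claims cont)
          (subst (λ l → Σl l (λ e → X + Zₗ (label e)) ≤ Σl l (λ e → Xₗ (label e) + Z)) eq sums))
    , (λ k i ph N₀ N≡ small → let open Step2 {F} {B} k i ph N₀ N≡ small in
        average-lower (Y₂ (suc k)) X Z (λ _ → X) (Zₗ ∘ label) brs
          (λ e' e'∈ rf claims cont → bounds (proj₁ (isFree e' e'∈)) (proj₂ (isFree e' e'∈)) rf claims cont)
          (subst (λ l → Σl l (λ e → X + Zₗ (label e)) ≤ Σl l (λ e → X + Z)) eq sums)) )
    where
    isFree : ∀ e' → e' ∈ e ∷ es → Free F B e'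
    isFree e' = All.lookup (subst (All (Free F B)) eq (diffList-free F B))

  claims : ∀ {F B D} → RF F B D → Claims F B D
  claims = RF-ind Claims claims-done claims-step

  gaps-full : ∀ k → gaps {k} (λ _ → true) ≡ 0
  gaps-full k = ∑-zero k

  alive-full : ∀ i → alive fullSet i ≡ true
  alive-full i = allF-intro {R} (λ _ → true) (λ _ → refl)

  #active-full : #active fullSet n ≡ n
  #active-full = trans (∑-cong {n} (λ i → cong indicator (active-intro {fullSet} {n} {i} (toℕ<n i) (alive-full i))))
    (trans (∑-const n 1) (*-identityʳ n))

  -- With nothing removed every group weighs `2 ^ 0`, so this counts groups: per bit there are seven
  -- kinds, each with at most `R` groups.
  penalty-full : penalty fullSet n ≤ n * (7 * R)
  penalty-full = ≤-trans (∑-mono {g = λ _ → 7 * R} perBit) (≤-reflexive (∑-const n (7 * R)))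
    where
    weight-full : ∀ x → weight fullSet x ≡ 1
    weight-full x = cong (2 ^_) (gaps-full r)
    row : ∀ {k} (f : Fin k → ℕ) → (∀ j → f j ≡ 1) → ∑ f ≡ k
    row {k} f f≡1 = trans (∑-cong f≡1) (trans (∑-const k 1) (*-identityʳ k))
    penA-full : ∀ i → penA fullSet i ≡ R
    penA-full i = trans (∑-cong {r} {x = λ j → ∑ λ k → weight fullSet (a0 i j k)} {y = λ _ → s}
      (λ j → row (λ k → weight fullSet (a0 i j k)) (λ k → weight-full (a0 i j k)))) (∑-const r s)
    chainWeight-full : ∀ i → chainWeight fullSet n i ≡ 1
    chainWeight-full i = trans (cong (λ y → if y then 2 ^ gaps (chain fullSet i) else 0)
      (active-intro {fullSet} {n} {i} (toℕ<n i) (alive-full i)))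
      (cong (2 ^_) (trans (gaps-cong {h = chain fullSet i} {h' = λ (_ : Fin r) → true} (λ j → allF-intro {s} (λ _ → true) (λ _ → refl))) (gaps-full r)))
    count : ∀ i → bitPenalty fullSet i + chainWeight fullSet n i ≡ R + (R + (1 + (1 + (r + 1)))) + 1
    count i = cong₂ _+_ (cong₂ _+_ (penA-full i) (cong₂ _+_ (row (λ j → weight fullSet (b0 i j)) (λ j → weight-full (b0 i j)))
      (cong₂ _+_ (weight-full (u1 i)) (cong₂ _+_ (weight-full (u0 i))
        (cong₂ _+_ (row (λ j → weight fullSet (wj i j)) (λ j → weight-full (wj i j))) (weight-full (w0 i)))))))
      (chainWeight-full i)
    perBit : ∀ i → bitPenalty fullSet i + chainWeight fullSet n i ≤ 7 * R
    perBit i = begin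
      bitPenalty fullSet i + chainWeight fullSet n i     ≡⟨ count i ⟩
      R + (R + (1 + (1 + (r + 1)))) + 1                  ≤⟨ +-mono-≤ (+-monoʳ-≤ R (+-monoʳ-≤ R (+-mono-≤ 1≤R (+-mono-≤ 1≤R
                                                              (+-mono-≤ (m≤m*n r s) 1≤R))))) 1≤R ⟩
      R + (R + (R + (R + (R + R)))) + R                  ≡⟨ seven R ⟩
      7 * R                                              ∎
      where
      open ≤-Reasoning
      1≤R : 1 ≤ R
      1≤R = s≤s z≤n
      seven : ∀ x → x + (x + (x + (x + (x + x)))) + x ≡ 7 * x
      seven = solve-∀

  -- With `p = n` there is no bit set last, and the conditions on it are vacuous.
  initial : ∀ {B₀} → IsTree B₀ → AllZeroEdges B₀ → Phase1 fullSet B₀ n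
  initial {B₀} tree zeros = record
    { tree = tree ; sub = λ _ _ → refl
    ; clean = λ i j _ Bx → case trans (sym (zeros (edge (b1 i j)) Bx)) (cong isZeroEdge (label-edge (b1 i j))) of λ ()
    ; level = λ i at → ⊥-elim (<⇒≢ (toℕ<n i) at)
    ; set = λ i at → ⊥-elim (<⇒≢ (toℕ<n i) at)
    ; path = λ i at → ⊥-elim (<⇒≢ (toℕ<n i) at) }

  runs : ∀ {B₀} → IsTree B₀ → Σ Dist (RF fullSet B₀)
  runs {B₀} tree = RF-exists fullSet B₀ tree (λ _ _ → refl)

  initial-bound : ∀ {B₀ D} → IsTree B₀ → AllZeroEdges B₀ → RF fullSet B₀ D → ∀ k →
    LowerBound (Y₁ k) (X₁ k n) (Z₁ k n (n * (7 * R))) (1ℚ ℚ.+ expectedSwitches D)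
  initial-bound {B₀} {D} tree zeros rf k = subst (LowerBound (Y₁ k) (X₁ k n) (Z₁ k n (n * (7 * R))))
    (trans (total≡mass+switches D) (cong (ℚ._+ expectedSwitches D) (RF-mass rf)))
    (lowerBound-relax ≤-refl (Z₁-mono k n penalty-full)
      (subst (λ N → LowerBound (Y₁ k) (X₁ k N) (Z₁ k N (penalty fullSet n)) (total D)) #active-full
        (proj₁ (claims rf) k n (initial tree zeros))))

-- Arithmetic of the parameters

log₂-upper : ∀ n → n < 2 ^ suc ⌊log₂ n ⌋
log₂-upper n with n <? 2 ^ suc ⌊log₂ n ⌋
... | yes lt = lt
... | no ≮ = ⊥-elim (<-irrefl refl (subst (_≤ ⌊log₂ n ⌋) (⌊log₂[2^n]⌋≡n (suc ⌊log₂ n ⌋)) (⌊log₂⌋-mono-≤ (≮⇒≥ ≮))))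

log₂-lower : ∀ n → 1 ≤ n → 2 ^ ⌊log₂ n ⌋ ≤ n
log₂-lower n 1≤n = go n (suc n) ≤-refl 1≤n
  where
  go : ∀ n f → n < f → 1 ≤ n → 2 ^ ⌊log₂ n ⌋ ≤ n
  go (suc zero) f n<f 1≤n = ≤-refl
  go n@(suc (suc n-2)) (suc f) n<f 1≤n = begin
    2 ^ ⌊log₂ n ⌋                          ≡⟨ cong (2 ^_) (m+[n∸m]≡n {1} (⌊log₂⌋-mono-≤ {2} {n} (s≤s (s≤s z≤n)))) ⟨
    2 * 2 ^ (⌊log₂ n ⌋ ∸ 1)                ≡⟨ cong (λ z → 2 * 2 ^ z) (⌊log₂⌊n/2⌋⌋≡⌊log₂n⌋∸1 n) ⟨
    2 * 2 ^ ⌊log₂ ⌊ n /2⌋ ⌋                ≤⟨ *-monoʳ-≤ 2 (go ⌊ n /2⌋ f (<-≤-trans (⌊n/2⌋<n (suc n-2)) (≤-pred n<f)) (s≤s z≤n)) ⟩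
    2 * ⌊ n /2⌋                            ≡⟨ cong (⌊ n /2⌋ +_) (+-identityʳ ⌊ n /2⌋) ⟩
    ⌊ n /2⌋ + ⌊ n /2⌋                      ≤⟨ +-monoʳ-≤ ⌊ n /2⌋ (⌊n/2⌋≤⌈n/2⌉ n) ⟩
    ⌊ n /2⌋ + ⌈ n /2⌉                      ≡⟨ ⌊n/2⌋+⌈n/2⌉≡n n ⟩
    n                                      ∎
    where open ≤-Reasoning

isqrt-step : ∀ {A : Set} → ℕ → Dec A → ℕ
isqrt-step x (yes _) = suc x
isqrt-step x (no _)  = x

isqrt : ℕ → ℕ
isqrt zero = 0
isqrt (suc n) = isqrt-step (isqrt n) (suc (isqrt n) * suc (isqrt n) ≤? suc n)

isqrt-spec : ∀ n → isqrt n * isqrt n ≤ n × n < suc (isqrt n) * suc (isqrt n)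
isqrt-spec zero = z≤n , s≤s z≤n
isqrt-spec (suc n) = step (isqrt n) (suc (isqrt n) * suc (isqrt n) ≤? suc n) (isqrt-spec n)
  where
  step : ∀ x (d : Dec (suc x * suc x ≤ suc n)) → x * x ≤ n × n < suc x * suc x →
    isqrt-step x d * isqrt-step x d ≤ suc n × suc n < suc (isqrt-step x d) * suc (isqrt-step x d)
  step x (yes le) (_ , hi) = le , ≤-<-trans hi (*-mono-< (n<1+n (suc x)) (n<1+n (suc x)))
  step x (no ≰) (lo , _) = m≤n⇒m≤1+n lo , ≰⇒> ≰

sqrt-mono : ∀ {x z} → x * x < suc z * suc z → x ≤ z
sqrt-mono {x} {z} lt with x ≤? z
... | yes le = le
... | no ≰ = ⊥-elim (<⇒≱ lt (*-mono-≤ (≰⇒> ≰) (≰⇒> ≰)))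

isqrt≤ : ∀ n → isqrt n ≤ n
isqrt≤ n with isqrt n | proj₁ (isqrt-spec n)
... | zero  | _  = z≤n
... | suc x | le = ≤-trans (m≤m*n (suc x) (suc x)) le

square≤4*2^ : ∀ l → suc l * suc l ≤ 4 * 2 ^ l
square≤4*2^ zero = s≤s z≤n
square≤4*2^ (suc zero) = s≤s (s≤s (s≤s (s≤s z≤n)))
-- Only from 3 on does passing to the next square at most double it, so the smaller cases are
-- checked separately.
square≤4*2^ (suc (suc l)) = go l
  where
  step : ∀ l → (4 + l) * (4 + l) + (l * l + 4 * l + 2) ≡ 2 * ((3 + l) * (3 + l))
  step = solve-∀
  twice : ∀ x → 2 * (4 * x) ≡ 4 * (2 * x)
  twice = solve-∀
  go : ∀ l → (3 + l) * (3 + l) ≤ 4 * 2 ^ (2 + l)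
  go zero = m≤m+n 9 7
  go (suc l) = ≤-trans (≤-trans (m≤m+n _ _) (≤-reflexive (step l)))
    (≤-trans (*-monoʳ-≤ 2 (go l)) (≤-reflexive (twice (2 ^ (2 + l)))))

-- Bernoulli's inequality (1 − 1/(m+1))ʲ ≥ 1 − j/(m+1), cleared of denominators.
bernoulli : ∀ m j d → j + d ≡ suc m → suc m ^ j * d ≤ suc m * m ^ j
bernoulli m zero d refl = ≤-reflexive (*-comm 1 (suc m))
bernoulli m (suc j) d eq = begin
  suc m * suc m ^ j * d        ≡⟨ rearrange (suc m) (suc m ^ j) d ⟩
  suc m ^ j * (d + m * d)      ≤⟨ *-monoʳ-≤ (suc m ^ j) (+-monoˡ-≤ (m * d) d≤m) ⟩
  suc m ^ j * (m + m * d)      ≡⟨ regroup (suc m ^ j) m d ⟩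
  m * (suc m ^ j * suc d)      ≤⟨ *-monoʳ-≤ m (bernoulli m j (suc d) (trans (+-suc j d) eq)) ⟩
  m * (suc m * m ^ j)          ≡⟨ swap m (suc m) (m ^ j) ⟩
  suc m * (m * m ^ j)          ∎
  where
  open ≤-Reasoning
  d≤m : d ≤ m
  d≤m = subst (d ≤_) (suc-injective eq) (m≤n+m d j)
  rearrange : ∀ m' x d → m' * x * d ≡ x * (m' * d)
  rearrange = solve-∀
  regroup : ∀ x m d → x * (m + m * d) ≡ m * (x * suc d)
  regroup = solve-∀
  swap : ∀ m m' x → m * (m' * x) ≡ m' * (m * x)
  swap = solve-∀

-- Bernoulli with exponent `h` gives `(1 - 1/(2h+1))ʰ ≥ (h+1)/(2h+1) ≥ 1/2`.
power-ratio-half : ∀ h → suc (2 * h) ^ h ≤ 2 * (2 * h) ^ h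
power-ratio-half h = *-cancelʳ-≤ _ _ (suc h) (begin
  suc (2 * h) ^ h * suc h              ≤⟨ bernoulli (2 * h) h (suc h) (total h) ⟩
  suc (2 * h) * (2 * h) ^ h            ≤⟨ *-monoˡ-≤ ((2 * h) ^ h) (n≤1+n (suc (2 * h))) ⟩
  suc (suc (2 * h)) * (2 * h) ^ h      ≡⟨ factor h ((2 * h) ^ h) ⟩
  2 * (2 * h) ^ h * suc h              ∎)
  where
  open ≤-Reasoning
  total : ∀ h → h + suc h ≡ suc (2 * h)
  total = solve-∀
  factor : ∀ h x → suc (suc (2 * h)) * x ≡ 2 * x * suc h
  factor = solve-∀

^-distribʳ-* : ∀ k x z → (x * z) ^ k ≡ x ^ k * z ^ k
^-distribʳ-* zero    x z = refl
^-distribʳ-* (suc k) x z = trans (cong (x * z *_) (^-distribʳ-* k x z)) (interchange x z (x ^ k) (z ^ k))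
  where
  interchange : ∀ x z x' z' → x * z * (x' * z') ≡ x * x' * (z * z')
  interchange = solve-∀

-- Padding both sides with `d = h * L ∸ k` further factors, the larger base on the left, makes the
-- exponent `h * L`, to which `power-ratio-half` applies `L` times.
power-ratio : ∀ h L k → 1 ≤ h → k ≤ h * L → suc (2 * h) ^ k ≤ 2 ^ L * (2 * h) ^ k
power-ratio h L k 1≤h k≤hL = *-cancelʳ-≤ _ _ ((2 * h) ^ d) {{m^n≢0 (2 * h) d {{Data.Nat.>-nonZero (≤-trans 1≤h (m≤m+n h _))}}}} (begin
  suc (2 * h) ^ k * (2 * h) ^ d        ≤⟨ *-monoʳ-≤ (suc (2 * h) ^ k) (^-monoˡ-≤ d (n≤1+n (2 * h))) ⟩
  suc (2 * h) ^ k * suc (2 * h) ^ d    ≡⟨ ^-distribˡ-+-* (suc (2 * h)) k d ⟨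
  suc (2 * h) ^ (k + d)                ≡⟨ cong (suc (2 * h) ^_) (m+[n∸m]≡n k≤hL) ⟩
  suc (2 * h) ^ (h * L)                ≡⟨ ^-*-assoc (suc (2 * h)) h L ⟨
  (suc (2 * h) ^ h) ^ L                ≤⟨ ^-monoˡ-≤ L (power-ratio-half h) ⟩
  (2 * (2 * h) ^ h) ^ L                ≡⟨ ^-distribʳ-* L 2 ((2 * h) ^ h) ⟩
  2 ^ L * ((2 * h) ^ h) ^ L            ≡⟨ cong (2 ^ L *_) (^-*-assoc (2 * h) h L) ⟩
  2 ^ L * (2 * h) ^ (h * L)            ≡⟨ cong (λ z → 2 ^ L * (2 * h) ^ z) (m+[n∸m]≡n k≤hL) ⟨
  2 ^ L * (2 * h) ^ (k + d)            ≡⟨ cong (2 ^ L *_) (^-distribˡ-+-* (2 * h) k d) ⟩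
  2 ^ L * ((2 * h) ^ k * (2 * h) ^ d)  ≡⟨ *-assoc (2 ^ L) ((2 * h) ^ k) ((2 * h) ^ d) ⟨
  2 ^ L * (2 * h) ^ k * (2 * h) ^ d    ∎)
  where
  open ≤-Reasoning
  d : ℕ
  d = h * L ∸ k

C-ratio : ∀ n j → suc j * (n C suc j) + j * (n C j) ≡ n * (n C j)
C-ratio zero zero = refl
C-ratio zero (suc j) = cong₂ _+_ (zeros (suc (suc j)) (suc j)) (zeros (suc j) j)
  where
  zeros : ∀ c j → c * (0 C suc j) ≡ 0
  zeros c j = trans (cong (c *_) (k>n⇒nCk≡0 {0} {suc j} (s≤s z≤n))) (*-zeroʳ c)
C-ratio (suc n) zero = trans (+-identityʳ _) (absorption n 0)
C-ratio (suc n) (suc j) = trans (cong₂ _+_ (absorption n (suc j)) (absorption n j))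
  (trans (sym (*-distribˡ-+ (suc n) (n C suc j) (n C j)))
    (cong (suc n *_) (trans (+-comm (n C suc j) (n C j)) (nCk+nC[k+1]≡[n+1]C[k+1] n j))))

-- The ratio of consecutive binomials is `(n - k)/(k + 1)`, at least `2 (k + 1)` under the
-- hypothesis. The product of these factors is `2 ^ k * k !`, so `C(n,k)/k!` is at least `2 ^ k`.
C-lower : ∀ n k → 2 * (k * k) + k ≤ n → 2 ^ k * k ! ≤ n C k
C-lower n zero le = ≤-refl
C-lower n (suc k) le = *-cancelˡ-≤ (suc k) (+-cancelʳ-≤ (k * (n C k)) _ _ (begin
  suc k * (2 ^ suc k * suc k !) + k * (n C k)                ≡⟨ cong (_+ k * (n C k)) (shuffle (suc k) (2 ^ k) (k !)) ⟩
  2 * (suc k * suc k) * (2 ^ k * k !) + k * (n C k)          ≤⟨ +-monoˡ-≤ (k * (n C k)) (*-monoʳ-≤ (2 * (suc k * suc k)) (C-lower n k smaller)) ⟩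
  2 * (suc k * suc k) * (n C k) + k * (n C k)                ≡⟨ *-distribʳ-+ (n C k) (2 * (suc k * suc k)) k ⟨
  (2 * (suc k * suc k) + k) * (n C k)                        ≤⟨ *-monoˡ-≤ (n C k) (≤-trans (+-monoʳ-≤ (2 * (suc k * suc k)) (n≤1+n k)) le) ⟩
  n * (n C k)                                                ≡⟨ C-ratio n k ⟨
  suc k * (n C suc k) + k * (n C k)                          ∎))
  where
  open ≤-Reasoning
  shuffle : ∀ k x f → k * (2 * x * (k * f)) ≡ 2 * (k * k) * (x * f)
  shuffle = solve-∀
  smaller : 2 * (k * k) + k ≤ n
  smaller = ≤-trans (+-mono-≤ (*-monoʳ-≤ 2 (*-mono-≤ (n≤1+n k) (n≤1+n k))) (n≤1+n k)) le

halve : ∀ x → ∃ λ k → 2 * k ≤ x × x ≤ suc (2 * k)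
halve zero = 0 , z≤n , z≤n
halve (suc zero) = 0 , z≤n , s≤s z≤n
halve (suc (suc x)) = let (k , lo , hi) = halve x in suc k ,
  subst (_≤ suc (suc x)) (sym (double k)) (s≤s (s≤s lo)) , subst (suc (suc x) ≤_) (cong suc (sym (double k))) (s≤s (s≤s hi))
  where
  double : ∀ k → 2 * suc k ≡ suc (suc (2 * k))
  double = solve-∀

ℕtoℚ-^ : ∀ x k {E} → ℕtoℚ x ℚ.≤ E → ℕtoℚ (x ^ k) ℚ.≤ E ^ℚ k
ℕtoℚ-^ x zero le = ℚP.≤-refl
ℕtoℚ-^ x (suc k) {E} le = ℚP.≤-trans (ℚP.≤-reflexive (ℕtoℚ-* x (x ^ k))) (ℚP.≤-trans
  (ℚP.*-monoˡ-≤-nonNeg (ℕtoℚ x) {{ℕtoℚ-nonNeg x}} (ℕtoℚ-^ x k le))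
  (ℚP.*-monoʳ-≤-nonNeg (E ^ℚ k) {{ℚ.nonNegative (ℚP.≤-trans (ℕtoℚ-mono-≤ {0} {x ^ k} z≤n) (ℕtoℚ-^ x k le))}} le))

-- An error of at most half the main term leaves `X / (2 Y)`.
lowerBound-growth : ∀ {Y X Z τ} c → LowerBound Y X Z τ → 1 ≤ Y → 2 * Z ≤ X → c * (2 * Y) ≤ X → ℕtoℚ c ℚ.≤ τ
lowerBound-growth {Y} {X} {Z} {τ} c low 1≤Y 2Z≤X cY≤X =
  ℚP.*-cancelˡ-≤-pos (ℕtoℚ (2 * Y)) {{ℚ.positive (ℕtoℚ-mono-< {0} {2 * Y} (≤-trans 1≤Y (m≤m+n Y _)))}} (begin
    ℕtoℚ (2 * Y) ℚ.* ℕtoℚ c       ≡⟨ ℕtoℚ-* (2 * Y) c ⟨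
    ℕtoℚ (2 * Y * c)              ≡⟨ cong ℕtoℚ (*-comm (2 * Y) c) ⟩
    ℕtoℚ (c * (2 * Y))            ≤⟨ ℕtoℚ-mono-≤ cY≤X ⟩
    ℕtoℚ X                        ≤⟨ cancel (subst (ℚ._≤ ℕtoℚ (2 * Y) ℚ.* τ ℚ.+ ℕtoℚ X) double
                                       (LowerBound.bound (lowerBound-relax ≤-refl 2Z≤X (lowerBound-scale 2 low)))) ⟩
    ℕtoℚ (2 * Y) ℚ.* τ            ∎)
  where
  open ℚP.≤-Reasoning
  double : ℕtoℚ (2 * X) ≡ ℕtoℚ X ℚ.+ ℕtoℚ X
  double = trans (cong ℕtoℚ (cong (X +_) (+-identityʳ X))) (ℕtoℚ-+ X X)
  cancel : ∀ {p} → ℕtoℚ X ℚ.+ ℕtoℚ X ℚ.≤ p ℚ.+ ℕtoℚ X → ℕtoℚ X ℚ.≤ p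
  cancel {p} le = subst₂ ℚ._≤_ (drop (ℕtoℚ X)) (drop p) (ℚP.+-monoˡ-≤ (ℚ.- ℕtoℚ X) le)
    where
    drop : ∀ p → (p ℚ.+ ℕtoℚ X) ℚ.+ ℚ.- ℕtoℚ X ≡ p
    drop p = trans (ℚP.+-assoc p (ℕtoℚ X) (ℚ.- ℕtoℚ X))
      (trans (cong (p ℚ.+_) (ℚP.+-inverseʳ (ℕtoℚ X))) (ℚP.+-identityʳ p))

drop-one : ∀ j {E} → ℕtoℚ (2 ^ suc j) ℚ.≤ 1ℚ ℚ.+ E → ℕtoℚ (2 ^ j) ℚ.≤ E
drop-one j {E} le = subst₂ ℚ._≤_ (cancel (ℕtoℚ (2 ^ j))) (cancel E) (ℚP.+-monoʳ-≤ (ℚ.- 1ℚ) (ℚP.≤-trans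
  (ℚP.≤-trans (ℚP.≤-reflexive (sym (ℕtoℚ-+ 1 (2 ^ j)))) (ℕtoℚ-mono-≤ (+-mono-≤ (m^n>0 2 j) (m≤m+n (2 ^ j) 0)))) le))
  where
  cancel : ∀ p → ℚ.- 1ℚ ℚ.+ (1ℚ ℚ.+ p) ≡ p
  cancel p = trans (sym (ℚP.+-assoc (ℚ.- 1ℚ) 1ℚ p)) (trans (cong (ℚ._+ p) (ℚP.+-inverseˡ 1ℚ)) (ℚP.+-identityˡ p))

lg : ℕ → ℕ
lg n = suc ⌊log₂ n ⌋

-- With m = 2 * half n, the factor (1 + 1/m)ᵏ of the penalty is at most 2 ^ lg n for all k ≤ ⌊√n⌋ < half n * lg n.
half : ℕ → ℕ
half n = suc (isqrt n DivMod./ lg n)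

half*lg≤ : ∀ n → half n * lg n ≤ lg n + isqrt n
half*lg≤ n = +-monoʳ-≤ (lg n) (m/n*n≤m (isqrt n) (lg n))

isqrt<half*lg : ∀ n → isqrt n < half n * lg n
isqrt<half*lg n = subst (_< half n * lg n) (sym (m≡m%n+[m/n]*n (isqrt n) (lg n)))
  (+-monoˡ-< (isqrt n DivMod./ lg n * lg n) (m%n<n (isqrt n) (lg n)))

half≤2^ : ∀ n → half n ≤ 2 ^ lg n
half≤2^ n = ≤-trans (s≤s (≤-trans (DivMod.m/n≤m (isqrt n) (lg n)) (isqrt≤ n))) (log₂-upper n)

1≤log₂ : ∀ n → 2 ≤ n → 1 ≤ ⌊log₂ n ⌋
1≤log₂ n = ⌊log₂⌋-mono-≤ {2}

lg≤2*log₂ : ∀ n → 2 ≤ n → lg n ≤ 2 * ⌊log₂ n ⌋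
lg≤2*log₂ n 2≤n = +-mono-≤ (1≤log₂ n 2≤n) (≤-reflexive (sym (+-identityʳ ⌊log₂ n ⌋)))

lg-theta : ∀ K → ThetaLog (λ n → suc K * lg n)
lg-theta K = 2 * suc K , 2 , λ n 2≤n →
  ≤-trans (n≤1+n _) (≤-trans (m≤n*m (lg n) (suc K)) (m≤n*m (suc K * lg n) (2 * suc K))) ,
  ≤-trans (*-monoʳ-≤ (suc K) (lg≤2*log₂ n 2≤n)) (≤-reflexive (swap (suc K) ⌊log₂ n ⌋))
  where
  swap : ∀ K l → K * (2 * l) ≡ 2 * K * l
  swap = solve-∀

-- For `r = K * lg n` and `m = 2 * half n` this is `2 r² m`, the least length that `long` permits.
-- Its order is √n log n because `half n * lg n` has order √n.
pathLength : ℕ → ℕ → ℕ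
pathLength K n = 2 * (K * lg n * (K * lg n) * (2 * half n))

pathLength-theta : ∀ K → ThetaSqrtLog (pathLength (suc K))
-- `c` is the coefficient from squaring `pathLength`. The factor 60 is 15 from `x²≤` times 4 from
-- replacing `lg n` by `2 * ⌊log₂ n ⌋` twice.
pathLength-theta K₀ = c * 60 , 2 , λ n 2≤n → lowerB n , upperB n 2≤n
  where
  open ≤-Reasoning
  K c : ℕ
  K = suc K₀
  c = 16 * (K * K * (K * K))
  square : ∀ K L h → 2 * (K * L * (K * L) * (2 * h)) * (2 * (K * L * (K * L) * (2 * h))) ≡
    16 * (K * K * (K * K)) * (h * L * (h * L) * (L * L))
  square = solve-∀
  lowerB : ∀ n → n * (⌊log₂ n ⌋ * ⌊log₂ n ⌋) ≤ c * 60 * (pathLength K n * pathLength K n)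
  lowerB n = begin
    n * (⌊log₂ n ⌋ * ⌊log₂ n ⌋)                     ≤⟨ *-mono-≤ (≤-trans (<⇒≤ (proj₂ (isqrt-spec n)))
                                                         (*-mono-≤ (isqrt<half*lg n) (isqrt<half*lg n)))
                                                       (*-mono-≤ (n≤1+n ⌊log₂ n ⌋) (n≤1+n ⌊log₂ n ⌋)) ⟩
    x * x * (lg n * lg n)                           ≤⟨ m≤n*m (x * x * (lg n * lg n)) c ⟩
    c * (x * x * (lg n * lg n))                     ≡⟨ square K (lg n) (half n) ⟨
    pathLength K n * pathLength K n                 ≤⟨ m≤n*m (pathLength K n * pathLength K n) (c * 60) ⟩
    c * 60 * (pathLength K n * pathLength K n)      ∎
    where
    x : ℕ
    x = half n * lg n
  upperB : ∀ n → 2 ≤ n → pathLength K n * pathLength K n ≤ c * 60 * (n * (⌊log₂ n ⌋ * ⌊log₂ n ⌋))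
  upperB n 2≤n = begin
    pathLength K n * pathLength K n                 ≡⟨ square K L (half n) ⟩
    c * (x * x * (L * L))                           ≤⟨ *-monoʳ-≤ c (*-mono-≤ x²≤ (*-mono-≤ (lg≤2*log₂ n 2≤n) (lg≤2*log₂ n 2≤n))) ⟩
    c * (15 * n * (2 * l * (2 * l)))                ≡⟨ collect c n l ⟩
    c * 60 * (n * (l * l))                          ∎
    where
    x L l S : ℕ
    L = lg n
    l = ⌊log₂ n ⌋
    S = isqrt n
    x = half n * L
    collect : ∀ c n l → c * (15 * n * (2 * l * (2 * l))) ≡ c * 60 * (n * (l * l))
    collect = solve-∀
    expand : ∀ L S → (L + S) * (L + S) ≡ (L * L + S * S) + 2 * (L * S)
    expand = solve-∀
    cross : ∀ L S → L * S ≤ L * L + S * S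
    cross L S with ≤-total L S
    ... | inj₁ L≤S = ≤-trans (*-monoˡ-≤ S L≤S) (m≤n+m _ (L * L))
    ... | inj₂ S≤L = ≤-trans (*-monoʳ-≤ L S≤L) (m≤m+n _ (S * S))
    triple : ∀ y → y + 2 * y ≡ 3 * y
    triple = solve-∀
    fifteen : ∀ n → 3 * (4 * n + n) ≡ 15 * n
    fifteen = solve-∀
    x²≤ : x * x ≤ 15 * n
    x²≤ = begin
      x * x                                         ≤⟨ *-mono-≤ (half*lg≤ n) (half*lg≤ n) ⟩
      (L + S) * (L + S)                             ≡⟨ expand L S ⟩
      (L * L + S * S) + 2 * (L * S)                 ≤⟨ +-monoʳ-≤ (L * L + S * S) (*-monoʳ-≤ 2 (cross L S)) ⟩
      (L * L + S * S) + 2 * (L * L + S * S)         ≡⟨ triple (L * L + S * S) ⟩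
      3 * (L * L + S * S)                           ≤⟨ *-monoʳ-≤ 3 (+-mono-≤ (≤-trans (square≤4*2^ l)
                                                         (*-monoʳ-≤ 4 (log₂-lower n (≤-trans (n≤1+n 1) 2≤n)))) (proj₁ (isqrt-spec n))) ⟩
      3 * (4 * n + n)                               ≡⟨ fifteen n ⟩
      15 * n                                        ∎

n<2^n : ∀ n → n < 2 ^ n
n<2^n zero = s≤s z≤n
n<2^n (suc n) = ≤-trans (+-mono-≤ (m^n>0 2 n) (n<2^n n)) (≤-reflexive (cong (2 ^ n +_) (sym (+-identityʳ (2 ^ n)))))

-- Every factor is bounded by a power of two; with `32 = 2 ^ 5` the exponents add up to
-- `21 + 7 * L`, and since `L ≥ 1` this is at most `32 * L`.
copies-suffice : ∀ l n h → n ≤ 2 ^ suc l → h ≤ 2 ^ suc l →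
  2 * 2 ^ suc l * (n * (n * (7 * (32 * suc l * (2 * (32 * suc l * (32 * suc l) * (2 * h))))))) ≤ 2 ^ (32 * suc l)
copies-suffice l n h n≤ h≤ = begin
  2 * 2 ^ L * (n * (n * (7 * (r * (2 * (r * r * (2 * h)))))))     ≤⟨ *-monoʳ-≤ (2 * 2 ^ L) (*-mono-≤ n≤ (*-mono-≤ n≤ (*-mono-≤ (n≤1+n 7)
                                                                       (*-mono-≤ r≤ (*-monoʳ-≤ 2 (*-mono-≤ (*-mono-≤ r≤ r≤) (*-monoʳ-≤ 2 h≤))))))) ⟩
  2 * 2 ^ L * (2 ^ L * (2 ^ L * (8 * (b * (2 * (b * b * (2 * 2 ^ L)))))))
                                                                  ≡⟨ collect (2 ^ L) b ⟩
  2 ^ 6 * (2 ^ L * 2 ^ L * (2 ^ L * 2 ^ L) * (b * b * b))         ≡⟨ powers ⟩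
  2 ^ (6 + (L + L + (L + L) + (5 + L + (5 + L) + (5 + L))))       ≤⟨ ^-monoʳ-≤ 2 {total} {32 * L} (≤-trans (m≤m+n total (4 + 25 * l)) (≤-reflexive (exponent l))) ⟩
  2 ^ (32 * L)                                                    ∎
  where
  open ≤-Reasoning
  L r b total : ℕ
  L = suc l
  total = 6 + (L + L + (L + L) + (5 + L + (5 + L) + (5 + L)))
  r = 32 * L
  b = 2 ^ (5 + L)
  r≤ : r ≤ b
  r≤ = ≤-trans (*-monoʳ-≤ 32 (<⇒≤ (n<2^n L))) (≤-reflexive (sym (^-distribˡ-+-* 2 5 L)))
  collect : ∀ a b → 2 * a * (a * (a * (8 * (b * (2 * (b * b * (2 * a))))))) ≡ 64 * (a * a * (a * a) * (b * b * b))
  collect = solve-∀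
  exponent : ∀ l → 6 + (suc l + suc l + (suc l + suc l) + (5 + suc l + (5 + suc l) + (5 + suc l))) + (4 + 25 * l) ≡ 32 * suc l
  exponent = solve-∀
  _⊗_ : ∀ {x y a c} → x ≡ 2 ^ a → y ≡ 2 ^ c → x * y ≡ 2 ^ (a + c)
  _⊗_ {a = a} {c} refl refl = sym (^-distribˡ-+-* 2 a c)
  powers : 2 ^ 6 * (2 ^ L * 2 ^ L * (2 ^ L * 2 ^ L) * (b * b * b)) ≡
    2 ^ (6 + (L + L + (L + L) + (5 + L + (5 + L) + (5 + L))))
  powers = _⊗_ {a = 6} {c = L + L + (L + L) + (5 + L + (5 + L) + (5 + L))} refl
    (_⊗_ {a = L + L + (L + L)} {c = 5 + L + (5 + L) + (5 + L)}
      (_⊗_ {a = L + L} {c = L + L} (_⊗_ {a = L} {c = L} refl refl) (_⊗_ {a = L} {c = L} refl refl))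
      (_⊗_ {a = 5 + L + (5 + L)} {c = 5 + L} (_⊗_ {a = 5 + L} {c = 5 + L} refl refl) refl))

module Growth (n r' s' h L j : ℕ) (1≤h : 1 ≤ h) (long : 2 * (suc r' * suc r' * (2 * h)) ≤ suc s')
  (k²≤n : 2 * (suc (suc j) * suc (suc j)) + suc (suc j) ≤ n) (k≤hL : suc (suc j) ≤ h * L)
  (room : 2 * 2 ^ L * (n * (n * (7 * (suc r' * suc s')))) ≤ 2 ^ suc r') where

  open Graph n (suc r') (suc s') (suc r')

  1≤m : 1 ≤ 2 * h
  1≤m = ≤-trans 1≤h (m≤m+n h _)

  open Counting n r' s' (2 * h) 1≤m long using (Q; Y₁; X₁; Z₁)
  open Bound n r' s' (2 * h) 1≤m long using (initial-bound)
  open Bound n r' s' (2 * h) 1≤m long public using (runs)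

  k G : ℕ
  k = suc (suc j)
  G = n * (7 * (suc r' * suc s'))

  1≤Y : 1 ≤ Y₁ k
  1≤Y = *-mono-≤ (1≤n! k) (*-mono-≤ (m^n>0 (2 * h) {{Data.Nat.>-nonZero 1≤m}} k) (m^n>0 2 (suc r')))

  Z≤X : 2 * Z₁ k n G ≤ X₁ k n
  Z≤X = begin
    2 * ((n C k) * suc (2 * h) ^ k * n * G)                   ≤⟨ *-monoʳ-≤ 2 (*-monoˡ-≤ G (*-monoˡ-≤ n (*-monoʳ-≤ (n C k)
                                                                   (power-ratio h L k 1≤h k≤hL)))) ⟩
    2 * ((n C k) * (2 ^ L * (2 * h) ^ k) * n * G)             ≡⟨ regroup (n C k) (2 ^ L) ((2 * h) ^ k) n G ⟩
    (n C k) * ((2 * h) ^ k * (2 * 2 ^ L * (n * G)))           ≤⟨ *-monoʳ-≤ (n C k) (*-monoʳ-≤ ((2 * h) ^ k) room) ⟩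
    (n C k) * ((2 * h) ^ k * 2 ^ suc r')                      ∎
    where
    open ≤-Reasoning
    regroup : ∀ c p x n G → 2 * (c * (p * x) * n * G) ≡ c * (x * (2 * p * (n * G)))
    regroup = solve-∀

  2^≤X : 2 ^ suc j * (2 * Y₁ k) ≤ X₁ k n
  2^≤X = ≤-trans (≤-reflexive (regroup (2 ^ suc j) (k !) (Q k))) (*-monoˡ-≤ (Q k) (C-lower n k k²≤n))
    where
    regroup : ∀ p f q → p * (2 * (f * q)) ≡ 2 * p * f * q
    regroup = solve-∀

  -- `C-lower` provides `2 ^ k` with `k = suc (suc j)`. One factor 2 goes to the error term, the
  -- other to the summand 1 that `total` has beyond the expected switches.
  switches-lower : ∀ {B₀ D} → IsTree B₀ → AllZeroEdges B₀ → RF fullSet B₀ D → ℕtoℚ (2 ^ j) ℚ.≤ expectedSwitches D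
  switches-lower tree zeros rf = drop-one j
    (lowerBound-growth (2 ^ suc j) (initial-bound tree zeros rf k) 1≤Y Z≤X 2^≤X)

-- The final k = suc (suc j) is about √n / 2, so that C(n,k) ≥ 2ᵏ k!.
record Exponent (n : ℕ) : Set where
  field
    j      : ℕ
    k²≤n   : 2 * (suc (suc j) * suc (suc j)) + suc (suc j) ≤ n
    k≤hL   : suc (suc j) ≤ half n * lg n
    isqrt≤8j : isqrt n ≤ j * 8

exponent : ∀ n → 36 ≤ n → Exponent n
exponent n 36≤n = build (halve S)
  where
  S : ℕ
  S = isqrt n
  -- The threshold 36 makes `k` at least 3 and hence `j` positive; no multiple of `j = 0` could
  -- bound `isqrt n`.
  6≤S : 6 ≤ S
  6≤S = sqrt-mono (≤-<-trans 36≤n (proj₂ (isqrt-spec n)))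
  build : (∃ λ k → 2 * k ≤ S × S ≤ suc (2 * k)) → Exponent n
  build (zero , _ , hi) = ⊥-elim (<⇒≱ (≤-trans (m≤m+n 2 4) 6≤S) hi)
  build (suc zero , _ , hi) = ⊥-elim (<⇒≱ (≤-trans (m≤m+n 4 2) 6≤S) hi)
  build (suc (suc zero) , _ , hi) = ⊥-elim (<⇒≱ 6≤S hi)
  build (k@(suc (suc (suc i))) , lo , hi) = record
    { j = suc i
    ; k²≤n = ≤-trans (≤-trans (+-monoʳ-≤ (2 * (k * k)) (≤-trans (m≤m*n k k) (m≤m+n (k * k) _))) (≤-reflexive (square k)))
        (≤-trans (*-mono-≤ lo lo) (proj₁ (isqrt-spec n)))
    ; k≤hL = ≤-trans (≤-trans (m≤m+n k _) lo) (<⇒≤ (isqrt<half*lg n))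
    ; isqrt≤8j = ≤-trans hi (≤-trans (m≤m+n _ (1 + 6 * i)) (≤-reflexive (eight i)))
    }
    where
    square : ∀ k → 2 * (k * k) + 2 * (k * k) ≡ 2 * k * (2 * k)
    square = solve-∀
    -- Origin of the exponent 8 in the theorem: `S ≤ 2 * i + 7` has to be at most a multiple of
    -- `j = suc i`, down to `i = 0`.
    eight : ∀ i → suc (2 * suc (suc (suc i))) + (1 + 6 * i) ≡ suc i * 8
    eight = solve-∀

power-bound : ∀ {n j E} → isqrt n ≤ j * 8 → ℕtoℚ (2 ^ j) ℚ.≤ E → ∀ m → m * m ≤ n → ℕtoℚ (2 ^ m) ℚ.≤ E ^ℚ 8
power-bound {n} {j} {E} small 2^j≤E m m²≤n = ℚP.≤-trans
  (ℕtoℚ-mono-≤ {2 ^ m} {2 ^ (j * 8)} (^-monoʳ-≤ 2 {m} {j * 8} (≤-trans (sqrt-mono {m} {isqrt n} (≤-<-trans m²≤n (proj₂ (isqrt-spec n)))) small)))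
  (subst (λ z → ℕtoℚ z ℚ.≤ E ^ℚ 8) (^-*-assoc 2 j 8) (ℕtoℚ-^ (2 ^ j) 8 2^j≤E))

open import Data.Integer using (+_)

mainTheorem1 : Σ (ℕ → ℕ) λ r → Σ (ℕ → ℕ) λ s → Σ (ℕ → ℕ) λ t →
    (∀ n → 1 ≤ r n) × (∀ n → 1 ≤ s n) × (∀ n → 1 ≤ t n) ×
    ThetaLog r × ThetaSqrtLog s × ThetaLog t ×
    Σ ℕ λ k → 1 ≤ k × Σ ℕ λ n₀ → ∀ n → n₀ ≤ n →
    let open Graph n (r n) (s n) (t n) in
    ∀ (B₀ : EdgeSet) → IsTree B₀ → AllZeroEdges B₀ →
    Σ Dist (RF fullSet B₀) ×
    (∀ D → RF fullSet B₀ D → ∀ m → m * m ≤ n →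
    ((+ (2 ^ m)) / 1) ℚ.≤ (expectedSwitches D ^ℚ k))
mainTheorem1 = copies , pathLength 32 , copies , (λ n → s≤s z≤n) , (λ n → s≤s z≤n) , (λ n → s≤s z≤n) ,
  lg-theta 31 , pathLength-theta 31 , lg-theta 31 , 8 , s≤s z≤n , 36 , λ n 36≤n B₀ tree zeros →
    let open Exponent (exponent n 36≤n)
        open Growth n (pred (copies n)) (pred (pathLength 32 n)) (half n) (lg n) j (s≤s z≤n) ≤-refl k²≤n k≤hL
          (copies-suffice ⌊log₂ n ⌋ n (half n) (<⇒≤ (log₂-upper n)) (half≤2^ n))
    in runs tree , λ D rf → power-bound {n} {j} isqrt≤8j (switches-lower tree zeros rf)
  where
  copies : ℕ → ℕ
  copies n = 32 * lg n
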